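{- Let $\mathsf{N}_n$ be a uniformly random simplex tree-child network with $n$ taxa. For every fixed $R\ge0$ and every finite rooted directed marked graph $G$, the following convergences in probability hold as $n\to\infty$ (a ratio whose denominator is zero being defined as $0$): $$\frac{\#\{u\in V(\mathsf{N}_n):u\text{ is a tree vertex and }U_R(\mathsf{N}_n,u)\cong G\}}{\#\{\text{tree vertices of }\mathsf{N}_n\}}\ \xrightarrow{p}\ \mathbb{P}\bigl(U_R(\hat{\mathcal{L}},p_0)\cong G\bigr),$$ $$\frac{\#\{u\in V(\mathsf{N}_n):u\text{ is a reticulation vertex and }U_R(\mathsf{N}_n,u)\cong G\}}{\#\{\text{reticulation vertices of }\mathsf{N}_n\}}\ \xrightarrow{p}\ \mathbb{P}\bigl(U_R(\hat{\mathcal{R}},\rho_0)\cong G\bigr),$$ $$\frac{\#\{u\in V(\mathsf{N}_n):u\text{ is a leaf and }U_R(\mathsf{N}_n,u)\cong G\}}{\#\{\text{leaves of }\mathsf{N}_n\}}\ \xrightarrow{p}\ \mathbb{P}\bigl(U_R(\hat{\mathsf{N}}^{\mathrm{lf}},\ell_0)\cong G\bigr).$$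
   Context: A simplex tree-child network on a finite set $X$ is a finite directed acyclic graph $N=(V,E)$ with a root $o$ and with leaves bijectively labelled by $X$, such that: the root has (indegree, outdegree) $=(0,1)$; every vertex is reachable from $o$ by a directed path; every leaf has degree $(1,0)$; every vertex that is neither the root nor a leaf is either a tree vertex, of degree $(1,2)$, or a reticulation vertex, of degree $(2,1)$; (tree-child) every non-leaf vertex has at least one child that is a tree vertex or a leaf; (one-component) the unique child of every reticulation vertex is a leaf. Networks are considered up to isomorphism preserving leaf labels. $\mathsf{N}_n$ is uniform on the finite set of simplex tree-child networks with leaf label set $[n]$. Local neighbourhoods: for a directed graph $N$ and $v\in V(N)$, $U_R(N,v)$ is the subgraph induced by the vertices at undirected graph distance at most $R$ from $v$, rooted at $v$. Each vertex carries a mark giving its type in $N$ (root, tree vertex, reticulation, or leaf); leaf labels are ignored. $\cong$ denotes isomorphism of rooted directed marked graphs, i.e. a bijection of vertex sets preserving root, marks, edges and edge orientations. Limit networks (deterministic, so the limiting probabilities are $0$ or $1$). A bi-infinite spine is a bi-infinite directed path $\cdots\to x_{ -1}\to x_0\to x_1\to\cdots$ of tree vertices. To decorate a tree vertex $x$ means: give $x$ a new reticulation child $\rho(x)$; give $\rho(x)$ a new leaf child $\ell(x)$; and give $\rho(x)$ a second parent $w(x)$, which is a tree vertex on a new bi-infinite spine, all of whose vertices other than $w(x)$ are in turn decorated, recursively (the reticulation child of $w(x)$ is $\rho(x)$). All spines and vertices introduced at every level are pairwise distinct. - $\hat{\mathcal{L}}$ is a bi-infinite spine $\cdots\to p_{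 -1}\to p_0\to p_1\to\cdots$ all of whose vertices are decorated, rooted at $p_0$. - $\hat{\mathcal{R}}$ has two disjoint bi-infinite spines $(p_i)_{i\in\mathbb{Z}}$ and $(q_i)_{i\in\mathbb{Z}}$, and a reticulation $\rho_0$ whose two parents are $p_0$ and $q_0$ and whose only child is a leaf $\ell_0$; every $p_i,q_i$ with $i\ne0$ is decorated, while $p_0,q_0$ have $\rho_0$ as their only reticulation child. It is rooted at $\rho_0$. - $\hat{\mathsf{N}}^{\mathrm{lf}}$ is the same directed graph as $\hat{\mathcal{R}}$, rooted at $\ell_0$ instead. -}

module Defs where

open import Data.Bool.Base using (Bool; T; if_then_else_)
open import Data.Bool.Properties using (T?)
open import Data.Empty using (⊥-elim-irr)
open import Data.Fin.Base using (Fin; zero; suc)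
import Data.Fin.Properties as Fin
open import Data.Integer.Base as ℤ using (ℤ; +_; 0ℤ)
import Data.Integer.Properties as ℤ
open import Data.List.Base using (List; []; _∷_; concatMap; allFin; map; _++_)
open import Data.List.Membership.Propositional using (_∈_; find; lose)
open import Data.List.Membership.Propositional.Properties
  using (∈-concatMap⁺; ∈-allFin; ∈-map⁺; ∈-++⁺ʳ)
open import Data.List.Relation.Unary.All as All using (All)
open import Data.List.Relation.Unary.Any using (Any; here; there; any?)
open import Data.Nat.Base as ℕ using (ℕ; zero; suc)
open import Data.Product.Base using (Σ-syntax; ∃; ∃-syntax; _×_; _,_; proj₁; proj₂)
open import Data.Rational.Base as ℚ using (ℚ; 0ℚ; 1ℚ; ∣_∣)
import Data.Rational.Properties as ℚ
open import Data.Refinement.Base using (Refinement; _,_; value)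
open import Data.Irrelevant using ([_])
open import Data.Sum.Base using (_⊎_; inj₁; inj₂)
open import Data.Unit.Base using (⊤; tt)
open import Data.Vec.Base as Vec using (Vec; []; _∷_; lookup; tabulate)
open import Data.Vec.Properties using (lookup∘tabulate)
open import Function.Base using (_∘_)
open import Function.Bundles using (_↔_; _⇔_; Inverse; Equivalence; Bijection; mk↔ₛ′; mk⇔)
import Function.Properties.Inverse as ↔
open import Level using (0ℓ)
open import Relation.Binary.Bundles using (Setoid)
open import Relation.Binary.Construct.Closure.ReflexiveTransitive using (Star)
open import Relation.Binary.Construct.Closure.Symmetric using (SymClosure; fwd; bwd)
open import Relation.Binary.Construct.Closure.Transitive using (TransClosure)
open import Relation.Binary.Definitions using (DecidableEquality)
open import Relation.Binary.PropositionalEquality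
  using (_≡_; _≢_; refl; sym; trans; cong; cong₂; subst; subst₂; setoid)
open import Relation.Nullary.Decidable
  using (Dec; yes; no; does; map′; ¬?; _×-dec_; _⊎-dec_; _→-dec_; recompute)
open import Relation.Nullary.Negation using (¬_)
open import Relation.Unary using (Decidable)

data Mark : Set where
  root tree reticulation leaf : Mark

_≟ᵐ_ : DecidableEquality Mark
root         ≟ᵐ root         = yes refl
root         ≟ᵐ tree         = no λ ()
root         ≟ᵐ reticulation = no λ ()
root         ≟ᵐ leaf         = no λ ()
tree         ≟ᵐ root         = no λ ()
tree         ≟ᵐ tree         = yes refl
tree         ≟ᵐ reticulation = no λ ()
tree         ≟ᵐ leaf         = no λ ()
reticulation ≟ᵐ root         = no λ ()
reticulation ≟ᵐ tree         = no λ ()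
reticulation ≟ᵐ reticulation = yes refl
reticulation ≟ᵐ leaf         = no λ ()
leaf         ≟ᵐ root         = no λ ()
leaf         ≟ᵐ tree         = no λ ()
leaf         ≟ᵐ reticulation = no λ ()
leaf         ≟ᵐ leaf         = yes refl

record MarkedGraph : Set₁ where
  infix 4 _⟶_
  field
    Vertex : Set
    _⟶_    : Vertex → Vertex → Set
    mark   : Vertex → Mark

  -- Within r v w : some undirected walk of at most r edges joins v to w,
  -- i.e. the undirected graph distance is at most r.
  data Within : ℕ → Vertex → Vertex → Set where
    here : ∀ {r v} → Within r v v
    step : ∀ {r v u w} → SymClosure _⟶_ v u → Within r u w → Within (suc r) v w

record RootedGraph : Set₁ where
  field
    graph : MarkedGraph
    point : MarkedGraph.Vertex graph
  open MarkedGraph graph public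

-- The subgraph induced by the vertices at distance at most r from v.
-- Membership is proof-irrelevant, so two vertices of the ball are equal as
-- soon as they are equal in Γ.
ball : (Γ : MarkedGraph) → ℕ → MarkedGraph.Vertex Γ → RootedGraph
ball Γ r v = record
  { graph = record
    { Vertex = Refinement Vertex (Within r v)
    ; _⟶_    = λ x y → value x ⟶ value y
    ; mark   = mark ∘ value
    }
  ; point = v , [ here ]
  }
  where open MarkedGraph Γ

infix 4 _≅_
record _≅_ (Γ Δ : RootedGraph) : Set where
  private
    module Γ = RootedGraph Γ
    module Δ = RootedGraph Δ
  field
    vertices : Γ.Vertex ↔ Δ.Vertex
  open Inverse vertices public using (to; from)
  field
    point-≡ : to Γ.point ≡ Δ.point
    mark-≡  : ∀ x → Δ.mark (to x) ≡ Γ.mark x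
    edge-⇔  : ∀ x y → (x Γ.⟶ y) ⇔ (to x Δ.⟶ to y)

record FiniteGraph : Set where
  field
    size  : ℕ
    edge  : Fin size → Fin size → Bool
    mark  : Fin size → Mark
    point : Fin size

  rooted : RootedGraph
  rooted = record
    { graph = record { Vertex = Fin size ; _⟶_ = λ u v → T (edge u v) ; mark = mark }
    ; point = point
    }

record LocallyFinite (Γ : MarkedGraph) : Set where
  open MarkedGraph Γ
  infix 4 _≟_ _⟶?_
  field
    _≟_   : DecidableEquality Vertex
    _⟶?_  : ∀ u v → Dec (u ⟶ v)
    -- A finite list containing, possibly strictly, all the neighbours.
    near  : Vertex → List Vertex
    near⁺ : ∀ {u v} → SymClosure _⟶_ u v → v ∈ near u

private
  _⇔-dec_ : ∀ {A B : Set} → Dec A → Dec B → Dec (A ⇔ B)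
  a? ⇔-dec b? = map′ (λ (f , g) → mk⇔ f g) (λ e → Equivalence.to e , Equivalence.from e)
                     ((a? →-dec b?) ×-dec (b? →-dec a?))

  anyVec? : ∀ {A : Set} (xs : List A) k {P : Vec A k → Set} → Decidable P →
            Dec (∃ λ w → (∀ i → lookup w i ∈ xs) × P w)
  anyVec? xs zero    P? = map′ (λ p → [] , (λ ()) , p) (λ { ([] , _ , p) → p }) (P? [])
  anyVec? xs (suc k) {P} P? = map′ extend restrict (any? (λ x → anyVec? xs k (P? ∘ (x ∷_))) xs)
    where
    extend : Any (λ x → ∃ λ w → (∀ i → lookup w i ∈ xs) × P (x ∷ w)) xs →
             ∃ λ w → (∀ i → lookup w i ∈ xs) × P w
    extend a with find a
    ... | x , x∈ , w , w∈ , p = x ∷ w , (λ { zero → x∈ ; (suc i) → w∈ i }) , p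
    restrict : (∃ λ w → (∀ i → lookup w i ∈ xs) × P w) →
               Any (λ x → ∃ λ w → (∀ i → lookup w i ∈ xs) × P (x ∷ w)) xs
    restrict (x ∷ w , w∈ , p) = lose (w∈ zero) (w , w∈ ∘ suc , p)

module _ {Γ : MarkedGraph} (lf : LocallyFinite Γ) where
  open MarkedGraph Γ
  open LocallyFinite lf

  private
    adjacent? : ∀ u v → Dec (SymClosure _⟶_ u v)
    adjacent? u v = map′ (λ { (inj₁ e) → fwd e ; (inj₂ e) → bwd e })
                         (λ { (fwd e) → inj₁ e ; (bwd e) → inj₂ e })
                         ((u ⟶? v) ⊎-dec (v ⟶? u))

  within? : ∀ r v w → Dec (Within r v w)
  within? zero    v w = map′ (λ { refl → here }) (λ { here → refl }) (v ≟ w)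
  within? (suc r) v w =
    map′ join split ((v ≟ w) ⊎-dec any? (λ u → adjacent? v u ×-dec within? r u w) (near v))
    where
    Via : Vertex → Set
    Via u = SymClosure _⟶_ v u × Within r u w
    join : v ≡ w ⊎ Any Via (near v) → Within (suc r) v w
    join (inj₁ refl) = here
    join (inj₂ a) with find a
    ... | _ , _ , e , p = step e p
    split : Within (suc r) v w → v ≡ w ⊎ Any Via (near v)
    split here       = inj₁ refl
    split (step e p) = inj₂ (lose (near⁺ e) (e , p))

  private
    candidates : ℕ → Vertex → List Vertex
    candidates zero    v = v ∷ []
    candidates (suc r) v = v ∷ concatMap (candidates r) (near v)

    candidates⁺ : ∀ {r v w} → Within r v w → w ∈ candidates r v
    candidates⁺ {zero}  here       = here refl
    candidates⁺ {suc r} here       = here refl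
    candidates⁺ {suc r} (step e p) =
      there (∈-concatMap⁺ (candidates r) (lose (near⁺ e) (candidates⁺ p)))

  module _ (r : ℕ) (v : Vertex) (G : FiniteGraph) where
    private
      module G = FiniteGraph G

      record Labelling (f : Fin G.size → Vertex) : Set where
        field
          inside     : ∀ i → Within r v (f i)
          injective  : ∀ i j → f i ≡ f j → i ≡ j
          surjective : All (λ w → Within r v w → ∃ λ i → f i ≡ w) (candidates r v)
          point-≡    : f G.point ≡ v
          mark-≡     : ∀ i → mark (f i) ≡ G.mark i
          edge-⇔     : ∀ i j → (f i ⟶ f j) ⇔ T (G.edge i j)

      open Labelling

      labelling? : ∀ f → Dec (Labelling f)
      labelling? f = map′
        (λ (a , b , c , d , e , g) → record
          { inside = a ; injective = b ; surjective = c ; point-≡ = d ; mark-≡ = e ; edge-⇔ = g })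
        (λ l → inside l , injective l , surjective l , point-≡ l , mark-≡ l , edge-⇔ l)
        ( Fin.all? (λ i → within? r v (f i))
        ×-dec Fin.all? (λ i → Fin.all? (λ j → (f i ≟ f j) →-dec (i Fin.≟ j)))
        ×-dec All.all? (λ w → within? r v w →-dec Fin.any? (λ i → f i ≟ w)) (candidates r v)
        ×-dec (f G.point ≟ v)
        ×-dec Fin.all? (λ i → mark (f i) ≟ᵐ G.mark i)
        ×-dec Fin.all? (λ i → Fin.all? (λ j → (f i ⟶? f j) ⇔-dec T? (G.edge i j))) )

      value-injective : (x y : RootedGraph.Vertex (ball Γ r v)) → value x ≡ value y → x ≡ y
      value-injective _ _ refl = refl

      value-within : (x : RootedGraph.Vertex (ball Γ r v)) → Within r v (value x)
      value-within (w , [ p ]) = recompute (within? r v w) p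

      fromLabelling : ∀ {f} → Labelling f → ball Γ r v ≅ G.rooted
      fromLabelling {f} l = record
        { vertices = mk↔ₛ′ index (λ i → f i , [ inside l i ])
            (λ i → injective l _ _ (index-≡ (f i , [ inside l i ])))
            (λ x → value-injective (f (index x) , [ inside l (index x) ]) x (index-≡ x))
        ; point-≡ = injective l _ _ (trans (index-≡ (v , [ here ])) (sym (point-≡ l)))
        ; mark-≡  = λ x → trans (sym (mark-≡ l _)) (cong mark (index-≡ x))
        ; edge-⇔  = λ x y → subst₂ (λ a b → (a ⟶ b) ⇔ T (G.edge (index x) (index y)))
                              (index-≡ x) (index-≡ y) (edge-⇔ l _ _)
        }
        where
        preimage : (x : RootedGraph.Vertex (ball Γ r v)) → ∃ λ i → f i ≡ value x
        preimage x = All.lookup (surjective l) (candidates⁺ (value-within x)) (value-within x)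
        index = proj₁ ∘ preimage
        index-≡ = proj₂ ∘ preimage

      toLabelling : (φ : ball Γ r v ≅ G.rooted) →
                    Labelling (lookup (tabulate (value ∘ _≅_.from φ)))
      toLabelling φ = record
        { inside     = within
        ; injective  = λ i j eq → trans (sym (inverseˡ refl))
                         (trans (cong to (value-injective (from i) (from j) (trans (sym (f≡ i)) (trans eq (f≡ j)))))
                                (inverseˡ refl))
        ; surjective = All.tabulate λ {w} _ p →
                         to (w , [ p ]) , trans (f≡ _) (cong value (inverseʳ refl))
        ; point-≡    = trans (f≡ _) (cong value (inverseʳ (sym φ.point-≡)))
        ; mark-≡     = λ i → trans (cong mark (f≡ i))
                               (trans (sym (φ.mark-≡ _)) (cong G.mark (inverseˡ refl)))
        ; edge-⇔     = λ i j → subst₂ (λ a b → (a ⟶ b) ⇔ T (G.edge i j)) (sym (f≡ i)) (sym (f≡ j))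
                         (subst₂ (λ a b → (value (from i) ⟶ value (from j)) ⇔ T (G.edge a b))
                           (inverseˡ refl) (inverseˡ refl) (φ.edge-⇔ _ _))
        }
        where
        module φ = _≅_ φ
        open Inverse φ.vertices using (to; from; inverseˡ; inverseʳ)
        f≡ : ∀ i → lookup (tabulate (value ∘ from)) i ≡ value (from i)
        f≡ = lookup∘tabulate (value ∘ from)
        within : ∀ i → Within r v (lookup (tabulate (value ∘ from)) i)
        within i = subst (Within r v) (sym (f≡ i))
          (value-within (from i))

    ball≅? : Dec (ball Γ r v ≅ G.rooted)
    ball≅? = map′
      (λ (w , _ , l) → fromLabelling l)
      (λ φ → let l = toLabelling φ in
        tabulate (value ∘ _≅_.from φ) , (λ i → candidates⁺ (inside l i)) , l)
      (anyVec? (candidates r v) G.size (labelling? ∘ lookup))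

# : ∀ {m} {P : Fin m → Set} → Decidable P → ℕ
# {m} P? = Vec.count P? (Vec.allFin m)

-- (indegree, outdegree)
degrees : Mark → ℕ × ℕ
degrees root         = 0 , 1
degrees tree         = 1 , 2
degrees reticulation = 2 , 1
degrees leaf         = 1 , 0

-- The degrees determine the mark of each vertex, so that mark is not additional
-- structure on the underlying directed graph.
record Network (n : ℕ) : Set where
  field
    size : ℕ
    edge : Fin size → Fin size → Bool
    mark : Fin size → Mark

  graph : MarkedGraph
  graph = record { Vertex = Fin size ; _⟶_ = λ u v → T (edge u v) ; mark = mark }

  open MarkedGraph graph public hiding (mark)

  indegree : Vertex → ℕ
  indegree v = # (λ u → T? (edge u v))

  outdegree : Vertex → ℕ
  outdegree v = # (λ w → T? (edge v w))

  field
    origin        : Vertex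
    origin-root   : ∀ v → mark v ≡ root ⇔ v ≡ origin
    degrees-≡     : ∀ v → (indegree v , outdegree v) ≡ degrees (mark v)
    acyclic       : ∀ v → ¬ TransClosure _⟶_ v v
    reachable     : ∀ v → Star _⟶_ origin v
    taxa          : Fin n ↔ (∃ λ v → mark v ≡ leaf)
    tree-child    : ∀ v → mark v ≢ leaf →
                    ∃ λ w → (v ⟶ w) × (mark w ≡ tree ⊎ mark w ≡ leaf)
    one-component : ∀ {v w} → mark v ≡ reticulation → v ⟶ w → mark w ≡ leaf

  taxon : Fin n → Vertex
  taxon = proj₁ ∘ Inverse.to taxa

  locallyFinite : LocallyFinite graph
  locallyFinite = record
    { _≟_   = Fin._≟_
    ; _⟶?_  = λ u v → T? (edge u v)
    ; near  = λ _ → allFin size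
    ; near⁺ = λ _ → ∈-allFin _
    }

-- Isomorphisms automatically respect the origin and the marks, by degrees.
record _≈_ {n} (M N : Network n) : Set where
  private
    module M = Network M
    module N = Network N
  field
    vertices : M.Vertex ↔ N.Vertex
  open Inverse vertices public using (to)
  field
    edge-≡  : ∀ u v → N.edge (to u) (to v) ≡ M.edge u v
    taxon-≡ : ∀ i → to (M.taxon i) ≡ N.taxon i

private
  ≈-refl : ∀ {n} {M : Network n} → M ≈ M
  ≈-refl = record { vertices = ↔.↔-refl ; edge-≡ = λ _ _ → refl ; taxon-≡ = λ _ → refl }

  ≈-sym : ∀ {n} {M N : Network n} → M ≈ N → N ≈ M
  ≈-sym {N = N} φ = record
    { vertices = ↔.↔-sym vertices
    ; edge-≡   = λ u v → trans (sym (edge-≡ _ _))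
                   (cong₂ (Network.edge N) (inverseˡ refl) (inverseˡ refl))
    ; taxon-≡  = λ i → inverseʳ (sym (taxon-≡ i))
    }
    where
    open _≈_ φ
    open Inverse vertices using (inverseˡ; inverseʳ)

  ≈-trans : ∀ {n} {L M N : Network n} → L ≈ M → M ≈ N → L ≈ N
  ≈-trans φ ψ = record
    { vertices = ↔.↔-trans φ.vertices ψ.vertices
    ; edge-≡   = λ u v → trans (ψ.edge-≡ _ _) (φ.edge-≡ u v)
    ; taxon-≡  = λ i → trans (cong ψ.to (φ.taxon-≡ i)) (ψ.taxon-≡ i)
    }
    where
    module φ = _≈_ φ
    module ψ = _≈_ ψ

networks : ℕ → Setoid _ _
networks n = record
  { Carrier       = Network n
  ; _≈_           = _≈_
  ; isEquivalence = record { refl = ≈-refl ; sym = ≈-sym ; trans = ≈-trans }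
  }

-- Each isomorphism class of networks on n taxa is listed exactly once.
record Enumeration (n : ℕ) : Set where
  field
    total   : ℕ
    classes : Bijection (setoid (Fin total)) (networks n)
  network : Fin total → Network n
  network = Bijection.to classes

ratio : ℕ → ℕ → ℚ
ratio a zero    = 0ℚ
ratio a (suc b) = + a ℚ./ suc b

-- The probability of an event about a deterministic object.
𝟙 : ∀ {A : Set} → Dec A → ℚ
𝟙 a? = if does a? then 1ℚ else 0ℚ

ℙ : ∀ {n} → Enumeration n → {A : Network n → Set} → Decidable A → ℚ
ℙ E A? = ratio (# (A? ∘ network)) total
  where open Enumeration E

ConvergesInProbability : (∀ n → Enumeration n) → (∀ {n} → Network n → ℚ) → ℚ → Set
ConvergesInProbability E X c =
  ∀ ε δ → 0ℚ ℚ.< ε → 0ℚ ℚ.< δ →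
  ∃[ n₀ ] ∀ n → n₀ ℕ.≤ n → ℙ (E n) (λ N → ε ℚ.<? ∣ X N ℚ.- c ∣) ℚ.≤ δ

proportion : Mark → ℕ → FiniteGraph → ∀ {n} → Network n → ℚ
proportion k r G N = ratio
  (# (λ u → (mark u ≟ᵐ k) ×-dec ball≅? locallyFinite r u G))
  (# (λ u → mark u ≟ᵐ k))
  where open Network N

-- B indexes the initial spines, and D is the set of their decorated positions.
module Decoration (B : Set) (D : ℤ → Set) where

  data Spine : Set
  Decorated : Spine → ℤ → Set

  -- side s i is the new spine that arises from decorating the vertex at
  -- position i of s; its own vertex w, which shares the new reticulation, is at
  -- position 0.
  data Spine where
    initial : B → Spine
    side    : (s : Spine) (i : ℤ) → .(Decorated s i) → Spine

  Decorated (initial _)  i = D i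
  Decorated (side _ _ _) i = i ≢ 0ℤ

  data Vertex : Set where
    x   : Spine → ℤ → Vertex
    ρ ℓ : (s : Spine) (i : ℤ) → .(Decorated s i) → Vertex

  data _⟶_ : Vertex → Vertex → Set where
    along : ∀ {s i j} → j ≡ ℤ.suc i → x s i ⟶ x s j
    x⟶ρ   : ∀ {s i} .{d : Decorated s i} → x s i ⟶ ρ s i d
    w⟶ρ   : ∀ {s i} .{d : Decorated s i} → x (side s i d) 0ℤ ⟶ ρ s i d
    ρ⟶ℓ   : ∀ {s i} .{d : Decorated s i} → ρ s i d ⟶ ℓ s i d

  graph : MarkedGraph
  graph = record
    { Vertex = Vertex
    ; _⟶_    = _⟶_
    ; mark   = λ { (x _ _) → tree ; (ρ _ _ _) → reticulation ; (ℓ _ _ _) → leaf }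
    }

  module _ (_≟ᴮ_ : DecidableEquality B) (D? : Decidable D) where
    private
      decorated? : ∀ s i → Dec (Decorated s i)
      decorated? (initial _)  i = D? i
      decorated? (side _ _ _) i = ¬? (i ℤ.≟ 0ℤ)

      _≟ˢ_ : DecidableEquality Spine
      initial b  ≟ˢ initial c  = map′ (cong initial) (λ { refl → refl }) (b ≟ᴮ c)
      initial _  ≟ˢ side _ _ _ = no λ ()
      side _ _ _ ≟ˢ initial _  = no λ ()
      side s i _ ≟ˢ side t j _ =
        map′ (λ { (refl , refl) → refl }) (λ { refl → refl , refl }) (s ≟ˢ t ×-dec i ℤ.≟ j)

      _≟ᵛ_ : DecidableEquality Vertex
      x s i   ≟ᵛ x t j   = map′ (λ { (refl , refl) → refl }) (λ { refl → refl , refl }) (s ≟ˢ t ×-dec i ℤ.≟ j)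
      x _ _   ≟ᵛ ρ _ _ _ = no λ ()
      x _ _   ≟ᵛ ℓ _ _ _ = no λ ()
      ρ _ _ _ ≟ᵛ x _ _   = no λ ()
      ρ s i _ ≟ᵛ ρ t j _ = map′ (λ { (refl , refl) → refl }) (λ { refl → refl , refl }) (s ≟ˢ t ×-dec i ℤ.≟ j)
      ρ _ _ _ ≟ᵛ ℓ _ _ _ = no λ ()
      ℓ _ _ _ ≟ᵛ x _ _   = no λ ()
      ℓ _ _ _ ≟ᵛ ρ _ _ _ = no λ ()
      ℓ s i _ ≟ᵛ ℓ t j _ = map′ (λ { (refl , refl) → refl }) (λ { refl → refl , refl }) (s ≟ˢ t ×-dec i ℤ.≟ j)

      _⟶?_ : ∀ u v → Dec (u ⟶ v)
      x s i   ⟶? x t j   = map′ (λ { (refl , e) → along e }) (λ { (along e) → refl , e })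
                             (s ≟ˢ t ×-dec j ℤ.≟ ℤ.suc i)
      x s i   ⟶? ρ t j d = map′
        (λ { (inj₁ (refl , refl)) → x⟶ρ ; (inj₂ (refl , refl)) → w⟶ρ })
        (λ { x⟶ρ → inj₁ (refl , refl) ; w⟶ρ → inj₂ (refl , refl) })
        ((s ≟ˢ t ×-dec i ℤ.≟ j) ⊎-dec (s ≟ˢ side t j d ×-dec i ℤ.≟ 0ℤ))
      x _ _   ⟶? ℓ _ _ _ = no λ ()
      ρ _ _ _ ⟶? x _ _   = no λ ()
      ρ _ _ _ ⟶? ρ _ _ _ = no λ ()
      ρ s i _ ⟶? ℓ t j _ = map′ (λ { (refl , refl) → ρ⟶ℓ }) (λ { ρ⟶ℓ → refl , refl })
                             (s ≟ˢ t ×-dec i ℤ.≟ j)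
      ℓ _ _ _ ⟶? x _ _   = no λ ()
      ℓ _ _ _ ⟶? ρ _ _ _ = no λ ()
      ℓ _ _ _ ⟶? ℓ _ _ _ = no λ ()

      own : ∀ s i → List Vertex
      own s i with decorated? s i
      ... | yes d = ρ s i d ∷ []
      ... | no _  = []

      own⁺ : ∀ s i .(d : Decorated s i) → ρ s i d ∈ own s i
      own⁺ s i d with decorated? s i
      ... | yes _ = here refl
      ... | no ¬d = ⊥-elim-irr (¬d d)

      opposite : Spine → List Vertex
      opposite (initial _)  = []
      opposite (side s i d) = ρ s i d ∷ []

      near : Vertex → List Vertex
      near (x s i)   = x s (ℤ.suc i) ∷ x s (ℤ.pred i) ∷ opposite s ++ own s i
      near (ρ s i d) = x s i ∷ x (side s i d) 0ℤ ∷ ℓ s i d ∷ []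
      near (ℓ s i d) = ρ s i d ∷ []

      near⁺ : ∀ {u v} → SymClosure _⟶_ u v → v ∈ near u
      near⁺ (fwd (along refl)) = here refl
      near⁺ {x s _} (bwd (along {i = i} refl)) = there (here (cong (x s) (sym (ℤ.pred-suc i))))
      near⁺ {x s i} (fwd (x⟶ρ {d = d})) = there (there (∈-++⁺ʳ (opposite s) (own⁺ s i d)))
      near⁺ (bwd x⟶ρ) = here refl
      near⁺ (fwd w⟶ρ) = there (there (here refl))
      near⁺ (bwd w⟶ρ) = there (here refl)
      near⁺ (fwd ρ⟶ℓ) = there (there (here refl))
      near⁺ (bwd ρ⟶ℓ) = here refl

    locallyFinite : LocallyFinite graph
    locallyFinite = record { _≟_ = _≟ᵛ_ ; _⟶?_ = _⟶?_ ; near = near ; near⁺ = near⁺ }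

module 𝓛 where
  open Decoration ⊤ (λ _ → ⊤) public using (Vertex; graph; x; initial)

  p₀ : Vertex
  p₀ = x (initial tt) 0ℤ

  locallyFinite : LocallyFinite graph
  locallyFinite = Decoration.locallyFinite _ _ (λ _ _ → yes refl) (λ _ → yes tt)

-- The common underlying graph of the limit networks rooted at ρ₀ and at ℓ₀.
module 𝓡 where
  data Name : Set where
    p q : Name

  module S = Decoration Name (_≢ 0ℤ)

  data Vertex : Set where
    old   : S.Vertex → Vertex
    ρ₀ ℓ₀ : Vertex

  data _⟶_ : Vertex → Vertex → Set where
    old   : ∀ {u v} → u S.⟶ v → old u ⟶ old v
    to-ρ₀ : ∀ {b} → old (S.x (S.initial b) 0ℤ) ⟶ ρ₀
    to-ℓ₀ : ρ₀ ⟶ ℓ₀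

  graph : MarkedGraph
  graph = record
    { Vertex = Vertex
    ; _⟶_    = _⟶_
    ; mark   = λ { (old v) → MarkedGraph.mark S.graph v ; ρ₀ → reticulation ; ℓ₀ → leaf }
    }

  private
    _≟ᴮ_ : DecidableEquality Name
    p ≟ᴮ p = yes refl
    p ≟ᴮ q = no λ ()
    q ≟ᴮ p = no λ ()
    q ≟ᴮ q = yes refl

    module F = LocallyFinite (S.locallyFinite _≟ᴮ_ (λ i → ¬? (i ℤ.≟ 0ℤ)))

    foot : Name → S.Vertex
    foot b = S.x (S.initial b) 0ℤ

    _≟_ : DecidableEquality Vertex
    old u ≟ old v = map′ (cong old) (λ { refl → refl }) (u F.≟ v)
    old _ ≟ ρ₀    = no λ ()
    old _ ≟ ℓ₀    = no λ ()
    ρ₀    ≟ old _ = no λ ()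
    ρ₀    ≟ ρ₀    = yes refl
    ρ₀    ≟ ℓ₀    = no λ ()
    ℓ₀    ≟ old _ = no λ ()
    ℓ₀    ≟ ρ₀    = no λ ()
    ℓ₀    ≟ ℓ₀    = yes refl

    _⟶?_ : ∀ u v → Dec (u ⟶ v)
    old u ⟶? old v = map′ old (λ { (old e) → e }) (u F.⟶? v)
    old u ⟶? ρ₀    = map′ (λ { (inj₁ refl) → to-ρ₀ ; (inj₂ refl) → to-ρ₀ })
                          (λ { (to-ρ₀ {p}) → inj₁ refl ; (to-ρ₀ {q}) → inj₂ refl })
                          ((u F.≟ foot p) ⊎-dec (u F.≟ foot q))
    old _ ⟶? ℓ₀    = no λ ()
    ρ₀    ⟶? old _ = no λ ()
    ρ₀    ⟶? ρ₀    = no λ ()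
    ρ₀    ⟶? ℓ₀    = yes to-ℓ₀
    ℓ₀    ⟶? old _ = no λ ()
    ℓ₀    ⟶? ρ₀    = no λ ()
    ℓ₀    ⟶? ℓ₀    = no λ ()

    near : Vertex → List Vertex
    near (old v) = ρ₀ ∷ map old (F.near v)
    near ρ₀      = ℓ₀ ∷ old (foot p) ∷ old (foot q) ∷ []
    near ℓ₀      = ρ₀ ∷ []

    near⁺ : ∀ {u v} → SymClosure _⟶_ u v → v ∈ near u
    near⁺ (fwd (old e))     = there (∈-map⁺ old (F.near⁺ (fwd e)))
    near⁺ (bwd (old e))     = there (∈-map⁺ old (F.near⁺ (bwd e)))
    near⁺ (fwd to-ρ₀)       = here refl
    near⁺ (bwd (to-ρ₀ {p})) = there (here refl)
    near⁺ (bwd (to-ρ₀ {q})) = there (there (here refl))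
    near⁺ (fwd to-ℓ₀)       = here refl
    near⁺ (bwd to-ℓ₀)       = here refl

  locallyFinite : LocallyFinite graph
  locallyFinite = record { _≟_ = _≟_ ; _⟶?_ = _⟶?_ ; near = near ; near⁺ = near⁺ }

{-# OPTIONS --safe #-}
-- The limits are deterministic, so it suffices that the expected number of vertices
-- with an exceptional neighbourhood is o(n).
--
-- Deleting the reticulations and their leaves turns a network into a binary tree, in
-- which the two parents of the reticulation i become unary vertices labelled (i , 0)
-- and (i , 1). Drawing this tree in the plane involves 2^(m-1) choices, where m is
-- the number of its leaves, and numbering the parents involves 2^(n-m) choices. As
-- the labels break all symmetries, every network has exactly 2^(n-1) such codes, and
-- a uniform network is the network of a uniform code. A vertex is exceptional only if
-- a root, a leaf or branching of the tree, or a reticulation on a short cycle is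
-- nearby, so there are O(m + #short cycles) exceptional vertices.
--
-- Few tree leaves: choose a leaf i of the tree and a branching above it, with
-- subtrees l ∋ i and r. Replace the branching by (i , 1) above l, and in l replace the
-- leaf i by (i , 0) above r. The result, i and one bit determine the original, so the
-- expected sum of the depths of the leaves is at most 2n. A binary tree with m leaves
-- has depth sum at least m log₂ m, hence E m = o(n).
--
-- Few short cycles: let a path of bounded length join the parents of i and avoid i.
-- Exchange the labels (i , 1) and (j , 1), where the path does not pass through j. In
-- the new code the same sequence of moves leads from (i , 0) to (j , 1), so j can be
-- recovered. There are n - m - O(1) choices of j, hence E #short cycles = O(1 + E m).
--
-- Away from the exceptional vertices the limit network maps to the network by a local
-- isomorphism, which is injective on balls because a closed walk without backtracking
-- would contain a short cycle through some reticulation.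

module Submission where

open import Defs
open import Data.Bool.Base using (Bool; true; false; not; T; if_then_else_)
open import Data.Bool.Properties as Bool using (T?) renaming (_≟_ to _≟ᵇ_)
open import Data.Empty using (⊥; ⊥-elim; ⊥-elim-irr)
open import Data.Fin.Base as Fin using (Fin; zero; suc)
import Data.Fin.Properties as Fin
open import Data.List.Base as List
  using (List; []; _∷_; map; _++_; concatMap; allFin; length; filter; cartesianProductWith; replicate;
    deduplicate)
open import Data.List.Properties
  using (length-map; length-++; length-tabulate; map-++; map-∘; map-cong; ++-conicalˡ; ++-conicalʳ;
    length-replicate)
open import Data.List.Membership.Propositional using (_∈_; _∉_; find; lose)
open import Data.List.Membership.Propositional.Properties
  using (∈-map⁺; ∈-map⁻; ∈-++⁺ˡ; ∈-++⁺ʳ; ∈-++⁻; ∈-filter⁺; ∈-filter⁻; ∈-allFin; ∈-concatMap⁺;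
    ∈-concatMap⁻; ∈-∃++; ∈-lookup; ∈-cartesianProductWith⁺; ∈-cartesianProductWith⁻; ∈-deduplicate⁺;
    ∈-deduplicate⁻)
open import Data.List.Relation.Unary.All as All using (All; []; _∷_)
open import Data.List.Relation.Unary.AllPairs as AllPairs using ([]; _∷_)
open import Data.List.Relation.Unary.Any as Any using (Any; here; there; any?)
open import Data.List.Relation.Unary.Unique.Propositional using (Unique)
import Data.List.Relation.Unary.Unique.Propositional.Properties as Unique
open import Data.Maybe.Base using (Maybe; just; nothing; fromMaybe; _<∣>_) renaming (map to mapᴹ)
open import Data.Nat.Base as ℕ using (ℕ; zero; suc; _+_; _*_; _∸_; _^_; _≤_; _<_; z≤n; s≤s)
import Data.Nat.Properties as ℕ
open import Data.Nat.Tactic.RingSolver using (solve-∀)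
open import Data.Product.Base using (Σ-syntax; ∃; _×_; _,_; proj₁; proj₂; uncurry)
open import Data.Sum.Base using (_⊎_; inj₁; inj₂; [_,_]′)
open import Data.Unit.Base using (⊤; tt)
open import Data.Vec.Base as Vec using (Vec; []; _∷_)
import Data.Vec.Properties as Vec
open import Function.Base using (_∘_; id; flip; case_of_)
open import Function.Bundles using (_↔_; Inverse; Equivalence; mk↔ₛ′; mk⇔)
open import Relation.Binary.Definitions using (DecidableEquality; tri<; tri≈; tri>)
open import Relation.Binary.PropositionalEquality
  using (_≡_; _≢_; refl; sym; trans; cong; cong₂; subst; subst₂; module ≡-Reasoning)
open import Relation.Nullary.Decidable
  using (Dec; yes; no; does; map′; ¬?; _×-dec_; _⊎-dec_; recompute; decidable-stable)
open import Relation.Nullary.Negation using (¬_; contradiction)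
open import Relation.Unary using (Decidable)
import Data.Product.Properties as Product
open import Data.Sum.Properties as Sum using (inj₂-injective)
open import Data.List.Relation.Unary.Any.Properties using (lookup-index)
open import Relation.Binary.Construct.Closure.ReflexiveTransitive using (Star; ε; _◅_; _◅◅_)
open import Relation.Binary.Construct.Closure.Transitive as Plus using (TransClosure; [_]; _∷_; _∷ʳ_)
open import Relation.Binary.PropositionalEquality.WithK using (≡-irrelevant)
open import Data.Fin.Induction using (spo-noetherian)
open import Induction.WellFounded using (Acc; acc)
import Relation.Binary.PropositionalEquality.Properties as ≡
open import Data.List.Relation.Unary.Unique.DecPropositional.Properties using (deduplicate-!)
open import Data.Nat.Induction using (<-wellFounded)
open import Data.Irrelevant using ([_])
open import Data.Refinement.Base as Refinement using (value)
open import Relation.Binary.Construct.Closure.Symmetric using (SymClosure; fwd; bwd)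
import Function.Properties.Inverse as ↔
open import Data.Integer.Base as ℤ using (ℤ; -[1+_]; 0ℤ) renaming (+_ to pos)
import Data.Integer.Properties as ℤ
import Data.Integer.Tactic.RingSolver as ℤ-Solver
open import Data.Rational.Base as ℚ using (ℚ; mkℚ; 0ℚ; 1ℚ; ∣_∣; toℚᵘ)
import Data.Rational.Properties as ℚ
open import Data.Rational.Unnormalised.Base as ℚᵘ using (mkℚᵘ; *≤*; *<*; *≡*)
import Data.Rational.Unnormalised.Properties as ℚᵘ

-- No asymptotics for the number of networks enter: every estimate compares codes on n taxa with
-- codes on n taxa by an injection, and the common number of codes per network cancels. The depth
-- argument gives k E m ≤ 2 n + 2^k for every k, so that a large constant k takes the place of the
-- logarithm. Both limits are the same infinite tree seen from different vertices. Three moves act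
-- on its tree vertices: down and up the spine, which are inverse to each other, and across the
-- reticulation, which is an involution. The tree vertices thus form a free orbit of Z * Z/2. The
-- same moves act on the labels of a code wherever the neighbouring vertices carry labels too, so
-- the local comparison becomes a statement about reduced words: away from tips, forks and short
-- cycles, no nonempty reduced word of bounded length fixes a label. `Closes` covers only the cycles
-- that cross the reticulation `i` just once. This is what makes the exchange of labels work, and an
-- induction on the length shows that no other closed walks need to be excluded.

variable
  A B C : Set
  n : ℕ

-- Finite sums and counting

⟦_⟧ : ∀ {P : Set} → Dec P → ℕ
⟦ P? ⟧ = if does P? then 1 else 0

∑ : List A → (A → ℕ) → ℕ
∑ []       f = 0
∑ (x ∷ xs) f = f x + ∑ xs f

∑-mono : ∀ {f g : A → ℕ} (xs : List A) → (∀ {x} → x ∈ xs → f x ≤ g x) → ∑ xs f ≤ ∑ xs g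
∑-mono []       h = z≤n
∑-mono (x ∷ xs) h = ℕ.+-mono-≤ (h (here refl)) (∑-mono xs (h ∘ there))

∑-cong : ∀ {f g : A → ℕ} (xs : List A) → (∀ {x} → x ∈ xs → f x ≡ g x) → ∑ xs f ≡ ∑ xs g
∑-cong []       h = refl
∑-cong (x ∷ xs) h = cong₂ _+_ (h (here refl)) (∑-cong xs (h ∘ there))

interchange : ∀ a b c d → (a + b) + (c + d) ≡ (a + c) + (b + d)
interchange = solve-∀

∑-+ : ∀ (xs : List A) (f g : A → ℕ) → ∑ xs (λ x → f x + g x) ≡ ∑ xs f + ∑ xs g
∑-+ []       f g = refl
∑-+ (x ∷ xs) f g = trans (cong (_+_ (f x + g x)) (∑-+ xs f g)) (interchange (f x) (g x) _ _)

∑-* : ∀ (xs : List A) k (f : A → ℕ) → ∑ xs (λ x → k * f x) ≡ k * ∑ xs f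
∑-* []       k f = sym (ℕ.*-zeroʳ k)
∑-* (x ∷ xs) k f = trans (cong (_+_ (k * f x)) (∑-* xs k f)) (sym (ℕ.*-distribˡ-+ k (f x) _))

∑-const : ∀ (xs : List A) k → ∑ xs (λ _ → k) ≡ length xs * k
∑-const []       k = refl
∑-const (x ∷ xs) k = cong (k +_) (∑-const xs k)

∑-zero : ∀ (xs : List A) → ∑ xs (λ _ → 0) ≡ 0
∑-zero []       = refl
∑-zero (x ∷ xs) = ∑-zero xs

∑-swap : ∀ (xs : List A) (ys : List B) (f : A → B → ℕ) →
         ∑ xs (λ x → ∑ ys (f x)) ≡ ∑ ys (λ y → ∑ xs (λ x → f x y))
∑-swap []       ys f = sym (∑-zero ys)
∑-swap (x ∷ xs) ys f = trans (cong (∑ ys (f x) +_) (∑-swap xs ys f))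
                             (sym (∑-+ ys (f x) (λ y → ∑ xs (λ x′ → f x′ y))))

length-concatMap : ∀ (f : A → List B) xs → length (concatMap f xs) ≡ ∑ xs (length ∘ f)
length-concatMap f []       = refl
length-concatMap f (x ∷ xs) = trans (length-++ (f x)) (cong (length (f x) +_) (length-concatMap f xs))

length-filter : ∀ {P : A → Set} (P? : Decidable P) xs → length (filter P? xs) ≡ ∑ xs (λ x → ⟦ P? x ⟧)
length-filter P? []       = refl
length-filter P? (x ∷ xs) with P? x
... | yes _ = cong suc (length-filter P? xs)
... | no  _ = length-filter P? xs

⟦⟧-yes : ∀ {P : Set} (P? : Dec P) → P → ⟦ P? ⟧ ≡ 1
⟦⟧-yes (yes _) _ = refl
⟦⟧-yes (no ¬p) p = contradiction p ¬p

⟦⟧-no : ∀ {P : Set} (P? : Dec P) → ¬ P → ⟦ P? ⟧ ≡ 0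
⟦⟧-no (yes p) ¬p = contradiction p ¬p
⟦⟧-no (no _)  _  = refl

-- Induction on `xs`: one occurrence of the image of the head is deleted from `ys`, and injectivity
-- keeps all other images in what is left.
injection⇒length≤ : ∀ {xs : List A} {ys : List B} (f : A → B) → Unique xs →
  (∀ {x} → x ∈ xs → f x ∈ ys) →
  (∀ {x y} → x ∈ xs → y ∈ xs → f x ≡ f y → x ≡ y) →
  length xs ≤ length ys
injection⇒length≤ {xs = []}     f _          into inj = z≤n
injection⇒length≤ {xs = x ∷ xs} f (x∉ ∷ xs!) into inj with ∈-∃++ (into (here refl))
... | us , vs , refl = begin
  suc (length xs)                ≤⟨ s≤s (injection⇒length≤ f xs! into′ (λ y∈ z∈ → inj (there y∈) (there z∈))) ⟩
  suc (length (us ++ vs))        ≡⟨ cong suc (length-++ us) ⟩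
  suc (length us + length vs)    ≡⟨ sym (ℕ.+-suc (length us) (length vs)) ⟩
  length us + suc (length vs)    ≡⟨ sym (length-++ us) ⟩
  length (us ++ f x ∷ vs)        ∎
  where
  open ℕ.≤-Reasoning
  into′ : ∀ {y} → y ∈ xs → f y ∈ us ++ vs
  into′ y∈ with ∈-++⁻ us (into (there y∈))
  ... | inj₁ p = ∈-++⁺ˡ p
  ... | inj₂ (here eq) = contradiction (inj (here refl) (there y∈) (sym eq)) (All.lookup x∉ y∈)
  ... | inj₂ (there p) = ∈-++⁺ʳ us p

⊆⇒length≤ : ∀ {xs ys : List A} → Unique xs → (∀ {x} → x ∈ xs → x ∈ ys) → length xs ≤ length ys
⊆⇒length≤ xs! xs⊆ys = injection⇒length≤ id xs! xs⊆ys (λ _ _ eq → eq)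

concatMap-unique : ∀ (f : A → List B) {xs} → Unique xs → (∀ {x} → x ∈ xs → Unique (f x)) →
  (∀ {x y z} → x ∈ xs → y ∈ xs → z ∈ f x → z ∈ f y → x ≡ y) → Unique (concatMap f xs)
concatMap-unique f {[]}     xs!        fx! disj = []
concatMap-unique f {x ∷ xs} (x∉ ∷ xs!) fx! disj = Unique.++⁺ (fx! (here refl))
  (concatMap-unique f xs! (fx! ∘ there) (λ p q → disj (there p) (there q)))
  λ (z∈ , z∈′) → let y , y∈ , z∈fy = find (∈-concatMap⁻ f {xs = xs} z∈′) in
    All.lookup x∉ y∈ (disj (here refl) (there y∈) z∈ z∈fy)

∈-concatMap : ∀ (f : A → List B) {xs x y} → x ∈ xs → y ∈ f x → y ∈ concatMap f xs
∈-concatMap f x∈ y∈ = ∈-concatMap⁺ f (lose x∈ y∈)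

-- The engine of the three counts below: of the codes of a network, of the depths of the tips and of
-- the short cycles. The pairs are listed without repetition and sent injectively into `M`.
double-count : ∀ {L : List A} {J : A → List B} {M : List C} (f : A → B → C) → Unique L →
  (∀ {a} → a ∈ L → Unique (J a)) →
  (∀ {a b} → a ∈ L → b ∈ J a → f a b ∈ M) →
  (∀ {a b a′ b′} → a ∈ L → b ∈ J a → a′ ∈ L → b′ ∈ J a′ → f a b ≡ f a′ b′ → a ≡ a′ × b ≡ b′) →
  ∑ L (length ∘ J) ≤ length M
double-count {A = A} {B} {C} {L} {J} {M} f L! J! into inj = begin
  ∑ L (length ∘ J)                    ≡⟨ ∑-cong L (λ {a} _ → sym (length-map (a ,_) (J a))) ⟩
  ∑ L (length ∘ pairs)                ≡⟨ sym (length-concatMap pairs L) ⟩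
  length (concatMap pairs L)          ≤⟨ injection⇒length≤ (uncurry f) unique into′ inj′ ⟩
  length M                            ∎
  where
  open ℕ.≤-Reasoning
  pairs : A → List (A × B)
  pairs a = map (a ,_) (J a)
  member : ∀ {a b} → (a , b) ∈ concatMap pairs L → a ∈ L × b ∈ J a
  member p with find (∈-concatMap⁻ pairs p)
  ... | a , a∈ , q with ∈-map⁻ (a ,_) q
  ... | b , b∈ , refl = a∈ , b∈
  fst : ∀ {a p} → p ∈ pairs a → proj₁ p ≡ a
  fst {a} q with ∈-map⁻ (a ,_) q
  ... | b , b∈ , refl = refl
  unique : Unique (concatMap pairs L)
  unique = concatMap-unique pairs L! (λ a∈ → Unique.map⁺ (λ { refl → refl }) (J! a∈))
             (λ _ _ p q → trans (sym (fst p)) (fst q))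
  into′ : ∀ {p} → p ∈ concatMap pairs L → uncurry f p ∈ M
  into′ p = let a∈ , b∈ = member p in into a∈ b∈
  inj′ : ∀ {p q} → p ∈ concatMap pairs L → q ∈ concatMap pairs L → uncurry f p ≡ uncurry f q → p ≡ q
  inj′ p q eq with member p | member q
  ... | a∈ , b∈ | a′∈ , b′∈ with inj a∈ b∈ a′∈ b′∈ eq
  ... | refl , refl = refl

allFin! : ∀ n → Unique (allFin n)
allFin! n = Unique.tabulate⁺ id

length-allFin : ∀ n → length (allFin n) ≡ n
length-allFin n = length-tabulate id

∑-indicator : ∀ {P : A → Set} (P? : Decidable P) {xs x} → Unique xs → x ∈ xs → P x →
              (∀ {y} → y ∈ xs → P y → y ≡ x) → ∑ xs (λ y → ⟦ P? y ⟧) ≡ 1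
∑-indicator P? {x ∷ xs} (x∉ ∷ xs!) (here refl) px only =
  cong₂ _+_ (⟦⟧-yes (P? x) px)
    (trans (∑-cong xs (λ {y} y∈ → ⟦⟧-no (P? y) (λ py → All.lookup x∉ y∈ (sym (only (there y∈) py))))) (∑-zero xs))
∑-indicator P? {y ∷ xs} (y∉ ∷ xs!) (there x∈) px only =
  cong₂ _+_ (⟦⟧-no (P? y) (λ py → All.lookup y∉ x∈ (only (here refl) py)))
    (∑-indicator P? xs! x∈ px (only ∘ there))

-- The counting function # of the definitions

private
  count-tabulate : ∀ {m} {P : A → Set} (P? : Decidable P) (f : Fin m → A) →
    Vec.count P? (Vec.tabulate f) ≡ length (filter P? (List.tabulate f))
  count-tabulate {m = zero}  P? f = refl
  count-tabulate {m = suc m} P? f with P? (f zero)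
  ... | yes _ = cong suc (count-tabulate P? (f ∘ suc))
  ... | no  _ = count-tabulate P? (f ∘ suc)

#-filter : ∀ {m} {P : Fin m → Set} (P? : Decidable P) → # P? ≡ length (filter P? (allFin m))
#-filter P? = count-tabulate P? id

module _ {m} {P : Fin m → Set} (P? : Decidable P) where

  filter-allFin! : Unique (filter P? (allFin m))
  filter-allFin! = Unique.filter⁺ P? (allFin! m)

  ∈-filter-allFin : ∀ {i} → P i → i ∈ filter P? (allFin m)
  ∈-filter-allFin {i} = ∈-filter⁺ P? (∈-allFin i)

  filter-allFin⁻ : ∀ {i} → i ∈ filter P? (allFin m) → P i
  filter-allFin⁻ = proj₂ ∘ ∈-filter⁻ P? {xs = allFin m}

  #-list : ∀ {ks} → Unique ks → (∀ {i} → P i → i ∈ ks) → (∀ {i} → i ∈ ks → P i) → # P? ≡ length ks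
  #-list ks! to from = trans (#-filter P?) (ℕ.≤-antisym
    (⊆⇒length≤ filter-allFin! (to ∘ filter-allFin⁻))
    (⊆⇒length≤ ks! (∈-filter-allFin ∘ from)))

  #≡0 : # P? ≡ 0 → ∀ i → ¬ P i
  #≡0 eq i p = ℕ.<-irrefl (sym (trans (sym (#-filter P?)) eq))
    (ℕ.≤-trans (⊆⇒length≤ {xs = i ∷ []} ([] ∷ []) (λ { (here refl) → ∈-filter-allFin p })) ℕ.≤-refl)

  #≡1 : # P? ≡ 1 → ∃ λ i → P i × (∀ j → P j → j ≡ i)
  #≡1 eq = go _ (λ {i} → ∈-filter-allFin {i}) (λ {i} → filter-allFin⁻ {i}) (trans (sym (#-filter P?)) eq)
    where
    go : ∀ ks → (∀ {i} → P i → i ∈ ks) → (∀ {i} → i ∈ ks → P i) → length ks ≡ 1 →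
         ∃ λ i → P i × (∀ j → P j → j ≡ i)
    go (k ∷ []) to from _ = k , from (here refl) , λ j p → case to p of λ { (here e) → e }

  #≡2 : # P? ≡ 2 → ∃ λ i → ∃ λ j → P i × P j × i ≢ j × (∀ k → P k → k ≡ i ⊎ k ≡ j)
  #≡2 eq = go _ filter-allFin! (λ {i} → ∈-filter-allFin {i}) (λ {i} → filter-allFin⁻ {i}) (trans (sym (#-filter P?)) eq)
    where
    go : ∀ ks → Unique ks → (∀ {i} → P i → i ∈ ks) → (∀ {i} → i ∈ ks → P i) → length ks ≡ 2 →
         ∃ λ i → ∃ λ j → P i × P j × i ≢ j × (∀ k → P k → k ≡ i ⊎ k ≡ j)
    go (k ∷ l ∷ []) ((k≢l ∷ _) ∷ _) to from _ = k , l , from (here refl) , from (there (here refl)) , k≢l ,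
      λ j p → case to p of λ { (here e) → inj₁ e ; (there (here e)) → inj₂ e }

-- Codes

Lab : ℕ → Set
Lab n = Fin n × Bool

_≟ˡ_ : DecidableEquality (Lab n)
_≟ˡ_ = Product.≡-dec Fin._≟_ _≟ᵇ_

-- The tree component of a network, drawn in the plane: tip i is the leaf i,
-- via (i , b) is the parent number b of the reticulation above the leaf i, and
-- fork is a tree vertex without a reticulation child.
data Code (n : ℕ) : Set where
  tip  : Fin n → Code n
  via  : Lab n → Code n → Code n
  fork : Code n → Code n → Code n

via-injective : ∀ {a b} {s t : Code n} → via a s ≡ via b t → a ≡ b × s ≡ t
via-injective refl = refl , refl

fork-injective : ∀ {s t s′ t′ : Code n} → fork s t ≡ fork s′ t′ → s ≡ s′ × t ≡ t′
fork-injective refl = refl , refl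

_≟ᶜ_ : DecidableEquality (Code n)
tip i    ≟ᶜ tip j      = map′ (cong tip) (λ { refl → refl }) (i Fin.≟ j)
tip _    ≟ᶜ via _ _    = no λ ()
tip _    ≟ᶜ fork _ _   = no λ ()
via _ _  ≟ᶜ tip _      = no λ ()
via a t  ≟ᶜ via b u    = map′ (λ { (refl , refl) → refl }) (λ { refl → refl , refl }) (a ≟ˡ b ×-dec t ≟ᶜ u)
via _ _  ≟ᶜ fork _ _   = no λ ()
fork _ _ ≟ᶜ tip _      = no λ ()
fork _ _ ≟ᶜ via _ _    = no λ ()
fork l r ≟ᶜ fork l′ r′ = map′ (λ { (refl , refl) → refl }) (λ { refl → refl , refl }) (l ≟ᶜ l′ ×-dec r ≟ᶜ r′)

Letter : ℕ → Set
Letter n = Fin n ⊎ Lab n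

_≟ˣ_ : DecidableEquality (Letter n)
_≟ˣ_ = Sum.≡-dec Fin._≟_ _≟ˡ_

occ : Letter n → Code n → ℕ
occ x (tip i)    = ⟦ x ≟ˣ inj₁ i ⟧
occ x (via a t)  = ⟦ x ≟ˣ inj₂ a ⟧ + occ x t
occ x (fork l r) = occ x l + occ x r

size : Code n → ℕ
size (tip i)    = 1
size (via a t)  = suc (size t)
size (fork l r) = suc (size l + size r)

-- Either the tip i occurs once, or both parents of the reticulation i do.
record Valid (c : Code n) : Set where
  constructor valid
  field once : ∀ i b → occ (inj₁ i) c + occ (inj₂ (i , b)) c ≡ 1
open Valid public

record Linear (c : Code n) : Set where
  constructor linear
  field at-most-once : ∀ x → occ x c ≤ 1
open Linear public

valid⇒linear : ∀ {c : Code n} → Valid c → Linear c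
valid⇒linear {c = c} (valid v) = linear λ where
  (inj₁ i)       → ℕ.≤-trans (ℕ.m≤m+n _ (occ (inj₂ (i , true)) c)) (ℕ.≤-reflexive (v i true))
  (inj₂ (i , b)) → ℕ.≤-trans (ℕ.m≤n+m _ (occ (inj₁ i) c)) (ℕ.≤-reflexive (v i b))

-- Subcodes and their parents

infix 4 _⊑_ _⋖_

data _⊑_ {n} : Code n → Code n → Set where
  here  : ∀ {t} → t ⊑ t
  via   : ∀ {s a t} → s ⊑ t → s ⊑ via a t
  left  : ∀ {s l r} → s ⊑ l → s ⊑ fork l r
  right : ∀ {s l r} → s ⊑ r → s ⊑ fork l r

data _⋖_ {n} : Code n → Code n → Set where
  via   : ∀ {a t} → t ⋖ via a t
  left  : ∀ {l r} → l ⋖ fork l r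
  right : ∀ {l r} → r ⋖ fork l r

⊑-trans : ∀ {s t u : Code n} → s ⊑ t → t ⊑ u → s ⊑ u
⊑-trans p here      = p
⊑-trans p (via q)   = via (⊑-trans p q)
⊑-trans p (left q)  = left (⊑-trans p q)
⊑-trans p (right q) = right (⊑-trans p q)

⋖⇒⊑ : ∀ {s p : Code n} → s ⋖ p → s ⊑ p
⋖⇒⊑ via   = via here
⋖⇒⊑ left  = left here
⋖⇒⊑ right = right here

⊑-size : ∀ {s t : Code n} → s ⊑ t → size s ≤ size t
⊑-size here      = ℕ.≤-refl
⊑-size (via p)   = ℕ.m≤n⇒m≤1+n (⊑-size p)
⊑-size (left {l = l} {r} p)  = ℕ.m≤n⇒m≤1+n (ℕ.≤-trans (⊑-size p) (ℕ.m≤m+n (size l) (size r)))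
⊑-size (right {l = l} {r} p) = ℕ.m≤n⇒m≤1+n (ℕ.≤-trans (⊑-size p) (ℕ.m≤n+m (size r) (size l)))

⋖-size : ∀ {s p : Code n} → s ⋖ p → size s < size p
⋖-size via   = ℕ.≤-refl
⋖-size (left {l} {r})  = s≤s (ℕ.m≤m+n (size l) (size r))
⋖-size (right {l} {r}) = s≤s (ℕ.m≤n+m (size r) (size l))

occ-⊑ : ∀ {s t : Code n} x → s ⊑ t → occ x s ≤ occ x t
occ-⊑ x here      = ℕ.≤-refl
occ-⊑ x (via p)   = ℕ.≤-trans (occ-⊑ x p) (ℕ.m≤n+m _ _)
occ-⊑ x (left p)  = ℕ.≤-trans (occ-⊑ x p) (ℕ.m≤m+n _ _)
occ-⊑ x (right p) = ℕ.≤-trans (occ-⊑ x p) (ℕ.m≤n+m _ _)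

linear-⊑ : ∀ {s t : Code n} → s ⊑ t → Linear t → Linear s
linear-⊑ p (linear lin) = linear λ x → ℕ.≤-trans (occ-⊑ x p) (lin x)

occ-tip : ∀ (i : Fin n) → occ (inj₁ i) (tip i) ≡ 1
occ-tip i = ⟦⟧-yes (inj₁ i ≟ˣ inj₁ i) refl

occ-via : ∀ (a : Lab n) t → occ (inj₂ a) (via a t) ≡ suc (occ (inj₂ a) t)
occ-via a t = cong (_+ occ (inj₂ a) t) (⟦⟧-yes (inj₂ a ≟ˣ inj₂ a) refl)

tip⊑⇒occ : ∀ {i} {c : Code n} → tip i ⊑ c → 1 ≤ occ (inj₁ i) c
tip⊑⇒occ {i = i} p = ℕ.≤-trans (ℕ.≤-reflexive (sym (occ-tip i))) (occ-⊑ (inj₁ i) p)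

via⊑⇒occ : ∀ {a t} {c : Code n} → via a t ⊑ c → 1 ≤ occ (inj₂ a) c
via⊑⇒occ {a = a} {t} p = ℕ.≤-trans (ℕ.≤-trans (s≤s z≤n) (ℕ.≤-reflexive (sym (occ-via a t)))) (occ-⊑ (inj₂ a) p)

private
  ≤-+ : ∀ {a b} → 1 ≤ a + b → 1 ≤ a ⊎ 1 ≤ b
  ≤-+ {zero}  p = inj₂ p
  ≤-+ {suc a} p = inj₁ (s≤s z≤n)

  1≤0 : ∀ {a b : ℕ} → a ≡ 0 → 1 ≤ a + b → 1 ≤ b
  1≤0 refl p = p

occ⇒tip⊑ : ∀ {i} (c : Code n) → 1 ≤ occ (inj₁ i) c → tip i ⊑ c
occ⇒tip⊑ {i = i} (tip j) p with i Fin.≟ j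
... | yes refl = here
occ⇒tip⊑ (via a t)  p = via (occ⇒tip⊑ t p)
occ⇒tip⊑ {i = i} (fork l r) p with ≤-+ {occ (inj₁ i) l} p
... | inj₁ q = left (occ⇒tip⊑ l q)
... | inj₂ q = right (occ⇒tip⊑ r q)

occ⇒via⊑ : ∀ {a} (c : Code n) → 1 ≤ occ (inj₂ a) c → ∃ λ t → via a t ⊑ c
occ⇒via⊑ {a = a} (via b t) p = by (a ≟ˡ b)
  where
  by : Dec (a ≡ b) → ∃ λ u → via a u ⊑ via b t
  by (yes refl) = t , here
  by (no a≢b)   = let u , q = occ⇒via⊑ {a = a} t (1≤0 (⟦⟧-no (inj₂ a ≟ˣ inj₂ b) (λ { refl → a≢b refl })) p)
                  in u , via q
occ⇒via⊑ {a = a} (fork l r) p with ≤-+ {occ (inj₂ a) l} p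
... | inj₁ q = let u , s = occ⇒via⊑ l q in u , left s
... | inj₂ q = let u , s = occ⇒via⊑ r q in u , right s

some-tip : ∀ (t : Code n) → ∃ λ i → tip i ⊑ t
some-tip (tip i)    = i , here
some-tip (via a t)  = let i , p = some-tip t in i , via p
some-tip (fork l r) = let i , p = some-tip l in i , left p

linear-fork : ∀ {l r : Code n} {x} → Linear (fork l r) → 1 ≤ occ x l → 1 ≤ occ x r → ⊥
linear-fork {x = x} (linear lin) p q = ℕ.<-irrefl refl (ℕ.≤-trans (ℕ.+-mono-≤ p q) (lin x))

linear-via : ∀ {a} {t : Code n} → Linear (via a t) → occ (inj₂ a) t ≡ 0
linear-via {a = a} {t} (linear lin) = ℕ.n≤0⇒n≡0 (ℕ.≤-pred (ℕ.≤-trans (ℕ.≤-reflexive (sym (occ-via a t))) (lin (inj₂ a))))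

-- Every subcode contains a tip, and this tip would occur in both branches.
fork-disjoint : ∀ {l r s : Code n} → Linear (fork l r) → s ⊑ l → s ⊑ r → ⊥
fork-disjoint {s = s} lin p q = let i , t = some-tip s in
  linear-fork {x = inj₁ i} lin (tip⊑⇒occ (⊑-trans t p)) (tip⊑⇒occ (⊑-trans t q))

-- A label thus determines the whole subcode that it heads, so that later a tree vertex above a
-- reticulation can be addressed by its label alone.
via-unique : ∀ {c t t′ : Code n} {a} → Linear c → via a t ⊑ c → via a t′ ⊑ c → t ≡ t′
via-unique lin here here = refl
via-unique {a = a} lin here (via q) = contradiction (via⊑⇒occ q) (ℕ.<⇒≱ (s≤s (ℕ.≤-reflexive (linear-via lin))))
via-unique {a = a} lin (via p) here = contradiction (via⊑⇒occ p) (ℕ.<⇒≱ (s≤s (ℕ.≤-reflexive (linear-via lin))))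
via-unique lin (via p) (via q) = via-unique (linear-⊑ (via here) lin) p q
via-unique lin (left p) (left q) = via-unique (linear-⊑ (left here) lin) p q
via-unique {a = a} lin (left p) (right q) = ⊥-elim (linear-fork {x = inj₂ a} lin (via⊑⇒occ p) (via⊑⇒occ q))
via-unique {a = a} lin (right p) (left q) = ⊥-elim (linear-fork {x = inj₂ a} lin (via⊑⇒occ q) (via⊑⇒occ p))
via-unique lin (right p) (right q) = via-unique (linear-⊑ (right here) lin) p q

private
  too-big : ∀ {s p t : Code n} → s ⋖ p → p ⊑ t → size s ≡ size t → ⊥
  too-big s⋖p p⊑t eq = ℕ.<-irrefl eq (ℕ.<-≤-trans (⋖-size s⋖p) (⊑-size p⊑t))

¬⋖-root : ∀ {c p : Code n} → p ⊑ c → ¬ (c ⋖ p)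
¬⋖-root p⊑c c⋖p = too-big c⋖p p⊑c refl

private
  parent-of-root-child : ∀ {c p s : Code n} → Linear c → p ⊑ c → s ⋖ c → s ⋖ p → c ≡ p
  parent-of-root-child lin here x y = refl
  parent-of-root-child lin (via q) via y = ⊥-elim (too-big y q refl)
  parent-of-root-child lin (left q) left y = ⊥-elim (too-big y q refl)
  parent-of-root-child lin (right q) left y = ⊥-elim (fork-disjoint lin here (⊑-trans (⋖⇒⊑ y) q))
  parent-of-root-child lin (left q) right y = ⊥-elim (fork-disjoint lin (⊑-trans (⋖⇒⊑ y) q) here)
  parent-of-root-child lin (right q) right y = ⊥-elim (too-big y q refl)

-- Subcodes are compared as terms and not as positions. Two positions of the same subcode are
-- excluded by `fork-disjoint` if they lie in different branches and by size if one lies above the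
-- other.
parent-unique : ∀ {c p p′ s : Code n} → Linear c → p ⊑ c → p′ ⊑ c → s ⋖ p → s ⋖ p′ → p ≡ p′
parent-unique lin here q x y = parent-of-root-child lin q x y
parent-unique lin p here x y = sym (parent-of-root-child lin p y x)
parent-unique lin (via p) (via q) x y = parent-unique (linear-⊑ (via here) lin) p q x y
parent-unique lin (left p) (left q) x y = parent-unique (linear-⊑ (left here) lin) p q x y
parent-unique lin (left p) (right q) x y = ⊥-elim (fork-disjoint lin (⊑-trans (⋖⇒⊑ x) p) (⊑-trans (⋖⇒⊑ y) q))
parent-unique lin (right p) (left q) x y = ⊥-elim (fork-disjoint lin (⊑-trans (⋖⇒⊑ y) q) (⊑-trans (⋖⇒⊑ x) p))
parent-unique lin (right p) (right q) x y = parent-unique (linear-⊑ (right here) lin) p q x y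

parent-exists : ∀ {c s : Code n} → s ⊑ c → s ≡ c ⊎ ∃ λ p → p ⊑ c × s ⋖ p
parent-exists here = inj₁ refl
parent-exists (via p) with parent-exists p
... | inj₁ refl = inj₂ (_ , here , via)
... | inj₂ (u , q , e) = inj₂ (u , via q , e)
parent-exists (left p) with parent-exists p
... | inj₁ refl = inj₂ (_ , here , left)
... | inj₂ (u , q , e) = inj₂ (u , left q , e)
parent-exists (right p) with parent-exists p
... | inj₁ refl = inj₂ (_ , here , right)
... | inj₂ (u , q , e) = inj₂ (u , right q , e)

subs : Code n → List (Code n)
subs t@(tip _)    = t ∷ []
subs t@(via _ u)  = t ∷ subs u
subs t@(fork l r) = t ∷ subs l ++ subs r

∈subs⇒⊑ : ∀ {s} (t : Code n) → s ∈ subs t → s ⊑ t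
∈subs⇒⊑ (tip i)    (here refl) = here
∈subs⇒⊑ (via a t)  (here refl) = here
∈subs⇒⊑ (via a t)  (there p)   = via (∈subs⇒⊑ t p)
∈subs⇒⊑ (fork l r) (here refl) = here
∈subs⇒⊑ (fork l r) (there p) with ∈-++⁻ (subs l) p
... | inj₁ q = left (∈subs⇒⊑ l q)
... | inj₂ q = right (∈subs⇒⊑ r q)

⊑⇒∈subs : ∀ {s} {t : Code n} → s ⊑ t → s ∈ subs t
⊑⇒∈subs {t = tip _}    here = here refl
⊑⇒∈subs {t = via _ _}  here = here refl
⊑⇒∈subs {t = fork _ _} here = here refl
⊑⇒∈subs (via p)   = there (⊑⇒∈subs p)
⊑⇒∈subs (left p)  = there (∈-++⁺ˡ (⊑⇒∈subs p))
⊑⇒∈subs (right {l = l} p) = there (∈-++⁺ʳ (subs l) (⊑⇒∈subs p))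

subs-unique : ∀ {c : Code n} → Linear c → Unique (subs c)
subs-unique {c = tip i}    lin = [] ∷ []
subs-unique {c = via a t}  lin =
  All.tabulate (λ p eq → too-big via (subst (_⊑ t) (sym eq) (∈subs⇒⊑ t p)) refl) ∷ subs-unique (linear-⊑ (via here) lin)
subs-unique {c = fork l r} lin =
  All.tabulate (λ p eq → apart (∈-++⁻ (subs l) (subst (_∈ _) (sym eq) p)))
  ∷ Unique.++⁺ (subs-unique (linear-⊑ (left here) lin)) (subs-unique (linear-⊑ (right here) lin))
      (λ (p , q) → fork-disjoint lin (∈subs⇒⊑ l p) (∈subs⇒⊑ r q))
  where
  apart : fork l r ∈ subs l ⊎ fork l r ∈ subs r → ⊥
  apart (inj₁ p) = too-big left (∈subs⇒⊑ l p) refl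
  apart (inj₂ p) = too-big right (∈subs⇒⊑ r p) refl

-- The labels of the reticulations

Hybrid : Code n → Fin n → Set
Hybrid c i = occ (inj₁ i) c ≡ 0

hybrid? : ∀ (c : Code n) → Decidable (Hybrid c)
hybrid? c i = zero? (occ (inj₁ i) c)
  where
  zero? : ∀ k → Dec (k ≡ 0)
  zero? zero    = yes refl
  zero? (suc _) = no λ ()

hybrids : Code n → List (Fin n)
hybrids {n} c = filter (hybrid? c) (allFin n)

hybrid⇒via : ∀ {c : Code n} {i} → Valid c → Hybrid c i → ∀ b → ∃ λ t → via (i , b) t ⊑ c
hybrid⇒via {c = c} {i} (valid v) h b = occ⇒via⊑ c (ℕ.≤-reflexive (sym (trans (cong (_+ occ (inj₂ (i , b)) c) (sym h)) (v i b))))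

via⇒hybrid : ∀ {c t : Code n} {i b} → Valid c → via (i , b) t ⊑ c → Hybrid c i
via⇒hybrid {c = c} {i = i} {b} (valid v) p = ℕ.n≤0⇒n≡0 (ℕ.≤-pred (ℕ.≤-trans
  (ℕ.≤-trans (ℕ.≤-reflexive (ℕ.+-comm 1 _)) (ℕ.+-monoʳ-≤ (occ (inj₁ i) c) (via⊑⇒occ p))) (ℕ.≤-reflexive (v i b))))

tip⇒¬hybrid : ∀ {c : Code n} {i} → tip i ⊑ c → ¬ Hybrid c i
tip⇒¬hybrid p h = ℕ.<-irrefl (sym h) (tip⊑⇒occ p)

¬hybrid⇒tip : ∀ {c : Code n} {i} → ¬ Hybrid c i → tip i ⊑ c
¬hybrid⇒tip {c = c} ¬h = occ⇒tip⊑ c (ℕ.n≢0⇒n>0 ¬h)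

-- From codes to networks

data Name (n : ℕ) : Set where
  orig : Name n
  node   : Code n → Name n
  ret lf : Fin n → Name n

-- The vertices of the network of a code are named by the subcodes, which are
-- pairwise distinct because every subcode contains a tip.
data _∋_ {n} (c : Code n) : Name n → Set where
  orig : c ∋ orig
  node   : ∀ {t} → t ⊑ c → c ∋ node t
  ret    : ∀ {i} → Hybrid c i → c ∋ ret i
  lf     : ∀ {i} → Hybrid c i → c ∋ lf i

data Edge {n} (c : Code n) : Name n → Name n → Set where
  start : Edge c orig (node c)
  along : ∀ {s p} → s ⋖ p → Edge c (node p) (node s)
  cross : ∀ {i b t} → Edge c (node (via (i , b) t)) (ret i)
  hang  : ∀ {i} → Edge c (ret i) (lf i)

nameMark : Name n → Mark
nameMark orig            = root
nameMark (node (tip _))    = leaf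
nameMark (node (via _ _))  = tree
nameMark (node (fork _ _)) = tree
nameMark (ret _)           = reticulation
nameMark (lf _)            = leaf

leafName : Code n → Fin n → Name n
leafName c i = if does (hybrid? c i) then lf i else node (tip i)

private
  _⋖?_ : ∀ (s p : Code n) → Dec (s ⋖ p)
  s ⋖? tip i    = no λ ()
  s ⋖? via a t  = map′ (λ { refl → via }) (λ { via → refl }) (s ≟ᶜ t)
  s ⋖? fork l r = map′ (λ { (inj₁ refl) → left ; (inj₂ refl) → right }) (λ { left → inj₁ refl ; right → inj₂ refl })
                       (s ≟ᶜ l ⊎-dec s ≟ᶜ r)

  edge? : ∀ (c : Code n) u v → Dec (Edge c u v)
  edge? c orig            (node t) = map′ (λ { refl → start }) (λ { start → refl }) (t ≟ᶜ c)
  edge? c orig            orig   = no λ ()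
  edge? c orig            (ret _)  = no λ ()
  edge? c orig            (lf _)   = no λ ()
  edge? c (node p)          (node s) = map′ along (λ { (along e) → e }) (s ⋖? p)
  edge? c (node p)          orig   = no λ ()
  edge? c (node p)          (lf _)   = no λ ()
  edge? c (node (tip _))    (ret _)  = no λ ()
  edge? c (node (fork _ _)) (ret _)  = no λ ()
  edge? c (node (via a t))  (ret i)  = map′ (λ { refl → cross }) (λ { cross → refl }) (proj₁ a Fin.≟ i)
  edge? c (ret i)           (lf j)   = map′ (λ { refl → hang }) (λ { hang → refl }) (i Fin.≟ j)
  edge? c (ret i)           orig   = no λ ()
  edge? c (ret i)           (node _) = no λ ()
  edge? c (ret i)           (ret _)  = no λ ()
  edge? c (lf i)            _        = no λ ()

  T-does⁻ : ∀ {P : Set} (d : Dec P) → T (does d) → P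
  T-does⁻ (yes p) _ = p

  T-does⁺ : ∀ {P : Set} (d : Dec P) → P → T (does d)
  T-does⁺ (yes _) _ = tt
  T-does⁺ (no ¬p) p = ⊥-elim (¬p p)

  leafName∋ : ∀ (c : Code n) i → c ∋ leafName c i
  leafName∋ c i with hybrid? c i
  ... | yes h = lf h
  ... | no ¬h = node (¬hybrid⇒tip ¬h)

  leafName-mark : ∀ (c : Code n) i → nameMark (leafName c i) ≡ leaf
  leafName-mark c i with hybrid? c i
  ... | yes h = refl
  ... | no ¬h = refl

  leafLabel : Fin n → Name n → Fin n
  leafLabel j (node (tip i)) = i
  leafLabel j (lf i)         = i
  leafLabel j _              = j

  leafLabel-leafName : ∀ (c : Code n) j i → leafLabel j (leafName c i) ≡ i
  leafLabel-leafName c j i with hybrid? c i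
  ... | yes _ = refl
  ... | no  _ = refl

leafName-tip : ∀ {c : Code n} {i} → tip i ⊑ c → leafName c i ≡ node (tip i)
leafName-tip {c = c} {i} p with hybrid? c i
... | yes h = contradiction h (tip⇒¬hybrid p)
... | no  _ = refl

leafName-lf : ∀ {c : Code n} {i} → Hybrid c i → leafName c i ≡ lf i
leafName-lf {c = c} {i} h with hybrid? c i
... | yes _ = refl
... | no ¬h = contradiction h ¬h

leaf-names : ∀ {c : Code n} {x} → c ∋ x → nameMark x ≡ leaf → ∃ λ i → x ≡ leafName c i
leaf-names {x = node (tip i)} (node p) _ = i , sym (leafName-tip p)
leaf-names {c = c} {lf i}     (lf h)   _ = i , sym (leafName-lf {c = c} h)

-- An isomorphism between `M` and the abstract graph described by `c`. The counting arguments reach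
-- a network only through such a naming, which is why `toNetwork` can stay opaque.
record Named (M : Network n) (c : Code n) : Set where
  private module M = Network M
  field
    name      : M.Vertex → Name n
    injective : ∀ {u v} → name u ≡ name v → u ≡ v
    member    : ∀ u → c ∋ name u
    onto      : ∀ {x} → c ∋ x → ∃ λ u → name u ≡ x
    edge-to   : ∀ {u v} → u M.⟶ v → Edge c (name u) (name v)
    edge-from : ∀ {u v} → Edge c (name u) (name v) → u M.⟶ v
    mark-≡    : ∀ u → M.mark u ≡ nameMark (name u)
    taxon-≡   : ∀ i → name (M.taxon i) ≡ leafName c i

module _ {N} {P : Fin N → Set} (P? : Decidable P) where
  #0 : (∀ {u} → ¬ P u) → # P? ≡ 0
  #0 none = #-list P? {[]} [] (λ p → ⊥-elim (none p)) λ ()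

  #1 : ∀ u → P u → (∀ {w} → P w → w ≡ u) → # P? ≡ 1
  #1 u p only = #-list P? {u ∷ []} ([] ∷ []) (here ∘ only) λ { (here refl) → p }

  #2 : ∀ {u v} → u ≢ v → P u → P v → (∀ {w} → P w → w ≡ u ⊎ w ≡ v) → # P? ≡ 2
  #2 {u} {v} u≢v p q only = #-list P? {u ∷ v ∷ []} ((u≢v ∷ []) ∷ [] ∷ [])
    (λ r → [ here , there ∘ here ]′ (only r)) λ { (here refl) → p ; (there (here refl)) → q }

private
 module Build {n} {c : Code n} (c! : Valid c) {N} (name : Fin N → Name n)
  (injective : ∀ {u v} → name u ≡ name v → u ≡ v)
  (member : ∀ u → c ∋ name u) (onto : ∀ {x} → c ∋ x → ∃ λ u → name u ≡ x) where

  lin : Linear c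
  lin = valid⇒linear c!

  adj : Fin N → Fin N → Bool
  adj u v = does (edge? c (name u) (name v))

  adj⁻ : ∀ {u v} → T (adj u v) → Edge c (name u) (name v)
  adj⁻ {u} {v} = T-does⁻ (edge? c (name u) (name v))

  adj⁺ : ∀ {u v} → Edge c (name u) (name v) → T (adj u v)
  adj⁺ {u} {v} = T-does⁺ (edge? c (name u) (name v))

  at : ∀ {x} → c ∋ x → Fin N
  at p = proj₁ (onto p)

  at-≡ : ∀ {x} (p : c ∋ x) → name (at p) ≡ x
  at-≡ p = proj₂ (onto p)

  at-unique : ∀ {x u} (p : c ∋ x) → name u ≡ x → u ≡ at p
  at-unique p eq = injective (trans eq (sym (at-≡ p)))

  indeg outdeg : Fin N → ℕ
  indeg v = # (λ u → T? (adj u v))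
  outdeg v = # (λ u → T? (adj v u))

  module _ {v : Fin N} {z} (eq : name v ≡ z) where
    from-v : ∀ {u} → T (adj v u) → Edge c z (name u)
    from-v e = subst (λ x → Edge c x _) eq (adj⁻ e)

    to-v : ∀ {u} → T (adj u v) → Edge c (name u) z
    to-v e = subst (Edge c _) eq (adj⁻ e)

    from-v⁺ : ∀ {x} (p : c ∋ x) → Edge c z x → T (adj v (at p))
    from-v⁺ p e = adj⁺ (subst₂ (Edge c) (sym eq) (sym (at-≡ p)) e)

    to-v⁺ : ∀ {x} (p : c ∋ x) → Edge c x z → T (adj (at p) v)
    to-v⁺ p e = adj⁺ (subst₂ (Edge c) (sym (at-≡ p)) (sym eq) e)

    at-≢ : ∀ {x x′} (p : c ∋ x) (p′ : c ∋ x′) → x ≢ x′ → at p ≢ at p′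
    at-≢ p p′ x≢x′ e = x≢x′ (trans (sym (at-≡ p)) (trans (cong name e) (at-≡ p′)))

    in-0 : (∀ {y} → c ∋ y → ¬ Edge c y z) → indeg v ≡ 0
    in-0 none = #0 (λ u → T? (adj u v)) λ e → none (member _) (to-v e)

    in-1 : ∀ {x} (p : c ∋ x) → Edge c x z → (∀ {y} → c ∋ y → Edge c y z → y ≡ x) → indeg v ≡ 1
    in-1 p e only = #1 (λ u → T? (adj u v)) (at p) (to-v⁺ p e) λ e′ → at-unique p (only (member _) (to-v e′))

    in-2 : ∀ {x x′} (p : c ∋ x) (p′ : c ∋ x′) → x ≢ x′ → Edge c x z → Edge c x′ z →
           (∀ {y} → c ∋ y → Edge c y z → y ≡ x ⊎ y ≡ x′) → indeg v ≡ 2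
    in-2 p p′ x≢x′ e e′ only = #2 (λ u → T? (adj u v)) (at-≢ p p′ x≢x′) (to-v⁺ p e) (to-v⁺ p′ e′)
      λ f → [ inj₁ ∘ at-unique p , inj₂ ∘ at-unique p′ ]′ (only (member _) (to-v f))

    out-0 : (∀ {y} → c ∋ y → ¬ Edge c z y) → outdeg v ≡ 0
    out-0 none = #0 (λ u → T? (adj v u)) λ e → none (member _) (from-v e)

    out-1 : ∀ {x} (p : c ∋ x) → Edge c z x → (∀ {y} → c ∋ y → Edge c z y → y ≡ x) → outdeg v ≡ 1
    out-1 p e only = #1 (λ u → T? (adj v u)) (at p) (from-v⁺ p e) λ e′ → at-unique p (only (member _) (from-v e′))

    out-2 : ∀ {x x′} (p : c ∋ x) (p′ : c ∋ x′) → x ≢ x′ → Edge c z x → Edge c z x′ →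
           (∀ {y} → c ∋ y → Edge c z y → y ≡ x ⊎ y ≡ x′) → outdeg v ≡ 2
    out-2 p p′ x≢x′ e e′ only = #2 (λ u → T? (adj v u)) (at-≢ p p′ x≢x′) (from-v⁺ p e) (from-v⁺ p′ e′)
      λ f → [ inj₁ ∘ at-unique p , inj₂ ∘ at-unique p′ ]′ (only (member _) (from-v f))

  parent-name : ∀ {t} → t ⊑ c → ∃ λ x → c ∋ x × Edge c x (node t) × (∀ {y} → c ∋ y → Edge c y (node t) → y ≡ x)
  parent-name t⊑ with parent-exists t⊑
  ... | inj₁ refl = orig , orig , start , λ where
    orig   start     → refl
    (node q) (along e) → ⊥-elim (¬⋖-root q e)
  ... | inj₂ (p , p⊑ , t⋖p) = node p , node p⊑ , along t⋖p , λ where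
    orig   start     → ⊥-elim (¬⋖-root p⊑ t⋖p)
    (node q) (along e) → cong node (parent-unique lin q p⊑ e t⋖p)

  in-node : ∀ {v t} → name v ≡ node t → t ⊑ c → indeg v ≡ 1
  in-node eq t⊑ = let x , x∈ , e , only = parent-name t⊑ in in-1 eq x∈ e only

  degree : ∀ {v x} → name v ≡ x → c ∋ x → (indeg v , outdeg v) ≡ degrees (nameMark x)
  degree eq orig = cong₂ _,_ (in-0 eq λ _ ()) (out-1 eq (node here) start λ { _ start → refl })
  degree eq (node {tip j} p) = cong₂ _,_ (in-node eq p) (out-0 eq λ { _ (along ()) })
  degree eq (node {via a t} p) = cong₂ _,_ (in-node eq p)
    (out-2 eq (node (⊑-trans (via here) p)) (ret (via⇒hybrid c! p)) (λ ()) (along via) cross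
      λ { _ (along via) → inj₁ refl ; _ cross → inj₂ refl })
  degree eq (node {fork l r} p) = cong₂ _,_ (in-node eq p)
    (out-2 eq (node (⊑-trans (left here) p)) (node (⊑-trans (right here) p))
      (λ { refl → fork-disjoint (linear-⊑ p lin) here here }) (along left) (along right)
      λ { _ (along left) → inj₁ refl ; _ (along right) → inj₂ refl })
  degree eq (ret h) =
    let t , p = hybrid⇒via c! h false ; t′ , p′ = hybrid⇒via c! h true in
    cong₂ _,_ (in-2 eq (node p) (node p′) (λ ()) cross cross λ where
                 (node q) (cross {b = false}) → inj₁ (cong (λ u → node (via _ u)) (via-unique lin q p))
                 (node q) (cross {b = true})  → inj₂ (cong (λ u → node (via _ u)) (via-unique lin q p′)))
              (out-1 eq (lf h) hang λ { _ hang → refl })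
  degree eq (lf h) = cong₂ _,_ (in-1 eq (ret h) hang λ { _ hang → refl }) (out-0 eq λ _ ())

  _⟶_ : Fin N → Fin N → Set
  u ⟶ v = T (adj u v)

  -- A potential that drops along every edge and so excludes cycles. The offsets put the leaves
  -- under reticulations lowest, then the reticulations, then all nodes, and the origin on top.
  rank : Name n → ℕ
  rank orig   = 3 + size c
  rank (node t) = 2 + size t
  rank (ret _)  = 1
  rank (lf _)   = 0

  rank-< : ∀ {x y} → Edge c x y → rank y < rank x
  rank-< start     = ℕ.≤-refl
  rank-< (along e) = s≤s (s≤s (⋖-size e))
  rank-< cross     = s≤s (s≤s z≤n)
  rank-< hang      = ℕ.≤-refl

  rank-<⁺ : ∀ {u v} → TransClosure _⟶_ u v → rank (name v) < rank (name u)
  rank-<⁺ [ e ]    = rank-< (adj⁻ e)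
  rank-<⁺ (e ∷ es) = ℕ.<-trans (rank-<⁺ es) (rank-< (adj⁻ e))

  o : Fin N
  o = at orig

  extend : ∀ {u x y} → Star _⟶_ o u → name u ≡ x → Edge c x y → (q : c ∋ y) → Star _⟶_ o (at q)
  extend path eq e q = path ◅◅ (adj⁺ (subst₂ (Edge c) (sym eq) (sym (at-≡ q)) e) ◅ ε)

  reach-below : ∀ {s t} → s ⊑ t → (p : c ∋ node t) → Star _⟶_ o (at p) → (q : c ∋ node s) → Star _⟶_ o (at q)
  reach-below here p path q = subst (Star _⟶_ o) (at-unique q (at-≡ p)) path
  reach-below (via s) p@(node t⊑) path q = reach-below s (node (⊑-trans (via here) t⊑))
    (extend path (at-≡ p) (along via) _) q
  reach-below (left s) p@(node t⊑) path q = reach-below s (node (⊑-trans (left here) t⊑))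
    (extend path (at-≡ p) (along left) _) q
  reach-below (right s) p@(node t⊑) path q = reach-below s (node (⊑-trans (right here) t⊑))
    (extend path (at-≡ p) (along right) _) q

  reach : ∀ {x} (p : c ∋ x) → Star _⟶_ o (at p)
  reach orig = ε
  reach (node t⊑) = reach-below t⊑ (node here) (extend ε (at-≡ orig) start (node here)) (node t⊑)
  reach (ret h) = let t , p = hybrid⇒via c! h true in extend (reach (node p)) (at-≡ (node p)) cross (ret h)
  reach (lf h) = extend (reach-ret h) (at-≡ (ret h)) hang (lf h)
    where
    reach-ret : ∀ {i} (h : Hybrid c i) → Star _⟶_ o (at (ret h))
    reach-ret h = let t , p = hybrid⇒via c! h true in extend (reach (node p)) (at-≡ (node p)) cross (ret h)

  taxonᴮ : Fin n → ∃ λ v → nameMark (name v) ≡ leaf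
  taxonᴮ i = at (leafName∋ c i) , trans (cong nameMark (at-≡ (leafName∋ c i))) (leafName-mark c i)

  labelᴮ : (∃ λ v → nameMark (name v) ≡ leaf) → Fin n
  labelᴮ (v , m) = proj₁ (leaf-names (member v) m)

  ,-≡ : ∀ {v w} {p : nameMark (name v) ≡ leaf} {q : nameMark (name w) ≡ leaf} → v ≡ w → (v , p) ≡ (w , q)
  ,-≡ {v} {p = p} {q} refl = cong (v ,_) (≡-irrelevant p q)

  leafName-injective : ∀ {i j} → leafName c i ≡ leafName c j → i ≡ j
  leafName-injective {i} {j} eq = trans (sym (leafLabel-leafName c i i)) (trans (cong (leafLabel i) eq) (leafLabel-leafName c i j))

  child : ∀ v → nameMark (name v) ≢ leaf →
          ∃ λ w → v ⟶ w × (nameMark (name w) ≡ tree ⊎ nameMark (name w) ≡ leaf)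
  child v ¬leaf = go refl (member v) ¬leaf
    where
    step : ∀ {x y} → name v ≡ x → (q : c ∋ y) → Edge c x y → nameMark y ≡ tree ⊎ nameMark y ≡ leaf →
           ∃ λ w → v ⟶ w × (nameMark (name w) ≡ tree ⊎ nameMark (name w) ≡ leaf)
    step eq q e m = at q , adj⁺ (subst₂ (Edge c) (sym eq) (sym (at-≡ q)) e) ,
      subst (λ y → nameMark y ≡ tree ⊎ nameMark y ≡ leaf) (sym (at-≡ q)) m
    node-mark : ∀ (t : Code n) → nameMark (node t) ≡ tree ⊎ nameMark (node t) ≡ leaf
    node-mark (tip _)    = inj₂ refl
    node-mark (via _ _)  = inj₁ refl
    node-mark (fork _ _) = inj₁ refl
    go : ∀ {x} → name v ≡ x → c ∋ x → nameMark x ≢ leaf →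
          ∃ λ w → v ⟶ w × (nameMark (name w) ≡ tree ⊎ nameMark (name w) ≡ leaf)
    go eq orig ¬l = step eq (node here) start (node-mark c)
    go eq (node {tip i} p) ¬l = ⊥-elim (¬l refl)
    go eq (node {via a t} p) ¬l = step eq (node (⊑-trans (via here) p)) (along via) (node-mark t)
    go eq (node {fork l r} p) ¬l = step eq (node (⊑-trans (left here) p)) (along left) (node-mark l)
    go eq (ret h) ¬l = step eq (lf h) hang (inj₂ refl)
    go eq (lf h) ¬l = ⊥-elim (¬l refl)

  net : Network n
  net = record
    { size = N
    ; edge = adj
    ; mark = nameMark ∘ name
    ; origin = o
    ; origin-root = λ v → mk⇔ (λ m → at-unique orig (root-name (member v) m)) λ { refl → cong nameMark (at-≡ orig) }
    ; degrees-≡ = λ v → degree refl (member v)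
    ; acyclic = λ v cycle → ℕ.<-irrefl refl (rank-<⁺ cycle)
    ; reachable = λ v → subst (Star _⟶_ o) (sym (at-unique (member v) refl)) (reach (member v))
    ; taxa = mk↔ₛ′ taxonᴮ labelᴮ
        (λ (v , m) → ,-≡ (sym (at-unique _ (proj₂ (leaf-names (member v) m)))))
        (λ i → leafName-injective (trans (sym (proj₂ (leaf-names (member _) (proj₂ (taxonᴮ i))))) (at-≡ (leafName∋ c i))))
    ; tree-child = child
    ; one-component = λ m e → hanging (adj⁻ e) m
    }
    where
    root-name : ∀ {x} → c ∋ x → nameMark x ≡ root → x ≡ orig
    root-name orig m = refl
    root-name {node (tip _)} _ ()
    root-name {node (via _ _)} _ ()
    root-name {node (fork _ _)} _ ()
    hanging : ∀ {x y} → Edge c x y → nameMark x ≡ reticulation → nameMark y ≡ leaf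
    hanging hang  m = refl
    hanging cross ()
    hanging (along via) ()
    hanging (along left) ()
    hanging (along right) ()

  named : Named net c
  named = record
    { name = name ; injective = injective ; member = member ; onto = onto
    ; edge-to = adj⁻ ; edge-from = adj⁺ ; mark-≡ = λ _ → refl ; taxon-≡ = λ i → at-≡ (leafName∋ c i) }

lookup-injective : ∀ {xs : List A} → Unique xs → ∀ {i j} → List.lookup xs i ≡ List.lookup xs j → i ≡ j
lookup-injective (x∉ ∷ xs!) {zero}  {zero}  eq = refl
lookup-injective (x∉ ∷ xs!) {zero}  {suc j} eq = contradiction eq (All.lookup x∉ (∈-lookup j))
lookup-injective (x∉ ∷ xs!) {suc i} {zero}  eq = contradiction (sym eq) (All.lookup x∉ (∈-lookup i))
lookup-injective (x∉ ∷ xs!) {suc i} {suc j} eq = cong suc (lookup-injective xs! eq)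

private
 module _ {n} (c : Code n) where
  names : List (Name n)
  names = orig ∷ map node (subs c) ++ map ret (hybrids c) ++ map lf (hybrids c)

  names! : Valid c → Unique names
  names! c! = All.tabulate (λ p → λ { refl → origin∉ (∈-++⁻ (map node (subs c)) p) })
    ∷ Unique.++⁺ (Unique.map⁺ (λ { refl → refl }) (subs-unique (valid⇒linear c!)))
        (Unique.++⁺ (Unique.map⁺ (λ { refl → refl }) (filter-allFin! (hybrid? c)))
                    (Unique.map⁺ (λ { refl → refl }) (filter-allFin! (hybrid? c))) (λ (p , q) → ret≢lf (∈-map⁻ ret p) (∈-map⁻ lf q)))
        (λ (p , q) → node≢ (∈-map⁻ node p) (∈-++⁻ (map ret (hybrids c)) q))
    where
    origin∉ : orig ∈ map node (subs c) ⊎ orig ∈ map ret (hybrids c) ++ map lf (hybrids c) → ⊥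
    origin∉ (inj₁ p) with () ← proj₂ (proj₂ (∈-map⁻ node p))
    origin∉ (inj₂ p) with ∈-++⁻ (map ret (hybrids c)) p
    ... | inj₁ q with () ← proj₂ (proj₂ (∈-map⁻ ret q))
    ... | inj₂ q with () ← proj₂ (proj₂ (∈-map⁻ lf q))
    ret≢lf : ∀ {x} → (∃ λ i → i ∈ hybrids c × x ≡ ret i) → (∃ λ i → i ∈ hybrids c × x ≡ lf i) → ⊥
    ret≢lf (_ , _ , refl) (_ , _ , ())
    node≢ : ∀ {x} → (∃ λ t → t ∈ subs c × x ≡ node t) → x ∈ map ret (hybrids c) ⊎ x ∈ map lf (hybrids c) → ⊥
    node≢ (_ , _ , refl) (inj₁ q) with () ← proj₂ (proj₂ (∈-map⁻ ret q))
    node≢ (_ , _ , refl) (inj₂ q) with () ← proj₂ (proj₂ (∈-map⁻ lf q))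

  ∈names⁺ : ∀ {x} → c ∋ x → x ∈ names
  ∈names⁺ orig = here refl
  ∈names⁺ (node p) = there (∈-++⁺ˡ (∈-map⁺ node (⊑⇒∈subs p)))
  ∈names⁺ (ret h) = there (∈-++⁺ʳ (map node (subs c)) (∈-++⁺ˡ (∈-map⁺ ret (∈-filter-allFin (hybrid? c) h))))
  ∈names⁺ (lf h) = there (∈-++⁺ʳ (map node (subs c)) (∈-++⁺ʳ (map ret (hybrids c)) (∈-map⁺ lf (∈-filter-allFin (hybrid? c) h))))

  ∈names⁻ : ∀ {x} → x ∈ names → c ∋ x
  ∈names⁻ (here refl) = orig
  ∈names⁻ (there p) with ∈-++⁻ (map node (subs c)) p
  ... | inj₁ q with ∈-map⁻ node q
  ...   | t , t∈ , refl = node (∈subs⇒⊑ c t∈)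
  ∈names⁻ (there p) | inj₂ p′ with ∈-++⁻ (map ret (hybrids c)) p′
  ... | inj₁ q with ∈-map⁻ ret q
  ...   | i , i∈ , refl = ret (filter-allFin⁻ (hybrid? c) i∈)
  ∈names⁻ (there p) | inj₂ p′ | inj₂ q with ∈-map⁻ lf q
  ...   | i , i∈ , refl = lf (filter-allFin⁻ (hybrid? c) i∈)

module _ {n} {c : Code n} (c! : Valid c) where
  private
    module Names = Build c! (List.lookup (names c)) (lookup-injective (names! c c!)) (λ u → ∈names⁻ c (∈-lookup u))
                     (λ p → Any.index (∈names⁺ c p) , sym (lookup-index (∈names⁺ c p)))

  abstract
    toNetwork : Network n
    toNetwork = Names.net

    toNetwork-named : Named toNetwork c
    toNetwork-named = Names.named

named-≈ : ∀ {M M′ : Network n} {c} → Named M c → Named M′ c → M ≈ M′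
named-≈ {M = M} {M′} {c} P Q = record
  { vertices = mk↔ₛ′ f g (λ v → Q.injective (trans (f-≡ (g v)) (g-≡ v))) (λ u → P.injective (trans (g-≡ (f u)) (f-≡ u)))
  ; edge-≡   = λ u v → T-≡-Bool
      (λ e → P.edge-from (subst₂ (Edge c) (f-≡ u) (f-≡ v) (Q.edge-to e)))
      (λ e → Q.edge-from (subst₂ (Edge c) (sym (f-≡ u)) (sym (f-≡ v)) (P.edge-to e)))
  ; taxon-≡  = λ i → Q.injective (trans (f-≡ _) (trans (P.taxon-≡ i) (sym (Q.taxon-≡ i))))
  }
  where
  module P = Named P
  module Q = Named Q
  f : Network.Vertex M → Network.Vertex M′
  f u = proj₁ (Q.onto (P.member u))
  f-≡ : ∀ u → Q.name (f u) ≡ P.name u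
  f-≡ u = proj₂ (Q.onto (P.member u))
  g : Network.Vertex M′ → Network.Vertex M
  g u = proj₁ (P.onto (Q.member u))
  g-≡ : ∀ u → P.name (g u) ≡ Q.name u
  g-≡ u = proj₂ (P.onto (Q.member u))
  T-≡-Bool : ∀ {a b} → (T a → T b) → (T b → T a) → a ≡ b
  T-≡-Bool {false} {false} _ _ = refl
  T-≡-Bool {false} {true}  _ h = ⊥-elim (h tt)
  T-≡-Bool {true}  {false} h _ = ⊥-elim (h tt)
  T-≡-Bool {true}  {true}  _ _ = refl

-- From networks to codes

module _ {N} {P : Fin N → Set} (P? : Decidable P) where
  #1⇒≡ : # P? ≡ 1 → ∀ {u v} → P u → P v → u ≡ v
  #1⇒≡ eq p q = let _ , _ , only = #≡1 P? eq in trans (only _ p) (sym (only _ q))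

  #2⇒ : # P? ≡ 2 → ∀ {a b} → P a → P b → a ≢ b → ∀ {w} → P w → w ≡ a ⊎ w ≡ b
  #2⇒ eq pa pb a≢b pw with #≡2 P? eq
  ... | i , j , _ , _ , _ , only with only _ pa | only _ pb | only _ pw
  ... | inj₁ refl | inj₁ refl | _         = contradiction refl a≢b
  ... | inj₂ refl | inj₂ refl | _         = contradiction refl a≢b
  ... | inj₁ refl | inj₂ refl | inj₁ refl = inj₁ refl
  ... | inj₁ refl | inj₂ refl | inj₂ refl = inj₂ refl
  ... | inj₂ refl | inj₁ refl | inj₁ refl = inj₂ refl
  ... | inj₂ refl | inj₁ refl | inj₂ refl = inj₁ refl

module Representation {n} (N : Network n) where
  open Network N public

  private
    indegree-≡ : ∀ {v m} → mark v ≡ m → indegree v ≡ proj₁ (degrees m)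
    indegree-≡ {v} refl = cong proj₁ (degrees-≡ v)

    outdegree-≡ : ∀ {v m} → mark v ≡ m → outdegree v ≡ proj₂ (degrees m)
    outdegree-≡ {v} refl = cong proj₂ (degrees-≡ v)

  Hybridᵛ : Vertex → Set
  Hybridᵛ v = mark v ≡ reticulation

  hybridᵛ? : ∀ v → Dec (Hybridᵛ v)
  hybridᵛ? v = mark v ≟ᵐ reticulation

  no-parent : ∀ {u v} → mark v ≡ root → ¬ u ⟶ v
  no-parent {u} {v} m e = #≡0 (λ u → T? (edge u v)) (indegree-≡ m) u e

  no-child : ∀ {u v} → mark u ≡ leaf → ¬ u ⟶ v
  no-child {u} {v} m e = #≡0 (λ v → T? (edge u v)) (outdegree-≡ m) v e

  parent-≡ : ∀ {u u′ v} → ¬ Hybridᵛ v → u ⟶ v → u′ ⟶ v → u ≡ u′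
  parent-≡ {v = v} ¬h e e′ with mark v in m
  ... | root         = contradiction e (no-parent m)
  ... | tree         = #1⇒≡ (λ u → T? (edge u v)) (indegree-≡ m) e e′
  ... | reticulation = contradiction refl ¬h
  ... | leaf         = #1⇒≡ (λ u → T? (edge u v)) (indegree-≡ m) e e′

  only-child : ∀ {u v v′} → mark u ≡ root ⊎ Hybridᵛ u → u ⟶ v → u ⟶ v′ → v ≡ v′
  only-child {u} (inj₁ m) = #1⇒≡ (λ v → T? (edge u v)) (outdegree-≡ m)
  only-child {u} (inj₂ m) = #1⇒≡ (λ v → T? (edge u v)) (outdegree-≡ m)

  children : ∀ {u v v′ w} → mark u ≡ tree → u ⟶ v → u ⟶ v′ → v ≢ v′ → u ⟶ w → w ≡ v ⊎ w ≡ v′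
  children {u} m e e′ v≢v′ f = #2⇒ (λ v → T? (edge u v)) (outdegree-≡ m) e e′ v≢v′ f

  taxon-mark : ∀ i → mark (taxon i) ≡ leaf
  taxon-mark i = proj₂ (Inverse.to taxa i)

  taxon-¬hybrid : ∀ i → ¬ Hybridᵛ (taxon i)
  taxon-¬hybrid i h with () ← trans (sym h) (taxon-mark i)

  taxon-injective : ∀ {i j} → taxon i ≡ taxon j → i ≡ j
  taxon-injective {i} {j} eq = trans (sym (Inverse.strictlyInverseʳ taxa i))
    (trans (cong (Inverse.from taxa) (pair eq)) (Inverse.strictlyInverseʳ taxa j))
    where
    pair : ∀ {p q : ∃ λ v → mark v ≡ leaf} → proj₁ p ≡ proj₁ q → p ≡ q
    pair {v , p} {.v , q} refl = cong (v ,_) (≡-irrelevant p q)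

  taxon-surjective : ∀ {v} → mark v ≡ leaf → ∃ λ i → v ≡ taxon i
  taxon-surjective {v} m = Inverse.from taxa (v , m) , sym (cong proj₁ (Inverse.strictlyInverseˡ taxa (v , m)))

  hybrid-child : ∀ {r} → Hybridᵛ r → ∃ λ i → r ⟶ taxon i
  hybrid-child {r} h with tree-child r (λ m → case trans (sym h) m of λ ())
  ... | w , e , _ with taxon-surjective (one-component h e)
  ... | i , refl = i , e

  -- The only child of the root is not a reticulation, by the tree-child condition.
  hybrid-parent : ∀ {u r} → Hybridᵛ r → u ⟶ r → mark u ≡ tree
  hybrid-parent {u} {r} h e with mark u in m
  ... | tree = refl
  ... | leaf = contradiction e (no-child m)
  ... | reticulation with () ← trans (sym h) (one-component m e)
  ... | root with tree-child u (λ m′ → case trans (sym m) m′ of λ ())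
  ...   | w , f , k with only-child (inj₁ m) e f
  ...   | refl with k
  ...   | inj₁ q with () ← trans (sym h) q
  hybrid-parent {u} {r} h e | root | w , f , k | refl | inj₂ q with () ← trans (sym h) q

  -- Two different reticulation children would exhaust the children of a tree vertex and violate the
  -- tree-child condition. This is why a node of a code needs at most one label.
  hybrid-child-≡ : ∀ {u r r′} → Hybridᵛ r → Hybridᵛ r′ → u ⟶ r → u ⟶ r′ → r ≡ r′
  hybrid-child-≡ {u} {r} {r′} h h′ e e′ with r Fin.≟ r′
  ... | yes eq = eq
  ... | no r≢r′ with tree-child u (λ m → no-child m e)
  ...   | w , f , k with children (hybrid-parent h e) e e′ r≢r′ f | k
  ...   | inj₁ refl | inj₁ q with () ← trans (sym h) q
  ...   | inj₁ refl | inj₂ q with () ← trans (sym h) q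
  ...   | inj₂ refl | inj₁ q with () ← trans (sym h′) q
  ...   | inj₂ refl | inj₂ q with () ← trans (sym h′) q

  branch-mark : ∀ {u v w} → u ⟶ v → u ⟶ w → v ≢ w → mark u ≡ tree
  branch-mark {u} e f v≢w with mark u in m
  ... | tree         = refl
  ... | leaf         = contradiction e (no-child m)
  ... | reticulation = contradiction (only-child (inj₂ m) e f) v≢w
  ... | root         = contradiction (only-child (inj₁ m) e f) v≢w

  infixl 5 _▸_,_
  -- Paths in the tree component. Every vertex entered has a unique parent, so two paths with the
  -- same end can be followed back together.
  data TreePath : Vertex → Vertex → Set where
    ε     : ∀ {v} → TreePath v v
    _▸_,_ : ∀ {u v w} → TreePath u v → v ⟶ w → ¬ Hybridᵛ w → TreePath u w

  private
    Plus⟶ = TransClosure _⟶_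

    path⁺ : ∀ {u v w} → u ⟶ v → TreePath v w → Plus⟶ u w
    path⁺ e ε           = [ e ]
    path⁺ e (p ▸ f , _) = path⁺ e p ∷ʳ f

    no-cycle : ∀ {u v} → u ⟶ v → ¬ TreePath v u
    no-cycle e p = acyclic _ (path⁺ e p)

  -- Both paths are followed back from their common end. If they are exhausted together, the
  -- siblings coincide; if one is exhausted first, the other one passes through the common parent,
  -- which closes a cycle.
  siblings-disjoint : ∀ {v w w′ u} → v ⟶ w → v ⟶ w′ → ¬ Hybridᵛ w → ¬ Hybridᵛ w′ → w ≢ w′ →
                      TreePath w u → TreePath w′ u → ⊥
  siblings-disjoint e e′ h h′ w≢w′ ε ε = w≢w′ refl
  siblings-disjoint e e′ h h′ w≢w′ ε (q ▸ f , k) = no-cycle e′ (subst (TreePath _) (parent-≡ h f e) q)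
  siblings-disjoint e e′ h h′ w≢w′ (p ▸ f , k) ε = no-cycle e (subst (TreePath _) (parent-≡ h′ f e′) p)
  siblings-disjoint e e′ h h′ w≢w′ (p ▸ f , k) (q ▸ f′ , k′) =
    siblings-disjoint e e′ h h′ w≢w′ p (subst (TreePath _) (parent-≡ k f′ f) q)

  Oriented : (Vertex → Bool) → Set
  Oriented o = ∀ {p p′ r} → Hybridᵛ r → p ⟶ r → p′ ⟶ r → p ≢ p′ → o p ≢ o p′

  -- Derivations that `c` draws the tree component below `v`, with the numbers of the parents read
  -- off from `o`. As a relation it admits both orders of the branches at every fork.
  data Rep (o : Vertex → Bool) : Vertex → Code n → Set where
    tip  : ∀ {v i} → v ≡ taxon i → Rep o v (tip i)
    via  : ∀ {v r w i b t} → Hybridᵛ r → v ⟶ r → r ⟶ taxon i → o v ≡ b → v ⟶ w → ¬ Hybridᵛ w → Rep o w t →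
           Rep o v (via (i , b) t)
    fork : ∀ {v w w′ l r} → v ⟶ w → v ⟶ w′ → w ≢ w′ → ¬ Hybridᵛ w → ¬ Hybridᵛ w′ →
           Rep o w l → Rep o w′ r → Rep o v (fork l r)

  rep-mark : ∀ {o v t} → Rep o v t → mark v ≡ nameMark (node t)
  rep-mark (tip refl)              = taxon-mark _
  rep-mark (via h e _ _ _ _ _)     = hybrid-parent h e
  rep-mark (fork e e′ w≢w′ _ _ _ _) = branch-mark e e′ w≢w′

  -- The code leads down to a tip, whose taxon fixes a leaf, and from there unique parents lead back
  -- up. The two orientations may differ, which permits the comparison of erased codes.
  rep-≡ : ∀ {o o′ u u′ t} → Rep o u t → Rep o′ u′ t → u ≡ u′
  rep-≡ (tip refl) (tip refl) = refl
  rep-≡ (via _ _ _ _ e h p) (via _ _ _ _ e′ _ q) = parent-≡ h e (subst (_ ⟶_) (sym (rep-≡ p q)) e′)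
  rep-≡ (fork e _ _ h _ p _) (fork e′ _ _ _ _ q _) = parent-≡ h e (subst (_ ⟶_) (sym (rep-≡ p q)) e′)

  private
    noetherian : ∀ v → Acc (flip Plus⟶) v
    noetherian = spo-noetherian record
      { isEquivalence = ≡.isEquivalence
      ; irrefl = λ { refl → acyclic _ }
      ; trans = Plus._++_
      ; <-resp-≈ = (λ { refl p → p }) , (λ { refl p → p }) }

    child-mark : ∀ {u w} → u ⟶ w → ¬ Hybridᵛ w → mark w ≡ tree ⊎ mark w ≡ leaf
    child-mark {w = w} e ¬h with mark w in m
    ... | root         = contradiction e (no-parent m)
    ... | tree         = inj₁ refl
    ... | reticulation = contradiction refl ¬h
    ... | leaf         = inj₂ refl

  rep-exists : ∀ o v → mark v ≡ tree ⊎ mark v ≡ leaf → ∃ (Rep o v)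
  rep-exists o v = go (noetherian v)
    where
    go : ∀ {v} → Acc (flip Plus⟶) v → mark v ≡ tree ⊎ mark v ≡ leaf → ∃ (Rep o v)
    go _ (inj₂ m) = let i , eq = taxon-surjective m in tip i , tip eq
    go {v} (acc rec) (inj₁ m) with #≡2 (λ w → T? (edge v w)) (outdegree-≡ m)
    ... | w , w′ , e , e′ , w≢w′ , _ with hybridᵛ? w | hybridᵛ? w′
    ... | yes h | yes h′ = contradiction (hybrid-child-≡ h h′ e e′) w≢w′
    ... | yes h | no ¬h′ = let i , f = hybrid-child h ; t , p = go (rec [ e′ ]) (child-mark e′ ¬h′) in
      via (i , o v) t , via h e f refl e′ ¬h′ p
    ... | no ¬h | yes h′ = let i , f = hybrid-child h′ ; t , p = go (rec [ e ]) (child-mark e ¬h) in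
      via (i , o v) t , via h′ e′ f refl e ¬h p
    ... | no ¬h | no ¬h′ = let l , p = go (rec [ e ]) (child-mark e ¬h) ; r , q = go (rec [ e′ ]) (child-mark e′ ¬h′) in
      fork l r , fork e e′ w≢w′ ¬h ¬h′ p q

  -- At p u s: in the derivation p, the occurrence of the subcode s represents u.
  data At {o} : ∀ {v c} → Rep o v c → Vertex → Code n → Set where
    here  : ∀ {v c} {p : Rep o v c} → At p v c
    via   : ∀ {v r w i b t u s} {h : Hybridᵛ r} {e : v ⟶ r} {f : r ⟶ taxon i} {eq : o v ≡ b} {e′ : v ⟶ w} {h′} {p : Rep o w t} →
            At p u s → At (via h e f eq e′ h′ p) u s
    left  : ∀ {v w w′ l r u s} {e : v ⟶ w} {e′ : v ⟶ w′} {w≢w′ h h′} {p : Rep o w l} {q : Rep o w′ r} →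
            At p u s → At (fork e e′ w≢w′ h h′ p q) u s
    right : ∀ {v w w′ l r u s} {e : v ⟶ w} {e′ : v ⟶ w′} {w≢w′ h h′} {p : Rep o w l} {q : Rep o w′ r} →
            At q u s → At (fork e e′ w≢w′ h h′ p q) u s

  module _ {o : Vertex → Bool} where

    at-rep : ∀ {v c u s} {p : Rep o v c} → At p u s → Rep o u s
    at-rep {p = p} here = p
    at-rep (via a)   = at-rep a
    at-rep (left a)  = at-rep a
    at-rep (right a) = at-rep a

    at-⊑ : ∀ {v c u s} {p : Rep o v c} → At p u s → s ⊑ c
    at-⊑ here      = here
    at-⊑ (via a)   = via (at-⊑ a)
    at-⊑ (left a)  = left (at-⊑ a)
    at-⊑ (right a) = right (at-⊑ a)

    ⊑-at : ∀ {v c s} (p : Rep o v c) → s ⊑ c → ∃ λ u → At p u s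
    ⊑-at p here = _ , here
    ⊑-at (via _ _ _ _ _ _ p)    (via s)   = let u , a = ⊑-at p s in u , via a
    ⊑-at (fork _ _ _ _ _ p q)   (left s)  = let u , a = ⊑-at p s in u , left a
    ⊑-at (fork _ _ _ _ _ p q)   (right s) = let u , a = ⊑-at q s in u , right a

    private
      prepend : ∀ {u v w} → u ⟶ v → ¬ Hybridᵛ v → TreePath v w → TreePath u w
      prepend e h ε           = ε ▸ e , h
      prepend e h (p ▸ f , k) = prepend e h p ▸ f , k

    at-path : ∀ {v c u s} {p : Rep o v c} → At p u s → TreePath v u
    at-path here = ε
    at-path (via {e′ = e′} {h′} a)          = prepend e′ h′ (at-path a)
    at-path (left {e = e} {h = h} a)        = prepend e h (at-path a)
    at-path (right {e′ = e′} {h′ = h′} a)   = prepend e′ h′ (at-path a)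

    at-root : ∀ {v c s} {p : Rep o v c} → At p v s → s ≡ c
    at-root here = refl
    at-root (via {e′ = e′} a)   = ⊥-elim (no-cycle e′ (at-path a))
    at-root (left {e = e} a)    = ⊥-elim (no-cycle e (at-path a))
    at-root (right {e′ = e′} a) = ⊥-elim (no-cycle e′ (at-path a))

    -- Every vertex of the tree component receives a single name: two occurrences one above the
    -- other would give a cycle, and two occurrences in different branches contradict
    -- `siblings-disjoint`.
    at-≡ : ∀ {v c u s s′} {p : Rep o v c} → At p u s → At p u s′ → s ≡ s′
    at-≡ here b = sym (at-root b)
    at-≡ a here = at-root a
    at-≡ (via a) (via b) = at-≡ a b
    at-≡ (left a) (left b) = at-≡ a b
    at-≡ (right a) (right b) = at-≡ a b
    at-≡ (left {e = e} {e′} {ne} {h} {h′} a) (right b) = ⊥-elim (siblings-disjoint e e′ h h′ ne (at-path a) (at-path b))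
    at-≡ (right {e = e} {e′} {ne} {h} {h′} a) (left b) = ⊥-elim (siblings-disjoint e e′ h h′ ne (at-path b) (at-path a))

    rep-child : ∀ {u s w} (p : Rep o u s) → u ⟶ w → ¬ Hybridᵛ w → ∃ λ t → t ⋖ s × At p w t
    rep-child (tip refl) f k = contradiction f (no-child (taxon-mark _))
    rep-child (via h e _ _ e′ h′ p) f k
      with children (hybrid-parent h e) e e′ (λ { refl → h′ h }) f
    ... | inj₁ refl = contradiction h k
    ... | inj₂ refl = _ , via , via here
    rep-child (fork e e′ ne h h′ p q) f k with children (branch-mark e e′ ne) e e′ ne f
    ... | inj₁ refl = _ , left , left here
    ... | inj₂ refl = _ , right , right here

    at-trans : ∀ {v c u s w t} {p : Rep o v c} (a : At p u s) → At (at-rep a) w t → At p w t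
    at-trans here      b = b
    at-trans (via a)   b = via (at-trans a b)
    at-trans (left a)  b = left (at-trans a b)
    at-trans (right a) b = right (at-trans a b)

    at-child : ∀ {v c u s w} {p : Rep o v c} → At p u s → u ⟶ w → ¬ Hybridᵛ w → ∃ λ t → t ⋖ s × At p w t
    at-child a f k = let t , t⋖s , b = rep-child (at-rep a) f k in t , t⋖s , at-trans a b

    rep-hybrid : ∀ {u s r i} → Rep o u s → Hybridᵛ r → u ⟶ r → r ⟶ taxon i → ∃ λ t → s ≡ via (i , o u) t
    rep-hybrid (tip refl) h e f = contradiction e (no-child (taxon-mark _))
    rep-hybrid (via {t = t} h′ e′ f′ refl _ _ _) h e f with hybrid-child-≡ h′ h e′ e
    ... | refl with taxon-injective (only-child (inj₂ h) f′ f)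
    ... | refl = t , refl
    rep-hybrid (fork e₁ e₂ ne h₁ h₂ _ _) h e f with children (branch-mark e₁ e₂ ne) e₁ e₂ ne e
    ... | inj₁ refl = contradiction h h₁
    ... | inj₂ refl = contradiction h h₂

    rep-⋖ : ∀ {u s t} → Rep o u s → t ⋖ s → ∃ λ w → u ⟶ w × Rep o w t
    rep-⋖ (via _ _ _ _ e _ p) via = _ , e , p
    rep-⋖ (fork e _ _ _ _ p _) left = _ , e , p
    rep-⋖ (fork _ e _ _ _ _ q) right = _ , e , q

    private
      Holds : Letter n → Vertex → Set
      Holds (inj₁ i)       u = u ≡ taxon i
      Holds (inj₂ (i , b)) u = ∃ λ r → Hybridᵛ r × u ⟶ r × r ⟶ taxon i × o u ≡ b

      holds-≡ : Oriented o → ∀ x {u u′} → Holds x u → Holds x u′ → u ≡ u′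
      holds-≡ or (inj₁ i) refl refl = refl
      holds-≡ or (inj₂ (i , b)) {u} {u′} (r , h , e , f , eq) (r′ , h′ , e′ , f′ , eq′)
        with parent-≡ (taxon-¬hybrid i) f f′ | u Fin.≟ u′
      ... | refl | yes u≡u′ = u≡u′
      ... | refl | no u≢u′  = contradiction (trans eq (sym eq′)) (or h e e′ u≢u′)

      occ⇒at : ∀ {v c} (p : Rep o v c) x → 1 ≤ occ x c → ∃ λ u → ∃ λ s → At p u s × Holds x u
      occ⇒at {c = c} p (inj₁ i) le with ⊑-at p (occ⇒tip⊑ c le)
      ... | u , a with at-rep a
      ... | tip eq = u , _ , a , eq
      occ⇒at {c = c} p (inj₂ a) le with occ⇒via⊑ c le
      ... | t , q with ⊑-at p q
      ... | u , a with at-rep a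
      ... | via h e f eq _ _ _ = u , _ , a , _ , h , e , f , eq

      indicator≤1 : ∀ {P : Set} (P? : Dec P) → ⟦ P? ⟧ ≤ 1
      indicator≤1 (yes _) = ℕ.≤-refl
      indicator≤1 (no _)  = z≤n

      +≤1 : ∀ {a b} → a ≤ 1 → b ≤ 1 → (1 ≤ a → 1 ≤ b → ⊥) → a + b ≤ 1
      +≤1 {zero}  _ q _ = q
      +≤1 {suc zero} {zero}  _ _ _ = ℕ.≤-refl
      +≤1 {suc zero} {suc b} _ _ h = ⊥-elim (h (s≤s z≤n) (s≤s z≤n))
      +≤1 {suc (suc a)} (s≤s ()) _ _

      -- In an oriented network a letter determines the vertex that carries it, so a second
      -- occurrence would put this vertex below itself or below two siblings.
      occ≤1 : Oriented o → ∀ {v c} → Rep o v c → ∀ x → occ x c ≤ 1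
      occ≤1 or (tip {i = i} _) x = indicator≤1 (x ≟ˣ inj₁ i)
      occ≤1 or (via {i = i} {b} {t} h e f eq e′ h′ p) x with x ≟ˣ inj₂ (i , b)
      ... | no _ = occ≤1 or p x
      ... | yes refl = +≤1 {1} ℕ.≤-refl (occ≤1 or p x) λ _ le → let u , s , a , q = occ⇒at p x le in
        no-cycle e′ (subst (TreePath _) (holds-≡ or x q (_ , h , e , f , eq)) (at-path a))
      occ≤1 or (fork e e′ ne h h′ p q) x = +≤1 (occ≤1 or p x) (occ≤1 or q x) λ le le′ →
        let u , s , a , k = occ⇒at p x le ; u′ , s′ , a′ , k′ = occ⇒at q x le′ in
        siblings-disjoint e e′ h h′ ne (at-path a) (subst (TreePath _) (holds-≡ or x k′ k) (at-path a′))

    module _ {v₀ c} (start₀ : origin ⟶ v₀) (¬h₀ : ¬ Hybridᵛ v₀) (p : Rep o v₀ c) where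

      data Class (u : Vertex) : Set where
        is-origin : u ≡ origin → Class u
        is-node   : ∀ {s} → At p u s → Class u
        is-ret    : Hybridᵛ u → Class u
        is-lf     : ∀ {r} → Hybridᵛ r → r ⟶ u → Class u

      origin-mark : mark origin ≡ root
      origin-mark = Equivalence.from (origin-root origin) refl

      private
        class-step : ∀ {u w} → Class u → u ⟶ w → Class w
        class-step {w = w} k e with hybridᵛ? w
        ... | yes h = is-ret h
        class-step (is-origin refl) e | no ¬h with only-child (inj₁ origin-mark) start₀ e
        ... | refl = is-node here
        class-step (is-node a) e | no ¬h = is-node (proj₂ (proj₂ (at-child a e ¬h)))
        class-step (is-ret h) e | no ¬h = is-lf h e
        class-step (is-lf h f) e | no ¬h = contradiction e (no-child (one-component h f))

        class-star : ∀ {u w} → Class u → Star _⟶_ u w → Class w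
        class-star k ε        = k
        class-star k (e ◅ es) = class-star (class-step k e) es

      -- This is where reachability enters: the origin has a class, and a child of a classified
      -- vertex has one too.
      classify : ∀ u → Class u
      classify u = class-star (is-origin refl) (reachable u)

      -- The parent of a node is the origin or another node. This separates the nodes from the
      -- leaves below reticulations.
      at-parent : ∀ {u s} → At p u s → ∃ λ q → q ⟶ u × ¬ Hybridᵛ q × ¬ Hybridᵛ u
      at-parent a = go (at-path a) (λ h → case trans (sym origin-mark) h of λ ()) start₀ ¬h₀
        where
        go : ∀ {v u} → TreePath v u → ∀ {q} → ¬ Hybridᵛ q → q ⟶ v → ¬ Hybridᵛ v → ∃ λ q → q ⟶ u × ¬ Hybridᵛ q × ¬ Hybridᵛ u
        go ε kq e kv = _ , e , kq , kv
        go (p ▸ f , k) kq e kv = let q , e′ , _ , ku = go p kq e kv in _ , f , ku , k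

      at-¬lf : ∀ {u s r} → At p u s → Hybridᵛ r → r ⟶ u → ⊥
      at-¬lf a h e = let q , f , kq , ku = at-parent a in kq (subst Hybridᵛ (parent-≡ ku e f) h)

      at-tree : ∀ {u} → mark u ≡ tree → ∃ λ s → At p u s
      at-tree {u} m with classify u
      ... | is-origin refl with () ← trans (sym m) origin-mark
      ... | is-node a = _ , a
      ... | is-ret h with () ← trans (sym m) h
      ... | is-lf h e with () ← trans (sym m) (one-component h e)

      -- The unique parent of the leaf `i` decides. If it is a reticulation, its two parents carry
      -- the two labels and the leaf is no node; otherwise the leaf is a node, hence a tip, and no
      -- reticulation has it as its child.
      rep-valid : Oriented o → Valid c
      rep-valid or = valid λ i b → go i b (#≡1 (λ u → T? (edge u (taxon i))) (indegree-≡ (taxon-mark i)))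
        where
        ≡1 : ∀ x → 1 ≤ occ x c → occ x c ≡ 1
        ≡1 x le = ℕ.≤-antisym (occ≤1 or p x) le
        ≡0 : ∀ x → ¬ 1 ≤ occ x c → occ x c ≡ 0
        ≡0 x le = ℕ.n≤0⇒n≡0 (ℕ.≤-pred (ℕ.≰⇒> le))
        parent-with : ∀ {r} → Hybridᵛ r → ∀ b → ∃ λ u → u ⟶ r × o u ≡ b
        parent-with {r} h b with #≡2 (λ u → T? (edge u r)) (indegree-≡ h)
        ... | u , u′ , e , e′ , u≢u′ , _ with o u in eq | o u′ in eq′ | b
        ... | false | false | _ = contradiction (trans eq (sym eq′)) (or h e e′ u≢u′)
        ... | true  | true  | _ = contradiction (trans eq (sym eq′)) (or h e e′ u≢u′)
        ... | false | true  | false = u , e , eq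
        ... | false | true  | true  = u′ , e′ , eq′
        ... | true  | false | true  = u , e , eq
        ... | true  | false | false = u′ , e′ , eq′
        go : ∀ i b → (∃ λ q → q ⟶ taxon i × (∀ q′ → q′ ⟶ taxon i → q′ ≡ q)) →
             occ (inj₁ i) c + occ (inj₂ (i , b)) c ≡ 1
        go i b (q , e , only) with hybridᵛ? q
        ... | yes h = cong₂ _+_ (≡0 (inj₁ i) λ le → let u , s , a , eq = occ⇒at p (inj₁ i) le in
                                   at-¬lf a h (subst (q ⟶_) (sym eq) e))
                                (≡1 (inj₂ (i , b)) present)
          where
          present : 1 ≤ occ (inj₂ (i , b)) c
          present with parent-with h b
          ... | u , f , refl with at-tree (hybrid-parent h f)
          ... | s , a with rep-hybrid (at-rep a) h f e
          ... | t , refl = via⊑⇒occ (at-⊑ a)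
        ... | no ¬h = cong₂ _+_ (≡1 (inj₁ i) (present (classify (taxon i))))
                                (≡0 (inj₂ (i , b)) λ le → let u , s , a , r , h , _ , f , _ = occ⇒at p (inj₂ (i , b)) le in
                                   ¬h (subst Hybridᵛ (only r f) h))
          where
          present : Class (taxon i) → 1 ≤ occ (inj₁ i) c
          present (is-origin eq) with () ← trans (sym (taxon-mark i)) (trans (cong mark eq) origin-mark)
          present (is-ret h) = contradiction h (taxon-¬hybrid i)
          present (is-lf h f) = contradiction (subst Hybridᵛ (only _ f) h) ¬h
          present (is-node a) with at-rep a | rep-mark (at-rep a)
          ... | tip eq | _ = subst (λ j → 1 ≤ occ (inj₁ j) c) (sym (taxon-injective eq)) (tip⊑⇒occ (at-⊑ a))
          ... | via _ _ _ _ _ _ _ | m with () ← trans (sym (taxon-mark i)) m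
          ... | fork _ _ _ _ _ _ _ | m with () ← trans (sym (taxon-mark i)) m

      ret-hybrid : Oriented o → ∀ {r i} → Hybridᵛ r → r ⟶ taxon i → Hybrid c i
      ret-hybrid or {r} {i} h f with hybrid? c i
      ... | yes k = k
      ... | no ¬k with ⊑-at p (¬hybrid⇒tip ¬k)
      ... | u , a with at-rep a
      ... | tip refl = ⊥-elim (at-¬lf a h f)

      private
        data Names : Vertex → Name n → Set where
          orig : Names origin orig
          node   : ∀ {u s} → At p u s → Names u (node s)
          ret    : ∀ {r i} → Hybridᵛ r → r ⟶ taxon i → Names r (ret i)
          lf     : ∀ {r u i} → Hybridᵛ r → r ⟶ u → u ≡ taxon i → Names u (lf i)

        names-total : ∀ u → ∃ (Names u)
        names-total u with classify u
        ... | is-origin refl = _ , orig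
        ... | is-node a      = _ , node a
        ... | is-ret h       = _ , ret h (proj₂ (hybrid-child h))
        ... | is-lf h e      = _ , lf h e (proj₂ (taxon-surjective (one-component h e)))

        at-¬origin : ∀ {s} → ¬ At p origin s
        at-¬origin a = let q , e , _ = at-parent a in no-parent origin-mark e

        at-¬ret : ∀ {u s} → At p u s → ¬ Hybridᵛ u
        at-¬ret a = let _ , _ , _ , k = at-parent a in k

        names-≡ : ∀ {u x y} → Names u x → Names u y → x ≡ y
        names-≡ orig orig = refl
        names-≡ orig (node a) = ⊥-elim (at-¬origin a)
        names-≡ orig (ret h _) with () ← trans (sym origin-mark) h
        names-≡ orig (lf _ e _) = ⊥-elim (no-parent origin-mark e)
        names-≡ (node a) orig = ⊥-elim (at-¬origin a)
        names-≡ (node a) (node b) = cong node (at-≡ a b)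
        names-≡ (node a) (ret h _) = ⊥-elim (at-¬ret a h)
        names-≡ (node a) (lf h e _) = ⊥-elim (at-¬lf a h e)
        names-≡ (ret h _) orig with () ← trans (sym origin-mark) h
        names-≡ (ret h _) (node a) = ⊥-elim (at-¬ret a h)
        names-≡ (ret h f) (ret _ f′) = cong ret (taxon-injective (only-child (inj₂ h) f f′))
        names-≡ (ret h _) (lf _ _ eq) = ⊥-elim (taxon-¬hybrid _ (subst Hybridᵛ eq h))
        names-≡ (lf _ e _) orig = ⊥-elim (no-parent origin-mark e)
        names-≡ (lf h e _) (node a) = ⊥-elim (at-¬lf a h e)
        names-≡ (lf _ _ eq) (ret h _) = ⊥-elim (taxon-¬hybrid _ (subst Hybridᵛ eq h))
        names-≡ (lf _ _ eq) (lf _ _ eq′) = cong lf (taxon-injective (trans (sym eq) eq′))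

        vertex-≡ : ∀ {u v x} → Names u x → Names v x → u ≡ v
        vertex-≡ orig orig = refl
        vertex-≡ (node a) (node b) = rep-≡ (at-rep a) (at-rep b)
        vertex-≡ (ret h f) (ret h′ f′) = parent-≡ (taxon-¬hybrid _) f f′
        vertex-≡ (lf _ _ refl) (lf _ _ refl) = refl

        names-edge⁺ : ∀ {u v x y} → Names u x → Names v y → u ⟶ v → Edge c x y
        names-edge⁺ _ orig e = ⊥-elim (no-parent origin-mark e)
        names-edge⁺ (lf h f _) _ e = ⊥-elim (no-child (one-component h f) e)
        names-edge⁺ orig (node a) e with only-child (inj₁ origin-mark) start₀ e
        ... | refl with at-root a
        ... | refl = start
        names-edge⁺ orig (ret h _) e with () ← trans (sym origin-mark) (hybrid-parent h e)
        names-edge⁺ orig (lf {i = i} h f refl) e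
          with () ← trans (sym origin-mark) (subst Hybridᵛ (parent-≡ (taxon-¬hybrid i) f e) h)
        names-edge⁺ (node a) (node b) e with at-child a e (at-¬ret b)
        ... | t , t⋖s , b′ with at-≡ b b′
        ... | refl = along t⋖s
        names-edge⁺ (node a) (ret h f) e with rep-hybrid (at-rep a) h e f
        ... | t , refl = cross
        names-edge⁺ (node a) (lf {i = i} h f refl) e = ⊥-elim (at-¬ret a (subst Hybridᵛ (parent-≡ (taxon-¬hybrid i) f e) h))
        names-edge⁺ (ret h f) (node a) e = ⊥-elim (at-¬lf a h e)
        names-edge⁺ (ret h f) (ret h′ f′) e with () ← trans (sym h) (hybrid-parent h′ e)
        names-edge⁺ (ret h f) (lf h′ f′ refl) e with taxon-injective (only-child (inj₂ h) f e)
        ... | refl = hang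

        names-edge⁻ : ∀ {u v x y} → Names u x → Names v y → Edge c x y → u ⟶ v
        names-edge⁻ orig (node a) start = subst (origin ⟶_) (rep-≡ p (at-rep a)) start₀
        names-edge⁻ (node a) (node b) (along t⋖s) =
          let w , e , q = rep-⋖ (at-rep a) t⋖s in subst (_ ⟶_) (rep-≡ q (at-rep b)) e
        names-edge⁻ (node a) (ret h f) cross with at-rep a
        ... | via h′ e′ f′ _ _ _ _ = subst (_ ⟶_) (parent-≡ (taxon-¬hybrid _) f′ f) e′
        names-edge⁻ (ret h f) (lf _ _ refl) hang = f

        names-mark : ∀ {u x} → Names u x → mark u ≡ nameMark x
        names-mark orig     = origin-mark
        names-mark (node a)   = rep-mark (at-rep a)
        names-mark (ret h _)  = h
        names-mark (lf _ _ refl) = taxon-mark _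

        module _ (or : Oriented o) where
          names-member : ∀ {u x} → Names u x → c ∋ x
          names-member orig          = orig
          names-member (node a)      = node (at-⊑ a)
          names-member (ret h f)     = ret (ret-hybrid or h f)
          names-member (lf h f refl) = lf (ret-hybrid or h f)

          names-onto : ∀ {x} → c ∋ x → ∃ λ u → Names u x
          names-onto orig   = _ , orig
          names-onto (node q) = let u , a = ⊑-at p q in u , node a
          names-onto (ret k) with hybrid⇒via (rep-valid or) k true
          ... | t , q with ⊑-at p q
          ... | u , a with at-rep a
          ... | via h _ f _ _ _ _ = _ , ret h f
          names-onto (lf k) with hybrid⇒via (rep-valid or) k true
          ... | t , q with ⊑-at p q
          ... | u , a with at-rep a
          ... | via h _ f _ _ _ _ = _ , lf h f refl

          taxon-names : ∀ i → Names (taxon i) (leafName c i)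
          taxon-names i with hybrid? c i
          ... | yes k with names-onto (lf k)
          ...   | u , m@(lf _ _ refl) = m
          taxon-names i | no ¬k with ⊑-at p (¬hybrid⇒tip ¬k)
          ... | u , a with at-rep a
          ... | tip refl = node a

      rep-named : Oriented o → Named N c
      rep-named or = record
        { name      = λ u → proj₁ (names-total u)
        ; injective = λ {u} {v} eq → vertex-≡ (proj₂ (names-total u)) (subst (Names v) (sym eq) (proj₂ (names-total v)))
        ; member    = λ u → names-member or (proj₂ (names-total u))
        ; onto      = λ q → let u , m = names-onto or q in u , names-≡ (proj₂ (names-total u)) m
        ; edge-to   = λ {u} {v} → names-edge⁺ (proj₂ (names-total u)) (proj₂ (names-total v))
        ; edge-from = λ {u} {v} → names-edge⁻ (proj₂ (names-total u)) (proj₂ (names-total v))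
        ; mark-≡    = λ u → names-mark (proj₂ (names-total u))
        ; taxon-≡   = λ i → names-≡ (proj₂ (names-total (taxon i))) (taxon-names or i)
        }

  top : ∃ λ v → origin ⟶ v × (mark v ≡ tree ⊎ mark v ≡ leaf)
  top = tree-child origin λ m → case trans (sym m) (Equivalence.from (origin-root origin) refl) of λ ()

  top-¬hybrid : ¬ Hybridᵛ (proj₁ top)
  top-¬hybrid h with proj₂ (proj₂ top)
  ... | inj₁ m with () ← trans (sym h) m
  ... | inj₂ m with () ← trans (sym h) m

  -- The numbering of the vertices breaks the symmetry: the smaller parent of a reticulation gets
  -- `true`. There is no conflict, since a vertex has at most one reticulation child.
  oriented-exists : ∃ Oriented
  oriented-exists = (λ u → does (first? u)) , oriented
    where
    First : Vertex → Set
    First u = ∃ λ r → ∃ λ w → Hybridᵛ r × u ⟶ r × w ⟶ r × u Fin.< w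
    first? : ∀ u → Dec (First u)
    first? u = Fin.any? λ r → Fin.any? λ w → hybridᵛ? r ×-dec T? (edge u r) ×-dec T? (edge w r) ×-dec u Fin.<? w
    below : ∀ {p p′ r} → Hybridᵛ r → p ⟶ r → p′ ⟶ r → p Fin.< p′ → ¬ First p′
    below h e e′ p<p′ (r′ , w , h′ , f , f′ , p′<w) with hybrid-child-≡ h h′ e′ f
    ... | refl with #2⇒ (λ u → T? (edge u r′)) (indegree-≡ h) e e′ (λ { refl → ℕ.<-irrefl refl p<p′ }) f′
    ... | inj₁ refl = ℕ.<-asym p<p′ p′<w
    ... | inj₂ refl = ℕ.<-irrefl refl p′<w
    differ : ∀ {p p′ r} → Hybridᵛ r → p ⟶ r → p′ ⟶ r → p Fin.< p′ → does (first? p) ≢ does (first? p′)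
    differ {p} {p′} {r} h e e′ p<p′ eq with first? p | first? p′
    ... | _     | yes f = below h e e′ p<p′ f
    ... | no ¬f | no _  = ¬f (r , p′ , h , e , e′ , p<p′)
    oriented : Oriented (λ u → does (first? u))
    oriented {p} {p′} h e e′ p≢p′ eq with ℕ.<-cmp (Fin.toℕ p) (Fin.toℕ p′)
    ... | tri< p<p′ _ _ = differ h e e′ p<p′ eq
    ... | tri≈ _ q _ = p≢p′ (Fin.toℕ-injective q)
    ... | tri> _ _ p′<p = differ h e′ e p′<p (sym eq)

  encode : ∃ λ c → Valid c × Named N c
  encode = let v₀ , e , m = top ; o , or = oriented-exists ; c , p = rep-exists o v₀ m in
    c , rep-valid e top-¬hybrid p or , rep-named e top-¬hybrid p or

  module _ {c : Code n} (c! : Valid c) (P : Named N c) where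
    private module P = Named P

    bit : Name n → Bool
    bit (node (via (_ , b) _)) = b
    bit _                      = false

    private
      at : ∀ {x} → c ∋ x → Vertex
      at q = proj₁ (P.onto q)

      edge⁺ : ∀ {u x y} → P.name u ≡ x → Edge c x y → (q : c ∋ y) → u ⟶ at q
      edge⁺ eq e q = P.edge-from (subst₂ (Edge c) (sym eq) (sym (proj₂ (P.onto q))) e)

      at-mark : ∀ {x} (q : c ∋ x) → mark (at q) ≡ nameMark x
      at-mark q = trans (P.mark-≡ _) (cong nameMark (proj₂ (P.onto q)))

      node-¬hybrid : ∀ {t} (q : c ∋ node t) → ¬ Hybridᵛ (at q)
      node-¬hybrid {tip _}    q h with () ← trans (sym h) (at-mark q)
      node-¬hybrid {via _ _}  q h with () ← trans (sym h) (at-mark q)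
      node-¬hybrid {fork _ _} q h with () ← trans (sym h) (at-mark q)

    named-rep-at : ∀ {t u} → t ⊑ c → P.name u ≡ node t → Rep (bit ∘ P.name) u t
    named-rep-at {tip i} q eq = tip (P.injective (trans eq (trans (sym (leafName-tip q)) (sym (P.taxon-≡ i)))))
    named-rep-at {via (i , b) t} q eq = via (at-mark (ret k)) (edge⁺ eq cross (ret k))
      (subst (at (ret k) ⟶_) (P.injective (trans (proj₂ (P.onto (lf k))) (trans (sym (leafName-lf {c = c} k)) (sym (P.taxon-≡ i)))))
        (edge⁺ (proj₂ (P.onto (ret k))) hang (lf k)))
      (cong bit eq) (edge⁺ eq (along via) (node q′)) (node-¬hybrid (node q′)) (named-rep-at q′ (proj₂ (P.onto (node q′))))
      where
      k = via⇒hybrid c! q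
      q′ = ⊑-trans (via here) q
    named-rep-at {fork l r} q eq = fork (edge⁺ eq (along left) (node ql)) (edge⁺ eq (along right) (node qr))
      (λ e → fork-disjoint (linear-⊑ q (valid⇒linear c!)) (here {t = l})
        (subst (_⊑ r) (node-injective (trans (sym (proj₂ (P.onto (node qr)))) (trans (sym (cong P.name e)) (proj₂ (P.onto (node ql)))))) here))
      (node-¬hybrid (node ql)) (node-¬hybrid (node qr))
      (named-rep-at ql (proj₂ (P.onto (node ql)))) (named-rep-at qr (proj₂ (P.onto (node qr))))
      where
      ql = ⊑-trans (left here) q
      qr = ⊑-trans (right here) q
      node-injective : ∀ {s t : Code n} → node s ≡ node t → s ≡ t
      node-injective refl = refl

    named-oriented : Oriented (bit ∘ P.name)
    named-oriented {p} {p′} {r} h e e′ p≢p′ eq = go refl refl refl (P.member r) (P.edge-to e) (P.edge-to e′)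
      where
      go : ∀ {x y z} → P.name p ≡ x → P.name p′ ≡ y → P.name r ≡ z → c ∋ z → Edge c x z → Edge c y z → ⊥
      go ep ep′ er (node {t} q) _ _ = node-¬hybrid (node q) (subst Hybridᵛ (P.injective (trans er (sym (proj₂ (P.onto (node q)))))) h)
      go ep ep′ er (lf k) _ _ with () ← trans (sym h) (trans (P.mark-≡ r) (cong nameMark er))
      go ep ep′ er (ret k) (cross {b = b} {t}) (cross {b = b′} {t′})
        with trans (sym (cong bit ep)) (trans eq (cong bit ep′))
      ... | refl with via-unique (valid⇒linear c!) (node⁻ (subst (c ∋_) ep (P.member p))) (node⁻ (subst (c ∋_) ep′ (P.member p′)))
        where
        node⁻ : ∀ {t} → c ∋ node t → t ⊑ c
        node⁻ (node q) = q
      ... | refl = p≢p′ (P.injective (trans ep (sym ep′)))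

    -- With `named-oriented` this is the converse of `rep-valid` and `rep-named`: the valid codes
    -- naming `N` are exactly those represented at the child of its root under some orientation.
    named-rep : Rep (bit ∘ P.name) (proj₁ top) c
    named-rep = subst (λ v → Rep (bit ∘ P.name) v c)
      (only-child (inj₁ (Equivalence.from (origin-root origin) refl)) (subst (_⟶ at (node here)) origin-at (edge⁺ (proj₂ (P.onto orig)) start (node here))) (proj₁ (proj₂ top)))
      (named-rep-at here (proj₂ (P.onto (node here))))
      where
      origin-at : at orig ≡ origin
      origin-at = Equivalence.to (origin-root (at orig)) (at-mark orig)

-- The codes of a network

relabel : (Lab n → Lab n) → Code n → Code n
relabel f (tip i)    = tip i
relabel f (via a t)  = via (f a) (relabel f t)
relabel f (fork l r) = fork (relabel f l) (relabel f r)

erase : Code n → Code n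
erase = relabel λ (i , _) → i , false

toggle : Fin n → Lab n → Lab n
toggle i (j , b) = j , (if does (i Fin.≟ j) then not b else b)

swaps : Code n → List (Code n)
swaps (tip i)    = tip i ∷ []
swaps (via a t)  = map (via a) (swaps t)
swaps (fork l r) = cartesianProductWith fork (swaps l) (swaps r) ++ cartesianProductWith (flip fork) (swaps l) (swaps r)

toggles : List (Fin n) → Code n → List (Code n)
toggles []       c = c ∷ []
toggles (i ∷ is) c = toggles is c ++ toggles is (relabel (toggle i) c)

-- All codes of the network of `c`: any order at every fork and any numbering of the parents of
-- every reticulation. They are distinct by `variants-unique` and complete by `named⇒variant`.
variants : Code n → List (Code n)
variants c = concatMap (toggles (hybrids c)) (swaps c)

tipCount forkCount : Code n → ℕ
tipCount (tip i)    = 1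
tipCount (via a t)  = tipCount t
tipCount (fork l r) = tipCount l + tipCount r
forkCount (tip i)    = 0
forkCount (via a t)  = forkCount t
forkCount (fork l r) = suc (forkCount l + forkCount r)

tips≡forks+1 : ∀ (c : Code n) → tipCount c ≡ suc (forkCount c)
tips≡forks+1 (tip i)    = refl
tips≡forks+1 (via a t)  = tips≡forks+1 t
tips≡forks+1 (fork l r) = trans (cong₂ _+_ (tips≡forks+1 l) (tips≡forks+1 r)) (ℕ.+-suc (suc (forkCount l)) (forkCount r))

∑-occ-tip : ∀ (c : Code n) → ∑ (allFin n) (λ i → occ (inj₁ i) c) ≡ tipCount c
∑-occ-tip {n} (tip i) = ∑-indicator (λ j → inj₁ j ≟ˣ inj₁ i) (allFin! n) (∈-allFin i) refl λ { _ refl → refl }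
∑-occ-tip {n} (via a t) = trans (∑-cong (allFin n) (λ {i} _ → cong (_+ occ (inj₁ i) t) (⟦⟧-no (inj₁ i ≟ˣ inj₂ a) λ ()))) (∑-occ-tip t)
∑-occ-tip {n} (fork l r) = trans (∑-+ (allFin n) (λ i → occ (inj₁ i) l) (λ i → occ (inj₁ i) r)) (cong₂ _+_ (∑-occ-tip l) (∑-occ-tip r))

hybrids+tips : ∀ {c : Code n} → Valid c → length (hybrids c) + tipCount c ≡ n
hybrids+tips {n} {c} c! = begin
  length (hybrids c) + tipCount c
    ≡⟨ cong₂ _+_ (length-filter (hybrid? c) (allFin n)) (sym (∑-occ-tip c)) ⟩
  ∑ (allFin n) (λ i → ⟦ hybrid? c i ⟧) + ∑ (allFin n) (λ i → occ (inj₁ i) c)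
    ≡⟨ sym (∑-+ (allFin n) (λ i → ⟦ hybrid? c i ⟧) (λ i → occ (inj₁ i) c)) ⟩
  ∑ (allFin n) (λ i → ⟦ hybrid? c i ⟧ + occ (inj₁ i) c)
    ≡⟨ ∑-cong (allFin n) (λ {i} _ → one i) ⟩
  ∑ (allFin n) (λ _ → 1)
    ≡⟨ trans (∑-const (allFin n) 1) (trans (ℕ.*-identityʳ _) (length-allFin n)) ⟩
  n ∎
  where
  open ≡-Reasoning
  one : ∀ i → ⟦ hybrid? c i ⟧ + occ (inj₁ i) c ≡ 1
  one i with occ (inj₁ i) c | at-most-once (valid⇒linear c!) (inj₁ i)
  ... | zero        | _ = refl
  ... | suc zero    | _ = refl
  ... | suc (suc _) | s≤s ()

private
  length-cartesian : ∀ (f : A → B → C) xs ys → length (cartesianProductWith f xs ys) ≡ length xs * length ys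
  length-cartesian f []       ys = refl
  length-cartesian f (x ∷ xs) ys = trans (length-++ (map (f x) ys)) (cong₂ _+_ (length-map (f x) ys) (length-cartesian f xs ys))

length-swaps : ∀ (c : Code n) → length (swaps c) ≡ 2 ^ forkCount c
length-swaps (tip i)    = refl
length-swaps (via a t)  = trans (length-map (via a) (swaps t)) (length-swaps t)
length-swaps (fork l r) = begin
  length (cartesianProductWith fork (swaps l) (swaps r) ++ cartesianProductWith (flip fork) (swaps l) (swaps r))
    ≡⟨ length-++ (cartesianProductWith fork (swaps l) (swaps r)) ⟩
  length (cartesianProductWith fork (swaps l) (swaps r)) + length (cartesianProductWith (flip fork) (swaps l) (swaps r))
    ≡⟨ cong₂ _+_ (prod fork) (prod (flip fork)) ⟩
  2 ^ (forkCount l + forkCount r) + 2 ^ (forkCount l + forkCount r)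
    ≡⟨ cong (2 ^ (forkCount l + forkCount r) +_) (sym (ℕ.+-identityʳ _)) ⟩
  2 ^ suc (forkCount l + forkCount r) ∎
  where
  open ≡-Reasoning
  prod : ∀ f → length (cartesianProductWith f (swaps l) (swaps r)) ≡ 2 ^ (forkCount l + forkCount r)
  prod f = trans (length-cartesian f (swaps l) (swaps r))
    (trans (cong₂ _*_ (length-swaps l) (length-swaps r)) (sym (ℕ.^-distribˡ-+-* 2 (forkCount l) (forkCount r))))

length-toggles : ∀ is (c : Code n) → length (toggles is c) ≡ 2 ^ length is
length-toggles []       c = refl
length-toggles (i ∷ is) c = trans (length-++ (toggles is c)) (cong₂ _+_ (length-toggles is c)
  (trans (length-toggles is _) (sym (ℕ.+-identityʳ _))))

-- There is one fork less than there are tips, and the tips and the reticulations number n together,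
-- so the two exponents add up to n - 1 for every code. A valid code forces n ≥ 1, hence the
-- truncated subtraction is exact. That the number depends on n alone is what allows codes to be
-- counted instead of networks.
length-variants : ∀ {c : Code n} → Valid c → length (variants c) ≡ 2 ^ (n ∸ 1)
length-variants {n} {c} c! = begin
  length (variants c)                                    ≡⟨ length-concatMap (toggles (hybrids c)) (swaps c) ⟩
  ∑ (swaps c) (λ d → length (toggles (hybrids c) d))     ≡⟨ ∑-cong (swaps c) (λ {d} _ → length-toggles (hybrids c) d) ⟩
  ∑ (swaps c) (λ _ → 2 ^ length (hybrids c))             ≡⟨ ∑-const (swaps c) _ ⟩
  length (swaps c) * 2 ^ length (hybrids c)              ≡⟨ cong (_* 2 ^ length (hybrids c)) (length-swaps c) ⟩
  2 ^ forkCount c * 2 ^ length (hybrids c)               ≡⟨ sym (ℕ.^-distribˡ-+-* 2 (forkCount c) _) ⟩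
  2 ^ (forkCount c + length (hybrids c))                 ≡⟨ cong (2 ^_) (cong (_∸ 1) exponent) ⟩
  2 ^ (n ∸ 1)                                            ∎
  where
  open ≡-Reasoning
  exponent : suc (forkCount c + length (hybrids c)) ≡ n
  exponent = trans (cong (_+ length (hybrids c)) (sym (tips≡forks+1 c))) (trans (ℕ.+-comm (tipCount c) _) (hybrids+tips c!))

occ-relabel : ∀ (f : Lab n → Lab n) i c → occ (inj₁ i) (relabel f c) ≡ occ (inj₁ i) c
occ-relabel f i (tip j)    = refl
occ-relabel f i (via a t)  = cong₂ _+_ (trans (⟦⟧-no (inj₁ i ≟ˣ inj₂ (f a)) λ ()) (sym (⟦⟧-no (inj₁ i ≟ˣ inj₂ a) λ ()))) (occ-relabel f i t)
occ-relabel f i (fork l r) = cong₂ _+_ (occ-relabel f i l) (occ-relabel f i r)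

relabel-∘ : ∀ {f g h : Lab n → Lab n} → (∀ a → f (g a) ≡ h a) → ∀ c → relabel f (relabel g c) ≡ relabel h c
relabel-∘ e (tip i)    = refl
relabel-∘ e (via a t)  = cong₂ via (e a) (relabel-∘ e t)
relabel-∘ e (fork l r) = cong₂ fork (relabel-∘ e l) (relabel-∘ e r)

-- Distinctness of the variants

private
  -- Weaker than `Linear` because it has to survive `erase`, after which the two parents of a
  -- reticulation carry the same label.
  TipLinear : Code n → Set
  TipLinear c = ∀ i → occ (inj₁ i) c ≤ 1

  swaps-occ : ∀ i (c : Code n) {d} → d ∈ swaps c → occ (inj₁ i) d ≡ occ (inj₁ i) c
  swaps-occ i (tip j)    (here refl) = refl
  swaps-occ i (via a t)  p with ∈-map⁻ (via a) p
  ... | u , q , refl = cong (⟦ inj₁ i ≟ˣ inj₂ a ⟧ +_) (swaps-occ i t q)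
  swaps-occ i (fork l r) p with ∈-++⁻ (cartesianProductWith fork (swaps l) (swaps r)) p
  ... | inj₁ q with ∈-cartesianProductWith⁻ fork (swaps l) (swaps r) q
  ...   | _ , _ , q₁ , q₂ , refl = cong₂ _+_ (swaps-occ i l q₁) (swaps-occ i r q₂)
  swaps-occ i (fork l r) p | inj₂ q with ∈-cartesianProductWith⁻ (flip fork) (swaps l) (swaps r) q
  ...   | l′ , r′ , q₁ , q₂ , refl = trans (ℕ.+-comm (occ (inj₁ i) r′) _) (cong₂ _+_ (swaps-occ i l q₁) (swaps-occ i r q₂))

  -- If swapping the branches of a fork gave the same code as not swapping them, the first branch
  -- would be a drawing of both subtrees, and each of its tips would occur twice.
  swaps-unique : ∀ (c : Code n) → TipLinear c → Unique (swaps c)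
  swaps-unique (tip i)    lin = [] ∷ []
  swaps-unique (via a t)  lin = Unique.map⁺ (λ { refl → refl })
    (swaps-unique t λ i → ℕ.≤-trans (ℕ.m≤n+m _ ⟦ inj₁ i ≟ˣ inj₂ a ⟧) (lin i))
  swaps-unique (fork l r) lin = Unique.++⁺
    (Unique.cartesianProductWith⁺ fork (λ { refl → refl , refl }) l! r!)
    (Unique.cartesianProductWith⁺ (flip fork) (λ { refl → refl , refl }) l! r!)
    λ (p , q) → apart (∈-cartesianProductWith⁻ fork (swaps l) (swaps r) p)
                      (∈-cartesianProductWith⁻ (flip fork) (swaps l) (swaps r) q)
    where
    l! = swaps-unique l λ i → ℕ.≤-trans (ℕ.m≤m+n _ _) (lin i)
    r! = swaps-unique r λ i → ℕ.≤-trans (ℕ.m≤n+m _ (occ (inj₁ i) l)) (lin i)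
    apart : ∀ {z} → (∃ λ x → ∃ λ y → x ∈ swaps l × y ∈ swaps r × z ≡ fork x y) →
            (∃ λ x → ∃ λ y → x ∈ swaps l × y ∈ swaps r × z ≡ fork y x) → ⊥
    apart (x , y , x∈ , y∈ , refl) (.y , .x , y∈l , x∈r , refl) =
      let i , q = some-tip x in
      ℕ.<-irrefl refl (ℕ.≤-trans (ℕ.+-mono-≤ (subst (1 ≤_) (swaps-occ i l x∈) (tip⊑⇒occ q))
                                             (subst (1 ≤_) (swaps-occ i r x∈r) (tip⊑⇒occ q))) (lin i))

  map-cartesian : ∀ (f : Code n → Code n → Code n) (g : Code n → Code n) → (∀ x y → g (f x y) ≡ f (g x) (g y)) → ∀ xs ys →
    map g (cartesianProductWith f xs ys) ≡ cartesianProductWith f (map g xs) (map g ys)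
  map-cartesian f g e []       ys = refl
  map-cartesian f g e (x ∷ xs) ys = trans (map-++ g (map (f x) ys) _)
    (cong₂ _++_ (trans (sym (map-∘ ys)) (trans (map-cong (e x) ys) (map-∘ ys))) (map-cartesian f g e xs ys))

  swaps-relabel : ∀ (f : Lab n → Lab n) c → swaps (relabel f c) ≡ map (relabel f) (swaps c)
  swaps-relabel f (tip i)    = refl
  swaps-relabel f (via a t)  = trans (cong (map (via (f a))) (swaps-relabel f t)) (trans (sym (map-∘ (swaps t))) (map-∘ (swaps t)))
  swaps-relabel f (fork l r) = sym (trans (map-++ (relabel f) (cartesianProductWith fork (swaps l) (swaps r)) _)
    (cong₂ _++_ (trans (map-cartesian fork (relabel f) (λ _ _ → refl) (swaps l) (swaps r)) (eq fork))
                (trans (map-cartesian (flip fork) (relabel f) (λ _ _ → refl) (swaps l) (swaps r)) (eq (flip fork)))))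
    where
    eq : ∀ g → cartesianProductWith g (map (relabel f) (swaps l)) (map (relabel f) (swaps r))
             ≡ cartesianProductWith g (swaps (relabel f l)) (swaps (relabel f r))
    eq g = sym (cong₂ (cartesianProductWith g) (swaps-relabel f l) (swaps-relabel f r))

  unique-map⇒injective : ∀ {f : A → B} {xs x y} → Unique (map f xs) → x ∈ xs → y ∈ xs → f x ≡ f y → x ≡ y
  unique-map⇒injective u (here refl) (here refl) e = refl
  unique-map⇒injective {f = f} (u ∷ _) (here refl) (there q) e = contradiction e (All.lookup u (∈-map⁺ f q))
  unique-map⇒injective {f = f} (u ∷ _) (there p) (here refl) e = contradiction (sym e) (All.lookup u (∈-map⁺ f p))
  unique-map⇒injective (_ ∷ u) (there p) (there q) e = unique-map⇒injective u p q e

  toggles-erase : ∀ is {c d : Code n} → d ∈ toggles is c → erase d ≡ erase c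
  toggles-erase []       (here refl) = refl
  toggles-erase (i ∷ is) {c} p with ∈-++⁻ (toggles is c) p
  ... | inj₁ q = toggles-erase is q
  ... | inj₂ q = trans (toggles-erase is q) (relabel-∘ (λ _ → refl) c)

  -- The numbers at the occurrences of the label `i`, read from left to right. Toggling `i`
  -- complements this list and so changes the code as soon as the list is nonempty; toggling another
  -- label leaves it alone.
  bits : Fin n → Code n → List Bool
  bits i (tip _)           = []
  bits i (via (j , b) t)   = (if does (i Fin.≟ j) then b ∷ [] else []) ++ bits i t
  bits i (fork l r)        = bits i l ++ bits i r

  bits-toggle : ∀ i (c : Code n) → bits i (relabel (toggle i) c) ≡ map not (bits i c)
  bits-toggle i (tip _)         = refl
  bits-toggle i (via (j , b) t) with i Fin.≟ j
  ... | yes _ = cong (not b ∷_) (bits-toggle i t)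
  ... | no _  = bits-toggle i t
  bits-toggle i (fork l r) = trans (cong₂ _++_ (bits-toggle i l) (bits-toggle i r)) (sym (map-++ not (bits i l) _))

  bits-toggle-≢ : ∀ {i j} (c : Code n) → i ≢ j → bits i (relabel (toggle j) c) ≡ bits i c
  bits-toggle-≢ (tip _) i≢j = refl
  bits-toggle-≢ {i = i} {j} (via (k , b) t) i≢j with i Fin.≟ k | j Fin.≟ k
  ... | yes refl | yes refl = contradiction refl i≢j
  ... | yes refl | no _     = cong (b ∷_) (bits-toggle-≢ t i≢j)
  ... | no _     | _        = bits-toggle-≢ t i≢j
  bits-toggle-≢ (fork l r) i≢j = cong₂ _++_ (bits-toggle-≢ l i≢j) (bits-toggle-≢ r i≢j)

  bits-toggles : ∀ {i} is {c d : Code n} → i ∉ is → d ∈ toggles is c → bits i d ≡ bits i c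
  bits-toggles []       i∉ (here refl) = refl
  bits-toggles (j ∷ is) {c} i∉ p with ∈-++⁻ (toggles is c) p
  ... | inj₁ q = bits-toggles is (i∉ ∘ there) q
  ... | inj₂ q = trans (bits-toggles is (i∉ ∘ there) q) (bits-toggle-≢ c (i∉ ∘ here))

  via⇒bits : ∀ {i b t} {c : Code n} → via (i , b) t ⊑ c → bits i c ≢ []
  via⇒bits {i = i} here eq with i Fin.≟ i
  via⇒bits here () | yes _
  ... | no ne = ne refl
  via⇒bits {i = i} (via {a = j , b} p) eq with i Fin.≟ j
  via⇒bits (via p) () | yes _
  ... | no _ = via⇒bits p eq
  via⇒bits (left {l = l} p) eq = via⇒bits p (++-conicalˡ _ _ eq)
  via⇒bits {i = i} (right {l = l} p) eq = via⇒bits p (++-conicalʳ (bits i l) _ eq)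

  map-not : ∀ bs → bs ≡ map not bs → bs ≡ []
  map-not []          _ = refl
  map-not (true  ∷ _) ()
  map-not (false ∷ _) ()

  toggle-bits : ∀ j i (c : Code n) → bits j c ≢ [] → bits j (relabel (toggle i) c) ≢ []
  toggle-bits j i c ne eq with j Fin.≟ i
  ... | no j≢i   = ne (trans (sym (bits-toggle-≢ c j≢i)) eq)
  ... | yes refl = ne (map-[] (bits i c) (trans (sym (bits-toggle i c)) eq))
    where
    map-[] : ∀ bs → map not bs ≡ [] → bs ≡ []
    map-[] [] _ = refl

  swaps-bits : ∀ i (c : Code n) {d} → d ∈ swaps c → bits i d ≡ [] → bits i c ≡ []
  swaps-bits i (tip j)    (here refl) eq = refl
  swaps-bits i (via (j , b) t)  p eq with ∈-map⁻ (via (j , b)) p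
  ... | u , q , refl with i Fin.≟ j
  ...   | no _ = swaps-bits i t q eq
  swaps-bits i (fork l r) p eq with ∈-++⁻ (cartesianProductWith fork (swaps l) (swaps r)) p
  ... | inj₁ q with ∈-cartesianProductWith⁻ fork (swaps l) (swaps r) q
  ...   | l′ , r′ , q₁ , q₂ , refl = cong₂ _++_ (swaps-bits i l q₁ (++-conicalˡ _ _ eq)) (swaps-bits i r q₂ (++-conicalʳ (bits i l′) _ eq))
  swaps-bits i (fork l r) p eq | inj₂ q with ∈-cartesianProductWith⁻ (flip fork) (swaps l) (swaps r) q
  ...   | l′ , r′ , q₁ , q₂ , refl = cong₂ _++_ (swaps-bits i l q₁ (++-conicalʳ (bits i r′) _ eq)) (swaps-bits i r q₂ (++-conicalˡ _ _ eq))

  toggles-unique : ∀ {is} {d : Code n} → Unique is → (∀ {i} → i ∈ is → bits i d ≢ []) → Unique (toggles is d)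
  toggles-unique {is = []} _ _ = [] ∷ []
  toggles-unique {is = i ∷ is} {d} (i∉ ∷ is!) h = Unique.++⁺
    (toggles-unique is! (h ∘ there))
    (toggles-unique is! (λ {j} j∈ → toggle-bits j i d (h (there j∈))))
    λ (p , q) → h (here refl) (map-not (bits i d)
      (trans (sym (bits-toggles is i∉is p)) (trans (bits-toggles is i∉is q) (bits-toggle i d))))
    where
    i∉is : i ∉ is
    i∉is i∈ = All.lookup i∉ i∈ refl

-- Toggling is invisible after `erase`, whereas different drawings remain different after it. Hence
-- the toggles of different drawings form disjoint blocks.
variants-unique : ∀ {c : Code n} → Valid c → Unique (variants c)
variants-unique {n} {c} c! = concatMap-unique (toggles (hybrids c)) (Unique.map⁻ erased!) each
  λ p q z∈ z∈′ → unique-map⇒injective erased! p q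
    (trans (sym (toggles-erase (hybrids c) z∈)) (toggles-erase (hybrids c) z∈′))
  where
  erased! : Unique (map erase (swaps c))
  erased! = subst Unique (swaps-relabel _ c) (swaps-unique (erase c) λ i →
    subst (_≤ 1) (sym (occ-relabel _ i c)) (at-most-once (valid⇒linear c!) (inj₁ i)))
  each : ∀ {d} → d ∈ swaps c → Unique (toggles (hybrids c) d)
  each {d} p = toggles-unique (filter-allFin! (hybrid? c)) λ i∈ eq →
    via⇒bits (proj₂ (hybrid⇒via c! (filter-allFin⁻ (hybrid? c) i∈) true)) (swaps-bits _ c p eq)

-- Completeness of the variants

module Orientations {n} (N : Network n) where
  open Representation N

  private
    Above : Fin n → Vertex → Set
    Above i u = ∃ λ r → Hybridᵛ r × u ⟶ r × r ⟶ taxon i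

    above? : ∀ i u → Dec (Above i u)
    above? i u = Fin.any? λ r → hybridᵛ? r ×-dec T? (edge u r) ×-dec T? (edge r (taxon i))

    turn : Fin n → (Vertex → Bool) → Vertex → Bool
    turn i o u = if does (above? i u) then not (o u) else o u

    not-inj : ∀ {a b} → not a ≡ not b → a ≡ b
    not-inj {false} {false} _ = refl
    not-inj {true}  {true}  _ = refl

    above-sibling : ∀ {i p p′ r} → Hybridᵛ r → p ⟶ r → p′ ⟶ r → Above i p → Above i p′
    above-sibling h e e′ (r′ , h′ , f , g) with hybrid-child-≡ h h′ e f
    ... | refl = r′ , h , e′ , g

    turn-oriented : ∀ {i o} → Oriented o → Oriented (turn i o)
    turn-oriented {i} {o} or {p} {p′} h e e′ p≢p′ eq with above? i p | above? i p′
    ... | yes _ | yes _  = or h e e′ p≢p′ (not-inj eq)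
    ... | no _  | no _   = or h e e′ p≢p′ eq
    ... | yes a | no ¬a′ = ¬a′ (above-sibling h e e′ a)
    ... | no ¬a | yes a′ = ¬a (above-sibling h e′ e a′)

    turn-≡ : ∀ {i j u r} o → Hybridᵛ r → u ⟶ r → r ⟶ taxon j →
             turn i o u ≡ (if does (i Fin.≟ j) then not (o u) else o u)
    turn-≡ {i} {j} {u} o h e f with above? i u | i Fin.≟ j
    ... | yes _ | yes _    = refl
    ... | no _  | no _     = refl
    ... | no ¬a | yes refl = contradiction (_ , h , e , f) ¬a
    ... | yes (r′ , h′ , e′ , f′) | no i≢j with hybrid-child-≡ h h′ e e′
    ...   | refl = contradiction (taxon-injective (only-child (inj₂ h) f′ f)) i≢j

    rep-toggle : ∀ {i o v c} → Rep o v c → Rep (turn i o) v (relabel (toggle i) c)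
    rep-toggle (tip eq) = tip eq
    rep-toggle {o = o} (via h e f refl e′ h′ p) = via h e f (turn-≡ o h e f) e′ h′ (rep-toggle p)
    rep-toggle (fork e e′ ne h h′ p q) = fork e e′ ne h h′ (rep-toggle p) (rep-toggle q)

  rep-swaps : ∀ {o v c d} → Rep o v c → d ∈ swaps c → Rep o v d
  rep-swaps (tip eq) (here refl) = tip eq
  rep-swaps (via {i = i} {b} h e f eq e′ h′ p) d∈ with ∈-map⁻ (via (i , b)) d∈
  ... | u , q , refl = via h e f eq e′ h′ (rep-swaps p q)
  rep-swaps (fork {l = l} {r} e e′ ne h h′ p q) d∈ with ∈-++⁻ (cartesianProductWith fork (swaps l) (swaps r)) d∈
  ... | inj₁ d∈ₗ with ∈-cartesianProductWith⁻ fork (swaps l) (swaps r) d∈ₗ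
  ...   | l′ , r′ , q₁ , q₂ , refl = fork e e′ ne h h′ (rep-swaps p q₁) (rep-swaps q q₂)
  rep-swaps (fork {l = l} {r} e e′ ne h h′ p q) d∈ | inj₂ d∈ᵣ with ∈-cartesianProductWith⁻ (flip fork) (swaps l) (swaps r) d∈ᵣ
  ...   | l′ , r′ , q₁ , q₂ , refl = fork e′ e (ne ∘ sym) h′ h (rep-swaps q q₂) (rep-swaps p q₁)

  rep-toggles : ∀ is {o v c d} → Oriented o → Rep o v c → d ∈ toggles is c → ∃ λ o′ → Oriented o′ × Rep o′ v d
  rep-toggles []       or p (here refl) = _ , or , p
  rep-toggles (i ∷ is) {c = c} or p d∈ with ∈-++⁻ (toggles is c) d∈
  ... | inj₁ q = rep-toggles is or p q
  ... | inj₂ q = rep-toggles is (turn-oriented or) (rep-toggle {i = i} p) q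

  rep-variants : ∀ {o v c d} → Oriented o → Rep o v c → d ∈ variants c → ∃ λ o′ → Oriented o′ × Rep o′ v d
  rep-variants {c = c} or p d∈ with find (∈-concatMap⁻ (toggles (hybrids c)) {xs = swaps c} d∈)
  ... | d′ , d′∈ , q = rep-toggles (hybrids c) or (rep-swaps p d′∈) q

  -- Both derivations start at the same vertex and therefore meet the same forks with the same
  -- children. The order at each fork is copied from the second code, so that only the numbering of
  -- the parents remains to be corrected.
  swap-to : ∀ {o o′ v c c′} → Rep o v c → Rep o′ v c′ → ∃ λ d → d ∈ swaps c × Rep o v d × erase d ≡ erase c′
  swap-to (tip refl) (tip eq) = _ , here refl , tip refl , cong tip (taxon-injective eq)
  swap-to (tip refl) q@(via _ _ _ _ _ _ _) with () ← trans (sym (taxon-mark _)) (rep-mark q)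
  swap-to (tip refl) q@(fork _ _ _ _ _ _ _) with () ← trans (sym (taxon-mark _)) (rep-mark q)
  swap-to p@(via _ _ _ _ _ _ _) (tip refl) with () ← trans (sym (taxon-mark _)) (rep-mark p)
  swap-to p@(fork _ _ _ _ _ _ _) (tip refl) with () ← trans (sym (taxon-mark _)) (rep-mark p)
  swap-to (via h e f _ _ _ _) q@(fork _ _ _ _ _ _ _) with () ← proj₂ (rep-hybrid q h e f)
  swap-to p@(fork _ _ _ _ _ _ _) (via h e f _ _ _ _) with () ← proj₂ (rep-hybrid p h e f)
  swap-to (via h e f eq e′ k p) (via h₂ e₂ f₂ eq₂ e₂′ k₂ q) with hybrid-child-≡ h h₂ e e₂
  ... | refl with taxon-injective (only-child (inj₂ h) f f₂)
                | children (hybrid-parent h e) e e′ (λ { refl → k h }) e₂′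
  ...   | refl | inj₁ refl = contradiction h k₂
  ...   | refl | inj₂ refl = let d , d∈ , r , er = swap-to p q in
    _ , ∈-map⁺ (via _) d∈ , via h e f eq e′ k r , cong (via _) er
  swap-to {c = fork l r} (fork e e′ ne h h′ p q) (fork e₂ e₂′ ne₂ h₂ h₂′ p₂ q₂)
    with children (branch-mark e e′ ne) e e′ ne e₂ | children (branch-mark e e′ ne) e e′ ne e₂′
  ... | inj₁ refl | inj₁ refl = contradiction refl ne₂
  ... | inj₂ refl | inj₂ refl = contradiction refl ne₂
  ... | inj₁ refl | inj₂ refl = let d , d∈ , rd , ed = swap-to p p₂ ; d′ , d′∈ , rd′ , ed′ = swap-to q q₂ in
    fork d d′ , ∈-++⁺ˡ (∈-cartesianProductWith⁺ fork d∈ d′∈) , fork e e′ ne h h′ rd rd′ , cong₂ fork ed ed′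
  ... | inj₂ refl | inj₁ refl = let d , d∈ , rd , ed = swap-to p q₂ ; d′ , d′∈ , rd′ , ed′ = swap-to q p₂ in
    fork d′ d , ∈-++⁺ʳ (cartesianProductWith fork (swaps l) (swaps r)) (∈-cartesianProductWith⁺ (flip fork) d∈ d′∈) ,
    fork e′ e (ne ∘ sym) h′ h rd′ rd , cong₂ fork ed′ ed

  private
    Agree : Fin n → (o o′ : Vertex → Bool) → Set
    Agree i o o′ = ∀ {u} → Above i u → o u ≡ o′ u

    ≢⇒≡not : ∀ {a b} → a ≢ b → not a ≡ b
    ≢⇒≡not {false} {false} ne = contradiction refl ne
    ≢⇒≡not {false} {true}  _  = refl
    ≢⇒≡not {true}  {false} _  = refl
    ≢⇒≡not {true}  {true}  ne = contradiction refl ne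

    -- Each orientation gives the two parents of a reticulation different bits. So two orientations
    -- agree at both parents or at neither, and in the latter case a single turn corrects both.
    agree-or-turn : ∀ {o o′} → Oriented o → Oriented o′ → ∀ i → Agree i o o′ ⊎ Agree i (turn i o) o′
    agree-or-turn {o} {o′} or or′ i with Fin.any? (λ u → above? i u ×-dec ¬? (o u ≟ᵇ o′ u))
    ... | no none = inj₁ λ {u} a → case o u ≟ᵇ o′ u of λ { (yes eq) → eq ; (no ne) → contradiction (u , a , ne) none }
    ... | yes (u , (r , h , e , f) , ne) = inj₂ turned
      where
      turned : Agree i (turn i o) o′
      turned {w} (r′ , h′ , e′ , f′) with parent-≡ (taxon-¬hybrid i) f f′
      ... | refl with turn-≡ {i} o h e′ f′
      ...   | eq with i Fin.≟ i
      ...     | no i≢i = contradiction refl i≢i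
      ...     | yes _ with w Fin.≟ u
      ...       | yes refl = trans eq (≢⇒≡not ne)
      ...       | no w≢u = trans eq (trans (≢⇒≡not (or h e′ e w≢u))
                     (not-inj (trans (≢⇒≡not ne) (sym (≢⇒≡not (or′ h e′ e w≢u))))))

    agree-turn : ∀ {i j o o′} → i ≢ j → Agree j o o′ → Agree j (turn i o) o′
    agree-turn {i} {j} {o} i≢j ag (r , h , e , f) with i Fin.≟ j | turn-≡ {i} o h e f
    ... | yes eq | _  = contradiction eq i≢j
    ... | no _   | eq = trans eq (ag (r , h , e , f))

    rep-agree : ∀ {o o′ v c c′} → (∀ i → Agree i o o′) → Rep o v c → Rep o′ v c′ → erase c ≡ erase c′ → c ≡ c′
    rep-agree ag (tip _) (tip _) refl = refl
    rep-agree ag (tip _) (via _ _ _ _ _ _ _) ()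
    rep-agree ag (tip _) (fork _ _ _ _ _ _ _) ()
    rep-agree ag (fork _ _ _ _ _ _ _) (tip _) ()
    rep-agree ag (fork _ _ _ _ _ _ _) (via _ _ _ _ _ _ _) ()
    rep-agree ag (via _ _ _ _ _ _ _) (tip _) ()
    rep-agree ag (via _ _ _ _ _ _ _) (fork _ _ _ _ _ _ _) ()
    rep-agree ag (via {i = i} h e f refl e′ k p) (via h₂ e₂ f₂ refl e₂′ k₂ q) eq with via-injective eq
    ... | refl , eq′ with children (hybrid-parent h e) e e′ (λ { refl → k h }) e₂′
    ...   | inj₁ refl = contradiction h k₂
    ...   | inj₂ refl = cong₂ via (cong (i ,_) (ag i (_ , h , e , f))) (rep-agree ag p q eq′)
    rep-agree ag (fork e e′ ne h h′ p q) (fork e₂ e₂′ ne₂ h₂ h₂′ p₂ q₂) eq with fork-injective eq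
    ... | eqₗ , eqᵣ = cong₂ fork (rep-agree ag p (subst (λ w → Rep _ w _) (sym (rep-≡ˢ p p₂ eqₗ)) p₂) eqₗ)
                                 (rep-agree ag q (subst (λ w → Rep _ w _) (sym (rep-≡ˢ q q₂ eqᵣ)) q₂) eqᵣ)
      where
      rep-≡ˢ : ∀ {o o′ u u′ s t} → Rep o u s → Rep o′ u′ t → erase s ≡ erase t → u ≡ u′
      rep-≡ˢ p q eq = rep-≡ (rep-erase p) (subst (Rep _ _) (sym eq) (rep-erase q))
        where
        rep-erase : ∀ {o u s} → Rep o u s → Rep (λ _ → false) u (erase s)
        rep-erase (tip eq) = tip eq
        rep-erase (via h e f _ e′ k p) = via h e f refl e′ k (rep-erase p)
        rep-erase (fork e e′ ne h h′ p q) = fork e e′ ne h h′ (rep-erase p) (rep-erase q)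

    -- Induction on the labels still to be adjusted: outside `is` the orientations agree already.
    toggle-to : ∀ is {o o′ v c c′} → Oriented o → Oriented o′ → (∀ i → i ∈ is ⊎ Agree i o o′) →
                Rep o v c → Rep o′ v c′ → erase c ≡ erase c′ → c′ ∈ toggles is c
    toggle-to [] or or′ ag p q eq = here (sym (rep-agree (λ i → [ (λ ()) , id ]′ (ag i)) p q eq))
    toggle-to (i ∷ is) {o} {o′} {c = c} or or′ ag p q eq with agree-or-turn or or′ i
    ... | inj₁ a = ∈-++⁺ˡ (toggle-to is or or′ ag′ p q eq)
      where
      ag′ : ∀ j → j ∈ is ⊎ Agree j o o′
      ag′ j with ag j
      ... | inj₁ (here refl) = inj₂ a
      ... | inj₁ (there j∈) = inj₁ j∈
      ... | inj₂ b = inj₂ b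
    ... | inj₂ a = ∈-++⁺ʳ (toggles is c) (toggle-to is (turn-oriented or) or′ ag′ (rep-toggle p) q
                     (trans (relabel-∘ (λ _ → refl) c) eq))
      where
      ag′ : ∀ j → j ∈ is ⊎ Agree j (turn i o) o′
      ag′ j with i Fin.≟ j
      ... | yes refl = inj₂ a
      ... | no i≢j with ag j
      ...   | inj₁ (here refl) = contradiction refl i≢j
      ...   | inj₁ (there j∈) = inj₁ j∈
      ...   | inj₂ b = inj₂ (agree-turn i≢j b)

  variants-complete : ∀ {o o′ c c′} → Oriented o → Oriented o′ → Valid c → Rep o (proj₁ top) c → Rep o′ (proj₁ top) c′ → c′ ∈ variants c
  variants-complete {o} {o′} {c} or or′ c! p q = let d , d∈ , r , eq = swap-to p q in
    ∈-concatMap (toggles (hybrids c)) d∈ (toggle-to (hybrids c) or or′ ag r q eq)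
    where
    ag : ∀ i → i ∈ hybrids c ⊎ Agree i o o′
    ag i with hybrid? c i
    ... | yes h = inj₁ (∈-filter-allFin (hybrid? c) h)
    ... | no ¬h = inj₂ λ (r , h , _ , f) → contradiction (ret-hybrid (proj₁ (proj₂ top)) top-¬hybrid p or h f) ¬h

module _ {n} {c : Code n} (c! : Valid c) {N : Network n} (P : Named N c) where
  open Representation N
  open Orientations N

  abstract
    variant⇒named : ∀ {d} → d ∈ variants c → Valid d × Named N d
    variant⇒named d∈ with rep-variants (named-oriented c! P) (named-rep c! P) d∈
    ... | o , or , p = rep-valid (proj₁ (proj₂ top)) top-¬hybrid p or , rep-named (proj₁ (proj₂ top)) top-¬hybrid p or

    named⇒variant : ∀ {d} → Valid d → Named N d → d ∈ variants c
    named⇒variant d! Q = variants-complete (named-oriented c! P) (named-oriented d! Q) c! (named-rep c! P) (named-rep d! Q)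

-- The enumeration of all networks

private
  codesUpTo : ℕ → List (Code n)
  codesUpTo {n} zero    = []
  codesUpTo {n} (suc h) = map tip (allFin n)
    ++ concatMap (λ i → map (via (i , false)) (codesUpTo h) ++ map (via (i , true)) (codesUpTo h)) (allFin n)
    ++ cartesianProductWith fork (codesUpTo h) (codesUpTo h)

  ∈-codesUpTo : ∀ h (c : Code n) → size c ≤ h → c ∈ codesUpTo h
  ∈-codesUpTo (suc h) (tip i) _ = ∈-++⁺ˡ (∈-map⁺ tip (∈-allFin i))
  ∈-codesUpTo {n} (suc h) (via (i , b) t) (s≤s le) = ∈-++⁺ʳ (map tip (allFin n)) (∈-++⁺ˡ (∈-concatMap _ (∈-allFin i) (by b)))
    where
    by : ∀ b → via (i , b) t ∈ map (via (i , false)) (codesUpTo h) ++ map (via (i , true)) (codesUpTo h)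
    by false = ∈-++⁺ˡ (∈-map⁺ _ (∈-codesUpTo h t le))
    by true  = ∈-++⁺ʳ (map (via (i , false)) (codesUpTo h)) (∈-map⁺ _ (∈-codesUpTo h t le))
  ∈-codesUpTo {n} (suc h) (fork l r) (s≤s le) = ∈-++⁺ʳ (map tip (allFin n)) (∈-++⁺ʳ (concatMap _ (allFin n))
    (∈-cartesianProductWith⁺ fork (∈-codesUpTo h l (ℕ.≤-trans (ℕ.m≤m+n _ _) le)) (∈-codesUpTo h r (ℕ.≤-trans (ℕ.m≤n+m _ _) le))))

  -- Tips count twice and labels once. As a binary tree has one fork less than tips, the total is
  -- one more than the size; a valid code has weight 2 at every `i`, so its size is 2 n - 1. This
  -- makes the search for valid codes finite.
  weight : Fin n → Code n → ℕ
  weight i c = (occ (inj₁ i) c + occ (inj₂ (i , false)) c) + (occ (inj₁ i) c + occ (inj₂ (i , true)) c)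

  ∑-weight : ∀ (c : Code n) → ∑ (allFin n) (λ i → weight i c) ≡ suc (size c)
  ∑-weight {n} (tip j) = trans (∑-cong (allFin n) (λ {i} _ → each i))
    (trans (∑-+ (allFin n) (λ i → ⟦ inj₁ i ≟ˣ inj₁ j ⟧) (λ i → ⟦ inj₁ i ≟ˣ inj₁ j ⟧))
           (cong₂ _+_ (∑-occ-tip (tip j)) (∑-occ-tip (tip j))))
    where
    each : ∀ i → weight i (tip j) ≡ ⟦ inj₁ i ≟ˣ inj₁ j ⟧ + ⟦ inj₁ i ≟ˣ inj₁ j ⟧
    each i = cong₂ _+_ (trans (cong (occ (inj₁ i) (tip j) +_) (⟦⟧-no (inj₂ (i , false) ≟ˣ inj₁ j) λ ())) (ℕ.+-identityʳ _))
                       (trans (cong (occ (inj₁ i) (tip j) +_) (⟦⟧-no (inj₂ (i , true) ≟ˣ inj₁ j) λ ())) (ℕ.+-identityʳ _))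
  ∑-weight {n} (via (j , b) t) = trans (∑-cong (allFin n) (λ {i} _ → each b i))
    (trans (∑-+ (allFin n) (λ i → ⟦ i Fin.≟ j ⟧) (λ i → weight i t))
           (cong₂ _+_ (∑-indicator (Fin._≟ j) (allFin! n) (∈-allFin j) refl (λ _ eq → eq)) (∑-weight t)))
    where
    each : ∀ b i → weight i (via (j , b) t) ≡ ⟦ i Fin.≟ j ⟧ + weight i t
    each b i with i Fin.≟ j
    each b     i | no _     = refl
    each false i | yes refl = cong (_+ (occ (inj₁ i) t + occ (inj₂ (i , true)) t)) (ℕ.+-suc (occ (inj₁ i) t) _)
    each true  i | yes refl = trans (cong (occ (inj₁ i) t + occ (inj₂ (i , false)) t +_) (ℕ.+-suc (occ (inj₁ i) t) _)) (ℕ.+-suc _ _)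
  ∑-weight {n} (fork l r) = trans (∑-cong (allFin n) (λ {i} _ → regroup (occ (inj₁ i) l) _ (occ (inj₂ (i , false)) l) _ (occ (inj₂ (i , true)) l) _))
    (trans (∑-+ (allFin n) (λ i → weight i l) (λ i → weight i r))
    (trans (cong₂ _+_ (∑-weight l) (∑-weight r)) (cong suc (ℕ.+-suc (size l) (size r)))))
    where
    regroup : ∀ a b c d e f → ((a + b) + (c + d)) + ((a + b) + (e + f)) ≡ ((a + c) + (a + e)) + ((b + d) + (b + f))
    regroup = solve-∀

  valid-size : ∀ {c : Code n} → Valid c → size c ≤ n * 2
  valid-size {n} {c} (valid v) = ℕ.≤-trans (ℕ.n≤1+n _) (ℕ.≤-reflexive (trans (sym (∑-weight c))
    (trans (∑-cong (allFin n) (λ {i} _ → cong₂ _+_ (v i false) (v i true)))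
    (trans (∑-const (allFin n) 2) (cong (_* 2) (length-allFin n))))))

  valid? : ∀ (c : Code n) → Dec (Valid c)
  valid? c = map′ (λ v → valid λ i → λ { false → proj₁ (v i) ; true → proj₂ (v i) }) (λ v i → once v i false , once v i true)
    (Fin.all? λ i → (occ (inj₁ i) c + occ (inj₂ (i , false)) c ℕ.≟ 1) ×-dec (occ (inj₁ i) c + occ (inj₂ (i , true)) c ℕ.≟ 1))

abstract
  allCodes : ∀ n → List (Code n)
  allCodes n = deduplicate _≟ᶜ_ (filter valid? (codesUpTo (n * 2)))

  allCodes-unique : ∀ n → Unique (allCodes n)
  allCodes-unique n = deduplicate-! _≟ᶜ_ _

  ∈-allCodes⁺ : ∀ {c : Code n} → Valid c → c ∈ allCodes n
  ∈-allCodes⁺ {n} {c} c! = ∈-deduplicate⁺ _≟ᶜ_ (∈-filter⁺ valid? (∈-codesUpTo (n * 2) c (valid-size c!)) c!)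

  ∈-allCodes⁻ : ∀ {c : Code n} → c ∈ allCodes n → Valid c
  ∈-allCodes⁻ {n} c∈ = proj₂ (∈-filter⁻ valid? {xs = codesUpTo (n * 2)} (∈-deduplicate⁻ _≟ᶜ_ _ c∈))

private
  variant? : ∀ (c d : Code n) → Dec (d ∈ variants c)
  variant? c d = any? (d ≟ᶜ_) (variants c)

  -- Two valid codes are variants of each other exactly if they have the same network, so keeping
  -- the first code of each class leaves one code per network.
  representatives : List (Code n) → List (Code n)
  representatives []       = []
  representatives (c ∷ cs) = c ∷ filter (¬? ∘ variant? c) (representatives cs)

  representatives-⊆ : ∀ (cs : List (Code n)) {c} → c ∈ representatives cs → c ∈ cs
  representatives-⊆ (c ∷ cs) (here refl) = here refl
  representatives-⊆ (c ∷ cs) (there p) = there (representatives-⊆ cs (proj₁ (∈-filter⁻ (¬? ∘ variant? c) p)))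

  ≈⇒variant : ∀ {M N : Network n} {c d} → Valid c → Valid d → Named M c → Named N d → M ≈ N → d ∈ variants c
  ≈⇒variant {M = M} {N} {c} {d} c! d! P Q φ = named⇒variant c! P d! record
    { name      = Q.name ∘ to
    ; injective = λ eq → trans (sym (inverseʳ refl)) (trans (cong from (Q.injective eq)) (inverseʳ refl))
    ; member    = λ u → Q.member (to u)
    ; onto      = λ q → let v , eq = Q.onto q in from v , trans (cong Q.name (inverseˡ refl)) eq
    ; edge-to   = λ {u} {v} e → Q.edge-to (subst T (sym (edge-≡ u v)) e)
    ; edge-from = λ {u} {v} e → subst T (edge-≡ u v) (Q.edge-from e)
    ; mark-≡    = mark-≡
    ; taxon-≡   = λ i → trans (cong Q.name (taxon-≡ i)) (Q.taxon-≡ i)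
    }
    where
    module P = Named P
    module Q = Named Q
    module M = Network M
    module N = Network N
    open _≈_ φ
    open Inverse vertices using (from; inverseˡ; inverseʳ)
    count-≡ : ∀ {k l} (f : Fin k ↔ Fin l) (p : Fin k → Bool) (q : Fin l → Bool) → (∀ i → q (Inverse.to f i) ≡ p i) →
              # (T? ∘ p) ≡ # (T? ∘ q)
    count-≡ f p q eq = trans (#-list (T? ∘ p) {map (Inverse.from f) (filter (T? ∘ q) (allFin _))}
        (Unique.map⁺ (λ e → trans (sym (Inverse.strictlyInverseˡ f _)) (trans (cong (Inverse.to f) e) (Inverse.strictlyInverseˡ f _)))
          (filter-allFin! (T? ∘ q)))
        (λ {i} pi → subst (_∈ _) (Inverse.strictlyInverseʳ f i)
          (∈-map⁺ (Inverse.from f) (∈-filter-allFin (T? ∘ q) (subst T (sym (eq i)) pi))))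
        back)
      (trans (length-map (Inverse.from f) (filter (T? ∘ q) (allFin _))) (sym (#-filter (T? ∘ q))))
      where
      back : ∀ {i} → i ∈ map (Inverse.from f) (filter (T? ∘ q) (allFin _)) → T (p i)
      back i∈ with ∈-map⁻ (Inverse.from f) i∈
      ... | j , j∈ , refl = subst T (trans (cong q (sym (Inverse.strictlyInverseˡ f j))) (eq _)) (filter-allFin⁻ (T? ∘ q) j∈)
    degrees-injective : ∀ {m m′} → degrees m ≡ degrees m′ → m ≡ m′
    degrees-injective {root} {root} _ = refl
    degrees-injective {tree} {tree} _ = refl
    degrees-injective {reticulation} {reticulation} _ = refl
    degrees-injective {leaf} {leaf} _ = refl
    mark-≡ : ∀ u → M.mark u ≡ nameMark (Q.name (to u))
    mark-≡ u = trans (degrees-injective (trans (sym (M.degrees-≡ u)) (trans (cong₂ _,_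
      (count-≡ vertices (λ v → M.edge v u) (λ v → N.edge v (to u)) (λ v → edge-≡ v u))
      (count-≡ vertices (M.edge u) (N.edge (to u)) (edge-≡ u))) (N.degrees-≡ (to u))))) (Q.mark-≡ (to u))

  variant-sym : ∀ {c d : Code n} → Valid c → d ∈ variants c → c ∈ variants d
  variant-sym c! d∈ = let d! , Q = variant⇒named c! (toNetwork-named c!) d∈ in named⇒variant d! Q c! (toNetwork-named c!)

  variant-common : ∀ {c d e : Code n} → Valid c → Valid d → e ∈ variants c → e ∈ variants d → d ∈ variants c
  variant-common c! d! p q =
    let e! , P = variant⇒named c! (toNetwork-named c!) p
        _  , Q = variant⇒named e! P (variant-sym d! q)
    in named⇒variant c! (toNetwork-named c!) d! Q

  representatives-cover : ∀ (cs : List (Code n)) → (∀ {c} → c ∈ cs → Valid c) → ∀ {c} → c ∈ cs →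
                          ∃ λ r → r ∈ representatives cs × c ∈ variants r
  representatives-cover (d ∷ cs) v {c} c∈ with variant? d c
  ... | yes p = d , here refl , p
  representatives-cover (d ∷ cs) v (here refl) | no ¬p =
    contradiction (named⇒variant (v (here refl)) (toNetwork-named (v (here refl))) (v (here refl)) (toNetwork-named (v (here refl)))) ¬p
  representatives-cover (d ∷ cs) v (there c∈) | no ¬p with representatives-cover cs (v ∘ there) c∈
  ... | r , r∈ , c∈r = r , there (∈-filter⁺ (¬? ∘ variant? d) r∈ (λ r∈d → ¬p
    (variant-common′ (v (here refl)) (v (there (representatives-⊆ cs r∈))) r∈d c∈r))) , c∈r
    where
    variant-common′ : ∀ {d r c : Code _} → Valid d → Valid r → r ∈ variants d → c ∈ variants r → c ∈ variants d
    variant-common′ d! r! p q = let c! , _ = variant⇒named r! (toNetwork-named r!) q in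
      variant-common d! c! p (variant-sym r! q)

  representatives-distinct : ∀ (cs : List (Code n)) → (∀ {c} → c ∈ cs → Valid c) → ∀ {c d} →
    c ∈ representatives cs → d ∈ representatives cs → d ∈ variants c → c ≡ d
  representatives-distinct (e ∷ cs) v (here refl) (here refl) p = refl
  representatives-distinct (e ∷ cs) v (here refl) (there d∈) p = contradiction p (proj₂ (∈-filter⁻ (¬? ∘ variant? e) {xs = representatives cs} d∈))
  representatives-distinct (e ∷ cs) v (there c∈) (here refl) p = let c∈′ , ¬q = ∈-filter⁻ (¬? ∘ variant? e) {xs = representatives cs} c∈ in
    contradiction (variant-sym (v (there (representatives-⊆ cs c∈′))) p) ¬q
  representatives-distinct (e ∷ cs) v (there c∈) (there d∈) p = representatives-distinct cs (v ∘ there)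
    (proj₁ (∈-filter⁻ (¬? ∘ variant? e) c∈)) (proj₁ (∈-filter⁻ (¬? ∘ variant? e) d∈)) p

  representatives-unique : ∀ {cs : List (Code n)} → Unique cs → Unique (representatives cs)
  representatives-unique {cs = []}     _          = []
  representatives-unique {cs = c ∷ cs} (c∉ ∷ cs!) =
    All.tabulate (λ p → All.lookup c∉ (representatives-⊆ cs (proj₁ (∈-filter⁻ (¬? ∘ variant? c) p))))
    ∷ Unique.filter⁺ (¬? ∘ variant? c) (representatives-unique cs!)

  module _ (n : ℕ) where
    reps : List (Code n)
    reps = representatives (allCodes n)

    reps-unique : Unique reps
    reps-unique = representatives-unique (allCodes-unique n)

    rep : Fin (length reps) → Code n
    rep = List.lookup reps

    rep! : ∀ k → Valid (rep k)
    rep! k = ∈-allCodes⁻ (representatives-⊆ (allCodes n) (∈-lookup k))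

    rep-≡ᵛ : ∀ {j k} → rep k ∈ variants (rep j) → j ≡ k
    rep-≡ᵛ {j} {k} p = lookup-injective reps-unique
      (representatives-distinct (allCodes n) ∈-allCodes⁻ (∈-lookup j) (∈-lookup k) p)

    cover : ∀ {c} → Valid c → ∃ λ k → c ∈ variants (rep k)
    cover c! = let r , r∈ , p = representatives-cover (allCodes n) ∈-allCodes⁻ (∈-allCodes⁺ c!) in
      Any.index r∈ , subst (λ r → _ ∈ variants r) (lookup-index r∈) p

enumeration : ∀ n → Enumeration n
enumeration n = record
  { total   = length (reps n)
  ; classes = record
    { to        = λ k → toNetwork (rep! n k)
    ; cong      = λ { refl → named-≈ (toNetwork-named (rep! n _)) (toNetwork-named (rep! n _)) }
    ; bijective = (λ {j} {k} φ → rep-≡ᵛ n (≈⇒variant (rep! n j) (rep! n k) (toNetwork-named (rep! n j)) (toNetwork-named (rep! n k)) φ))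
                , surjective
    }
  }
  where
  surjective : ∀ N → ∃ λ k → ∀ {j} → j ≡ k → toNetwork (rep! n j) ≈ N
  surjective N with Representation.encode N
  ... | c , c! , P with cover n c!
  ... | k , p = k , λ { refl → named-≈ (proj₂ (variant⇒named (rep! n k) (toNetwork-named (rep! n k)) p)) P }

-- Every isomorphism class has the same number of codes.
transfer : ∀ n d {A : Network n → Set} (A? : Decidable A) {B : Code n → Set} (B? : Decidable B) →
  (∀ {N c} → Valid c → Named N c → A N → B c) →
  d * length (filter B? (allCodes n)) ≤ length (allCodes n) →
  d * # (A? ∘ Enumeration.network (enumeration n)) ≤ Enumeration.total (enumeration n)
transfer n d {A} A? {B} B? A⇒B le = ℕ.*-cancelˡ-≤ (2 ^ (n ∸ 1)) {{ℕ.m^n≢0 2 (n ∸ 1)}} (begin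
  K * (d * # (A? ∘ net))                       ≡⟨ swap K d _ ⟩
  d * (K * # (A? ∘ net))                       ≤⟨ ℕ.*-monoʳ-≤ d events ⟩
  d * length (filter B? (allCodes n))          ≤⟨ le ⟩
  length (allCodes n)                          ≤⟨ ⊆⇒length≤ (allCodes-unique n) covered ⟩
  length (concatMap (variants ∘ rep n) (allFin _)) ≡⟨ length-concatMap (variants ∘ rep n) (allFin _) ⟩
  ∑ (allFin (length (reps n))) (length ∘ variants ∘ rep n) ≡⟨ ∑-cong (allFin _) (λ {k} _ → length-variants (rep! n k)) ⟩
  ∑ (allFin (length (reps n))) (λ _ → K)       ≡⟨ ∑-const (allFin (length (reps n))) K ⟩
  length (allFin (length (reps n))) * K        ≡⟨ cong (_* K) (length-allFin (length (reps n))) ⟩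
  length (reps n) * K                          ≡⟨ ℕ.*-comm _ K ⟩
  K * length (reps n)                          ∎)
  where
  open ℕ.≤-Reasoning
  K = 2 ^ (n ∸ 1)
  net = Enumeration.network (enumeration n)
  swap : ∀ a b c → a * (b * c) ≡ b * (a * c)
  swap = solve-∀
  covered : ∀ {c} → c ∈ allCodes n → c ∈ concatMap (variants ∘ rep n) (allFin _)
  covered c∈ = let k , p = cover n (∈-allCodes⁻ c∈) in ∈-concatMap (variants ∘ rep n) (∈-allFin k) p
  ks = filter (A? ∘ net) (allFin (length (reps n)))
  events : K * # (A? ∘ net) ≤ length (filter B? (allCodes n))
  events = begin
    K * # (A? ∘ net)                  ≡⟨ cong (K *_) (#-filter (A? ∘ net)) ⟩
    K * length ks                     ≡⟨ ℕ.*-comm K _ ⟩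
    length ks * K                     ≡⟨ sym (∑-const ks K) ⟩
    ∑ ks (λ _ → K)                    ≡⟨ ∑-cong ks (λ {k} _ → sym (length-variants (rep! n k))) ⟩
    -- All codes of a network in the event `A` satisfy `B`, and different networks have no code in
    -- common.
    ∑ ks (length ∘ variants ∘ rep n)  ≤⟨ double-count (λ _ d → d) (filter-allFin! (A? ∘ net)) (λ {k} _ → variants-unique (rep! n k))
                                           (λ {k} k∈ d∈ → let d! , P = variant⇒named (rep! n k) (toNetwork-named (rep! n k)) d∈ in
                                             ∈-filter⁺ B? (∈-allCodes⁺ d!) (A⇒B d! P (filter-allFin⁻ (A? ∘ net) k∈)))
                                           (λ {j} {d} {k} _ p _ q eq → rep-≡ᵛ n (variant-common (rep! n j) (rep! n k) p (subst (_∈ _) (sym eq) q)) , eq) ⟩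
    length (filter B? (allCodes n))   ∎

-- Few tips: replacing a fork above the tip i by a reticulation

graft : Fin n → Code n → Code n → Code n
graft i (tip j)    s = if does (i Fin.≟ j) then via (i , false) s else tip j
graft i (via a t)  s = via a (graft i t s)
graft i (fork l r) s = fork (graft i l s) (graft i r s)

-- In a valid code `occ` is 0 or 1 and merely tests on which side of the fork the tip `i` lies. The
-- bit records this side, without which `undo` could not restore the order of the branches.
cuts : Fin n → Code n → List (Bool × Code n)
cuts i (tip j)    = []
cuts i (via a t)  = map (λ (b , u) → b , via a u) (cuts i t)
cuts i (fork l r) =
  (replicate (occ (inj₁ i) l) (false , via (i , true) (graft i l r))
   ++ replicate (occ (inj₁ i) r) (true , via (i , true) (graft i r l)))
  ++ (map (λ (b , u) → b , fork u r) (cuts i l) ++ map (λ (b , u) → b , fork l u) (cuts i r))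

-- The two parts of a grafted tree: what hangs below `(i , false)` is the former sibling branch, and
-- the tip `i` is put back in its place.
prune below : Fin n → Code n → Code n
prune i (tip j)    = tip j
prune i (via a t)  = if does (a ≟ˡ (i , false)) then tip i else via a (prune i t)
prune i (fork l r) = fork (prune i l) (prune i r)
below i (tip j)    = tip j
below i (via a t)  = if does (a ≟ˡ (i , false)) then t else below i t
below i (fork l r) = if does (1 ℕ.≤? occ (inj₂ (i , false)) l) then below i l else below i r

undo : Fin n → Bool → Code n → Code n
undo i b (tip j)    = tip j
undo i b (via a t)  = if does (a ≟ˡ (i , true))
  then (if b then fork (below i t) (prune i t) else fork (prune i t) (below i t))
  else via a (undo i b t)
undo i b (fork l r) = fork (undo i b l) (undo i b r)

depthSum : Code n → ℕ
depthSum (tip i)    = 0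
depthSum (via a t)  = depthSum t
depthSum (fork l r) = (tipCount l + tipCount r) + (depthSum l + depthSum r)

-- The depths of the leaves of a binary tree with m leaves add up to at least m log₂ m.
tips≤depths : ∀ k (c : Code n) → k * tipCount c ≤ depthSum c + 2 ^ k
tips≤depths zero    c          = z≤n
tips≤depths (suc k) (tip i)    = ℕ.≤-trans (ℕ.≤-reflexive (ℕ.*-identityʳ (suc k))) (exponential k)
  where
  exponential : ∀ k → suc k ≤ 2 ^ suc k
  exponential zero    = s≤s z≤n
  exponential (suc k) = ℕ.≤-trans (ℕ.+-mono-≤ (ℕ.m^n>0 2 (suc k)) (exponential k)) (ℕ.+-monoʳ-≤ (2 ^ suc k) (ℕ.≤-reflexive (sym (ℕ.+-identityʳ _))))
tips≤depths (suc k) (via a t)  = tips≤depths (suc k) t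
tips≤depths (suc k) (fork l r) = ℕ.≤-trans
  (ℕ.+-monoʳ-≤ (tipCount l + tipCount r) (ℕ.≤-trans (ℕ.≤-reflexive (ℕ.*-distribˡ-+ k (tipCount l) (tipCount r)))
    (ℕ.+-mono-≤ (tips≤depths k l) (tips≤depths k r))))
  (ℕ.≤-reflexive (regroup (tipCount l + tipCount r) (depthSum l) (depthSum r) (2 ^ k)))
  where
  regroup : ∀ m a b p → m + ((a + p) + (b + p)) ≡ (m + (a + b)) + (p + (p + 0))
  regroup = solve-∀

-- Both sides count the pairs of a tip and a fork above it; on the right each fork contributes the
-- number of tips below it. Depth is thus measured in forks, and labels on the way do not count.
∑-cuts : ∀ (c : Code n) → ∑ (allFin n) (λ i → length (cuts i c)) ≡ depthSum c
∑-cuts {n} (tip i)    = ∑-zero (allFin n)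
∑-cuts {n} (via a t)  = trans (∑-cong (allFin n) (λ {i} _ → length-map _ (cuts i t))) (∑-cuts t)
∑-cuts {n} (fork l r) = trans (∑-cong (allFin n) (λ {i} _ → each i))
  (trans (∑-+ (allFin n) (λ i → occ (inj₁ i) l + occ (inj₁ i) r) _)
    (cong₂ _+_ (trans (∑-+ (allFin n) (λ i → occ (inj₁ i) l) _) (cong₂ _+_ (∑-occ-tip l) (∑-occ-tip r)))
               (trans (∑-+ (allFin n) (λ i → length (cuts i l)) _) (cong₂ _+_ (∑-cuts l) (∑-cuts r)))))
  where
  each : ∀ i → length (cuts i (fork l r)) ≡ (occ (inj₁ i) l + occ (inj₁ i) r) + (length (cuts i l) + length (cuts i r))
  each i = trans (length-++ (replicate (occ (inj₁ i) l) _ ++ replicate (occ (inj₁ i) r) _))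
    (cong₂ _+_ (trans (length-++ (replicate (occ (inj₁ i) l) _)) (cong₂ _+_ (length-replicate (occ (inj₁ i) l)) (length-replicate (occ (inj₁ i) r))))
               (trans (length-++ (map _ (cuts i l))) (cong₂ _+_ (length-map _ (cuts i l)) (length-map _ (cuts i r)))))

does-yes : ∀ {P : Set} (P? : Dec P) → P → does P? ≡ true
does-yes (yes _) _ = refl
does-yes (no ¬p) p = contradiction p ¬p

does-no : ∀ {P : Set} (P? : Dec P) → ¬ P → does P? ≡ false
does-no (yes p) ¬p = contradiction p ¬p
does-no (no _)  _  = refl

private
  +≡0ʳ : ∀ a {b} → a + b ≡ 0 → b ≡ 0
  +≡0ʳ zero eq = eq

  via-absent : ∀ {x a} {t : Code n} → occ (inj₂ x) (via a t) ≡ 0 → does (a ≟ˡ x) ≡ false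
  via-absent {x = x} {a} {t} eq with a ≟ˡ x
  ... | no _ = refl
  ... | yes refl with () ← trans (sym (occ-via a t)) eq

  graft-absent : ∀ i (t s : Code n) → occ (inj₁ i) t ≡ 0 → graft i t s ≡ t
  graft-absent i (tip j) s eq with i Fin.≟ j
  ... | no _ = refl
  graft-absent i (via a t) s eq = cong (via a) (graft-absent i t s (+≡0ʳ _ eq))
  graft-absent i (fork l r) s eq = cong₂ fork (graft-absent i l s (ℕ.m+n≡0⇒m≡0 _ eq)) (graft-absent i r s (+≡0ʳ (occ (inj₁ i) l) eq))

  prune-graft : ∀ i (t s : Code n) → occ (inj₂ (i , false)) t ≡ 0 → prune i (graft i t s) ≡ t
  prune-graft i (tip j) s eq with i Fin.≟ j
  ... | no _ = refl
  ... | yes refl with (i , false) ≟ˡ (i , false)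
  ...   | yes _ = refl
  ...   | no ne = contradiction refl ne
  prune-graft i (via a t) s eq rewrite via-absent {x = i , false} {a} {t} eq = cong (via a) (prune-graft i t s (+≡0ʳ _ eq))
  prune-graft i (fork l r) s eq = cong₂ fork (prune-graft i l s (ℕ.m+n≡0⇒m≡0 _ eq)) (prune-graft i r s (+≡0ʳ (occ (inj₂ (i , false)) l) eq))

  graft-via : ∀ i (t s : Code n) → 1 ≤ occ (inj₁ i) t → ∃ λ u → via (i , false) u ⊑ graft i t s
  graft-via i t s le = go t (occ⇒tip⊑ t le)
    where
    go : ∀ t → tip i ⊑ t → ∃ λ u → via (i , false) u ⊑ graft i t s
    go (tip j) here with i Fin.≟ i
    ... | yes _ = s , here
    ... | no ne = contradiction refl ne
    go (via a t) (via p) = let u , q = go t p in u , via q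
    go (fork l r) (left p) = let u , q = go l p in u , left q
    go (fork l r) (right p) = let u , q = go r p in u , right q

  below-graft : ∀ i (t s : Code n) → 1 ≤ occ (inj₁ i) t → occ (inj₂ (i , false)) t ≡ 0 → below i (graft i t s) ≡ s
  below-graft i (tip j) s le eq with i Fin.≟ j
  ... | yes refl with (i , false) ≟ˡ (i , false)
  ...   | yes _ = refl
  ...   | no ne = contradiction refl ne
  below-graft i (via a t) s le eq rewrite via-absent {x = i , false} {a} {t} eq = below-graft i t s le (+≡0ʳ _ eq)
  below-graft i (fork l r) s le eq with 1 ℕ.≤? occ (inj₁ i) l
  ... | yes le′ rewrite does-yes (1 ℕ.≤? occ (inj₂ (i , false)) (graft i l s)) (via⊑⇒occ (proj₂ (graft-via i l s le′))) =
    below-graft i l s le′ (ℕ.m+n≡0⇒m≡0 _ eq)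
  ... | no ¬le rewrite graft-absent i l s (ℕ.n≤0⇒n≡0 (ℕ.≤-pred (ℕ.≰⇒> ¬le))) | ℕ.m+n≡0⇒m≡0 (occ (inj₂ (i , false)) l) eq =
    below-graft i r s (subst (λ k → 1 ≤ k + _) (ℕ.n≤0⇒n≡0 (ℕ.≤-pred (ℕ.≰⇒> ¬le))) le) (+≡0ʳ (occ (inj₂ (i , false)) l) eq)

  undo-absent : ∀ i b (t : Code n) → occ (inj₂ (i , true)) t ≡ 0 → undo i b t ≡ t
  undo-absent i b (tip j) eq = refl
  undo-absent i b (via a t) eq rewrite via-absent {x = i , true} {a} {t} eq = cong (via a) (undo-absent i b t (+≡0ʳ _ eq))
  undo-absent i b (fork l r) eq = cong₂ fork (undo-absent i b l (ℕ.m+n≡0⇒m≡0 _ eq)) (undo-absent i b r (+≡0ʳ (occ (inj₂ (i , true)) l) eq))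

  ∈-replicate : ∀ k {x y : A} → y ∈ replicate k x → y ≡ x × 1 ≤ k
  ∈-replicate (suc k) (here refl) = refl , s≤s z≤n
  ∈-replicate (suc k) (there p) = proj₁ (∈-replicate k p) , s≤s z≤n

  data Cut (i : Fin n) : Code n → Bool × Code n → Set where
    in-via   : ∀ {a t b u} → Cut i t (b , u) → (b , u) ∈ cuts i t → Cut i (via a t) (b , via a u)
    at-left  : ∀ {l r} → 1 ≤ occ (inj₁ i) l → Cut i (fork l r) (false , via (i , true) (graft i l r))
    at-right : ∀ {l r} → 1 ≤ occ (inj₁ i) r → Cut i (fork l r) (true , via (i , true) (graft i r l))
    in-left  : ∀ {l r b u} → Cut i l (b , u) → Cut i (fork l r) (b , fork u r)
    in-right : ∀ {l r b u} → Cut i r (b , u) → Cut i (fork l r) (b , fork l u)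

  ∈-cuts : ∀ i (c : Code n) {x} → x ∈ cuts i c → Cut i c x
  ∈-cuts i (via a t) p with ∈-map⁻ _ p
  ... | (b , u) , q , refl = in-via (∈-cuts i t q) q
  ∈-cuts i (fork l r) p with ∈-++⁻ (replicate (occ (inj₁ i) l) _ ++ replicate (occ (inj₁ i) r) _) p
  ... | inj₁ q with ∈-++⁻ (replicate (occ (inj₁ i) l) _) q
  ...   | inj₁ q′ with ∈-replicate (occ (inj₁ i) l) q′
  ...     | refl , le = at-left le
  ∈-cuts i (fork l r) p | inj₁ q | inj₂ q′ with ∈-replicate (occ (inj₁ i) r) q′
  ...     | refl , le = at-right le
  ∈-cuts i (fork l r) p | inj₂ q with ∈-++⁻ (map (λ (b , u) → b , fork u r) (cuts i l)) q
  ...   | inj₁ q′ with ∈-map⁻ _ q′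
  ...     | (b , u) , q″ , refl = in-left (∈-cuts i l q″)
  ∈-cuts i (fork l r) p | inj₂ q | inj₂ q′ with ∈-map⁻ _ q′
  ...     | (b , u) , q″ , refl = in-right (∈-cuts i r q″)

  cut⇒occ : ∀ {i} {c : Code n} {x} → Cut i c x → 1 ≤ occ (inj₁ i) c
  cut⇒occ (in-via p _)  = ℕ.≤-trans (cut⇒occ p) (ℕ.m≤n+m _ _)
  cut⇒occ (at-left le)  = ℕ.≤-trans le (ℕ.m≤m+n _ _)
  cut⇒occ (at-right le) = ℕ.≤-trans le (ℕ.m≤n+m _ _)
  cut⇒occ (in-left p)   = ℕ.≤-trans (cut⇒occ p) (ℕ.m≤m+n _ _)
  cut⇒occ (in-right p)  = ℕ.≤-trans (cut⇒occ p) (ℕ.m≤n+m _ _)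

  -- The labels of `i` are absent from `c`, so `undo` meets only the two that the cut has created.
  undo-cut : ∀ {i} {c : Code n} {b u} → Cut i c (b , u) → occ (inj₂ (i , false)) c ≡ 0 → occ (inj₂ (i , true)) c ≡ 0 → undo i b u ≡ c
  undo-cut {i = i} (in-via {a} {t} p _) e₀ e₁ rewrite via-absent {x = i , true} {a} {t} e₁ =
    cong (via a) (undo-cut p (+≡0ʳ _ e₀) (+≡0ʳ _ e₁))
  undo-cut {i = i} (at-left {l} {r} le) e₀ e₁ rewrite does-yes ((i , true) ≟ˡ (i , true)) refl =
    cong₂ fork (prune-graft i l r (ℕ.m+n≡0⇒m≡0 _ e₀)) (below-graft i l r le (ℕ.m+n≡0⇒m≡0 _ e₀))
  undo-cut {i = i} (at-right {l} {r} le) e₀ e₁ rewrite does-yes ((i , true) ≟ˡ (i , true)) refl =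
    cong₂ fork (below-graft i r l le (+≡0ʳ (occ (inj₂ (i , false)) l) e₀)) (prune-graft i r l (+≡0ʳ (occ (inj₂ (i , false)) l) e₀))
  undo-cut {i = i} (in-left {l} {r} {b} p) e₀ e₁ =
    cong₂ fork (undo-cut p (ℕ.m+n≡0⇒m≡0 _ e₀) (ℕ.m+n≡0⇒m≡0 _ e₁)) (undo-absent i b r (+≡0ʳ (occ (inj₂ (i , true)) l) e₁))
  undo-cut {i = i} (in-right {l} {r} {b} p) e₀ e₁ =
    cong₂ fork (undo-absent i b l (ℕ.m+n≡0⇒m≡0 _ e₁)) (undo-cut p (+≡0ʳ (occ (inj₂ (i , false)) l) e₀) (+≡0ʳ (occ (inj₂ (i , true)) l) e₁))

  split≡1 : ∀ {a b} → 1 ≤ a → a + b ≤ 1 → a ≡ 1 × b ≡ 0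
  split≡1 {suc zero} {zero} _ _ = refl , refl
  split≡1 {suc zero} {suc b} _ (s≤s ())
  split≡1 {suc (suc a)} _ (s≤s ())

  -- The balance of the surgery, written without subtraction: the tip `i` is lost, while the label
  -- `(i , false)` and all letters of `s` are gained.
  occ-graft : ∀ i (t s : Code n) → occ (inj₁ i) t ≡ 1 → ∀ x →
              occ x (graft i t s) + ⟦ x ≟ˣ inj₁ i ⟧ ≡ (occ x t + ⟦ x ≟ˣ inj₂ (i , false) ⟧) + occ x s
  occ-graft i (tip j) s eq x with i Fin.≟ j
  ... | yes refl = rotate (⟦ x ≟ˣ inj₂ (i , false) ⟧) (occ x s) ⟦ x ≟ˣ inj₁ i ⟧
    where
    rotate : ∀ a b c → (a + b) + c ≡ (c + a) + b
    rotate = solve-∀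
  occ-graft i (via a t) s eq x = trans (ℕ.+-assoc ⟦ x ≟ˣ inj₂ a ⟧ _ _)
    (trans (cong (⟦ x ≟ˣ inj₂ a ⟧ +_) (occ-graft i t s eq′ x)) (reassoc ⟦ x ≟ˣ inj₂ a ⟧ (occ x t) _ _))
    where
    eq′ : occ (inj₁ i) t ≡ 1
    eq′ = trans (cong (_+ occ (inj₁ i) t) (sym (⟦⟧-no (inj₁ i ≟ˣ inj₂ a) λ ()))) eq
    reassoc : ∀ a b c d → a + ((b + c) + d) ≡ ((a + b) + c) + d
    reassoc = solve-∀
  occ-graft i (fork l r) s eq x with 1 ℕ.≤? occ (inj₁ i) l
  ... | yes le with split≡1 le (ℕ.≤-reflexive eq)
  ...   | eqₗ , eqᵣ rewrite graft-absent i r s eqᵣ =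
    trans (rotate (occ x (graft i l s)) (occ x r) _) (trans (cong (_+ occ x r) (occ-graft i l s eqₗ x)) (reassoc (occ x l) _ (occ x s) (occ x r)))
    where
    rotate : ∀ a b c → (a + b) + c ≡ (a + c) + b
    rotate = solve-∀
    reassoc : ∀ a b c d → ((a + b) + c) + d ≡ ((a + d) + b) + c
    reassoc = solve-∀
  occ-graft i (fork l r) s eq x | no ¬le with ℕ.n≤0⇒n≡0 (ℕ.≤-pred (ℕ.≰⇒> ¬le))
  ...   | eqₗ rewrite graft-absent i l s eqₗ =
    trans (ℕ.+-assoc (occ x l) _ _) (trans (cong (occ x l +_) (occ-graft i r s (trans (cong (_+ occ (inj₁ i) r) (sym eqₗ)) eq) x))
      (reassoc (occ x l) (occ x r) _ _))
    where
    reassoc : ∀ a b c d → a + ((b + c) + d) ≡ ((a + b) + c) + d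
    reassoc = solve-∀

  occ-cut : ∀ {i} {c : Code n} {b u} → Cut i c (b , u) → occ (inj₁ i) c ≤ 1 → ∀ x →
            occ x u + ⟦ x ≟ˣ inj₁ i ⟧ ≡ occ x c + (⟦ x ≟ˣ inj₂ (i , false) ⟧ + ⟦ x ≟ˣ inj₂ (i , true) ⟧)
  occ-cut {i = i} (in-via {a} {t} {b} {u} p _) le x = trans (ℕ.+-assoc ⟦ x ≟ˣ inj₂ a ⟧ _ _)
    (trans (cong (⟦ x ≟ˣ inj₂ a ⟧ +_) (occ-cut p (ℕ.≤-trans (ℕ.m≤n+m _ _) le) x)) (sym (ℕ.+-assoc ⟦ x ≟ˣ inj₂ a ⟧ _ _)))
  occ-cut {i = i} (at-left {l} {r} le′) le x =
    trans (ℕ.+-assoc ⟦ x ≟ˣ inj₂ (i , true) ⟧ _ _)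
      (trans (cong (⟦ x ≟ˣ inj₂ (i , true) ⟧ +_) (occ-graft i l r (proj₁ (split≡1 le′ le)) x))
        (regroup ⟦ x ≟ˣ inj₂ (i , true) ⟧ (occ x l) ⟦ x ≟ˣ inj₂ (i , false) ⟧ (occ x r)))
    where
    regroup : ∀ p a q b → p + ((a + q) + b) ≡ (a + b) + (q + p)
    regroup = solve-∀
  occ-cut {i = i} (at-right {l} {r} le′) le x =
    trans (ℕ.+-assoc ⟦ x ≟ˣ inj₂ (i , true) ⟧ _ _)
      (trans (cong (⟦ x ≟ˣ inj₂ (i , true) ⟧ +_) (occ-graft i r l (proj₁ (split≡1 le′ (ℕ.≤-trans (ℕ.≤-reflexive (ℕ.+-comm (occ (inj₁ i) r) _)) le))) x))
        (regroup ⟦ x ≟ˣ inj₂ (i , true) ⟧ (occ x r) ⟦ x ≟ˣ inj₂ (i , false) ⟧ (occ x l)))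
    where
    regroup : ∀ p a q b → p + ((a + q) + b) ≡ (b + a) + (q + p)
    regroup = solve-∀
  occ-cut {i = i} (in-left {l} {r} {b} {u} p) le x =
    trans (rotate (occ x u) (occ x r) _) (trans (cong (_+ occ x r) (occ-cut p (ℕ.≤-trans (ℕ.m≤m+n _ _) le) x)) (rotate (occ x l) _ (occ x r)))
    where
    rotate : ∀ a b c → (a + b) + c ≡ (a + c) + b
    rotate = solve-∀
  occ-cut {i = i} (in-right {l} {r} {b} {u} p) le x =
    trans (ℕ.+-assoc (occ x l) _ _) (trans (cong (occ x l +_) (occ-cut p (ℕ.≤-trans (ℕ.m≤n+m _ (occ (inj₁ i) l)) le) x)) (sym (ℕ.+-assoc (occ x l) _ _)))

  cut-valid : ∀ {i} {c : Code n} {b u} → Valid c → Cut i c (b , u) → Valid u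
  cut-valid {i = i} {c} {b} {u} c! p = valid go
    where
    le : occ (inj₁ i) c ≤ 1
    le = at-most-once (valid⇒linear c!) (inj₁ i)
    ¬h : ∀ b′ → occ (inj₁ i) c ≡ 1 × occ (inj₂ (i , b′)) c ≡ 0
    ¬h b′ = split≡1 (cut⇒occ p) (ℕ.≤-reflexive (once c! i b′))
    go : ∀ j b′ → occ (inj₁ j) u + occ (inj₂ (j , b′)) u ≡ 1
    go j b′ with occ-cut p le (inj₁ j) | occ-cut p le (inj₂ (j , b′)) | i Fin.≟ j
    ... | e₁ | e₂ | no i≢j = trans (cong₂ _+_ tips vias) (once c! j b′)
      where
      tips : occ (inj₁ j) u ≡ occ (inj₁ j) c
      tips = trans (sym (ℕ.+-identityʳ _)) (trans (cong (occ (inj₁ j) u +_) (sym (⟦⟧-no (inj₁ j ≟ˣ inj₁ i) λ { refl → i≢j refl })))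
        (trans e₁ (trans (cong (occ (inj₁ j) c +_) (cong₂ _+_ (⟦⟧-no (inj₁ j ≟ˣ inj₂ (i , false)) λ ()) (⟦⟧-no (inj₁ j ≟ˣ inj₂ (i , true)) λ ()))) (ℕ.+-identityʳ _))))
      vias : occ (inj₂ (j , b′)) u ≡ occ (inj₂ (j , b′)) c
      vias = trans (sym (ℕ.+-identityʳ _)) (trans (cong (occ (inj₂ (j , b′)) u +_) (sym (⟦⟧-no (inj₂ (j , b′) ≟ˣ inj₁ i) λ ())))
        (trans e₂ (trans (cong (occ (inj₂ (j , b′)) c +_) (cong₂ _+_ (⟦⟧-no (inj₂ (j , b′) ≟ˣ inj₂ (i , false)) λ { refl → i≢j refl })
                                                                   (⟦⟧-no (inj₂ (j , b′) ≟ˣ inj₂ (i , true)) λ { refl → i≢j refl }))) (ℕ.+-identityʳ _))))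
    ... | e₁ | e₂ | yes refl = cong₂ _+_ tips vias
      where
      tips : occ (inj₁ i) u ≡ 0
      tips = ℕ.+-cancelʳ-≡ 1 _ _ (trans (cong (occ (inj₁ i) u +_) (sym (⟦⟧-yes (inj₁ i ≟ˣ inj₁ i) refl)))
        (trans e₁ (trans (cong₂ _+_ (proj₁ (¬h b′)) (cong₂ _+_ (⟦⟧-no (inj₁ i ≟ˣ inj₂ (i , false)) λ ()) (⟦⟧-no (inj₁ i ≟ˣ inj₂ (i , true)) λ ()))) refl)))
      one : ∀ b′ → ⟦ inj₂ (i , b′) ≟ˣ inj₂ (i , false) ⟧ + ⟦ inj₂ (i , b′) ≟ˣ inj₂ (i , true) ⟧ ≡ 1
      one false = cong₂ _+_ (⟦⟧-yes (inj₂ (i , false) ≟ˣ inj₂ (i , false)) refl) (⟦⟧-no (inj₂ (i , false) ≟ˣ inj₂ (i , true)) λ ())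
      one true  = cong₂ _+_ (⟦⟧-no (inj₂ (i , true) ≟ˣ inj₂ (i , false)) λ ()) (⟦⟧-yes (inj₂ (i , true) ≟ˣ inj₂ (i , true)) refl)
      vias : occ (inj₂ (i , b′)) u ≡ 1
      vias = trans (sym (ℕ.+-identityʳ _)) (trans (cong (occ (inj₂ (i , b′)) u +_) (sym (⟦⟧-no (inj₂ (i , b′) ≟ˣ inj₁ i) λ ())))
        (trans e₂ (cong₂ _+_ (proj₂ (¬h b′)) (one b′))))

  replicate-unique : ∀ {k} {x : A} → k ≤ 1 → Unique (replicate k x)
  replicate-unique {k = zero} _ = []
  replicate-unique {k = suc zero} _ = [] ∷ []
  replicate-unique {k = suc (suc k)} (s≤s ())

  cuts-unique : ∀ i (c : Code n) → occ (inj₁ i) c ≤ 1 → Unique (cuts i c)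
  cuts-unique i (tip j) le = []
  cuts-unique i (via a t) le = Unique.map⁺ (λ { refl → refl }) (cuts-unique i t (ℕ.≤-trans (ℕ.m≤n+m _ _) le))
  cuts-unique i (fork l r) le = Unique.++⁺
    (Unique.++⁺ (replicate-unique leₗ) (replicate-unique leᵣ) λ (p , q) →
      both (proj₂ (∈-replicate (occ (inj₁ i) l) p)) (proj₂ (∈-replicate (occ (inj₁ i) r) q)))
    (Unique.++⁺ (Unique.map⁺ (λ { refl → refl }) (cuts-unique i l leₗ)) (Unique.map⁺ (λ { refl → refl }) (cuts-unique i r leᵣ)) λ (p , q) →
      let _ , p′ , _ = ∈-map⁻ _ p ; _ , q′ , _ = ∈-map⁻ _ q in both (cut⇒occ (∈-cuts i l p′)) (cut⇒occ (∈-cuts i r q′)))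
    λ (p , q) → heads (∈-++⁻ (replicate (occ (inj₁ i) l) _) p) (∈-++⁻ (map _ (cuts i l)) q)
    where
    leₗ : occ (inj₁ i) l ≤ 1
    leₗ = ℕ.≤-trans (ℕ.m≤m+n _ _) le
    leᵣ : occ (inj₁ i) r ≤ 1
    leᵣ = ℕ.≤-trans (ℕ.m≤n+m _ (occ (inj₁ i) l)) le
    both : 1 ≤ occ (inj₁ i) l → 1 ≤ occ (inj₁ i) r → ⊥
    both p q = ℕ.<-irrefl refl (ℕ.≤-trans (ℕ.+-mono-≤ p q) le)
    Fork Via : Bool × Code _ → Set
    Fork (_ , fork _ _) = ⊤
    Fork _              = ⊥
    Via (_ , via _ _) = ⊤
    Via _             = ⊥
    distinct : ∀ z → Via z → Fork z → ⊥
    distinct (_ , via _ _) _ ()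
    new : ∀ {z} → z ∈ replicate (occ (inj₁ i) l) (false , via (i , true) (graft i l r)) ⊎ z ∈ replicate (occ (inj₁ i) r) (true , via (i , true) (graft i r l)) → Via z
    new (inj₁ p) with ∈-replicate (occ (inj₁ i) l) p
    ... | refl , _ = tt
    new (inj₂ p) with ∈-replicate (occ (inj₁ i) r) p
    ... | refl , _ = tt
    old : ∀ {z} → z ∈ map (λ (b , u) → b , fork u r) (cuts i l) ⊎ z ∈ map (λ (b , u) → b , fork l u) (cuts i r) → Fork z
    old (inj₁ p) with ∈-map⁻ _ p
    ... | _ , _ , refl = tt
    old (inj₂ p) with ∈-map⁻ _ p
    ... | _ , _ , refl = tt
    heads : ∀ {z} → z ∈ replicate (occ (inj₁ i) l) (false , via (i , true) (graft i l r)) ⊎ z ∈ replicate (occ (inj₁ i) r) (true , via (i , true) (graft i r l)) →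
            z ∈ map (λ (b , u) → b , fork u r) (cuts i l) ⊎ z ∈ map (λ (b , u) → b , fork l u) (cuts i r) → ⊥
    heads {z} p q = distinct z (new p) (old q)

-- For a fixed `i`, a code together with a fork above its tip `i` is recovered from the cut code and
-- one bit. So each of the n labels contributes at most twice the number of codes, and the mean of
-- the depth sum is at most 2 n.
∑-depths : ∀ n → ∑ (allCodes n) depthSum ≤ n * (length (allCodes n) + length (allCodes n))
∑-depths n = begin
  ∑ L depthSum                                             ≡⟨ ∑-cong L (λ {c} _ → sym (∑-cuts c)) ⟩
  ∑ L (λ c → ∑ (allFin n) (λ i → length (cuts i c)))       ≡⟨ ∑-swap L (allFin n) _ ⟩
  ∑ (allFin n) (λ i → ∑ L (λ c → length (cuts i c)))       ≤⟨ ∑-mono (allFin n) (λ {i} _ → each i) ⟩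
  ∑ (allFin n) (λ _ → length L + length L)                 ≡⟨ ∑-const (allFin n) _ ⟩
  length (allFin n) * (length L + length L)                ≡⟨ cong (_* (length L + length L)) (length-allFin n) ⟩
  n * (length L + length L)                                ∎
  where
  open ℕ.≤-Reasoning
  L = allCodes n
  tag : Bool → Code n → Bool × Code n
  tag = _,_
  LL = map (tag false) L ++ map (tag true) L
  ∈LL : ∀ b {c} → Valid c → (b , c) ∈ LL
  ∈LL false c! = ∈-++⁺ˡ (∈-map⁺ (tag false) (∈-allCodes⁺ c!))
  ∈LL true  c! = ∈-++⁺ʳ (map (tag false) L) (∈-map⁺ (tag true) (∈-allCodes⁺ c!))
  restore : ∀ {i c b u} → c ∈ L → (b , u) ∈ cuts i c → undo i b u ≡ c
  restore {i} {c} c∈ p = undo-cut q (absent′ false) (absent′ true)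
    where
    q = ∈-cuts i c p
    absent′ : ∀ b′ → occ (inj₂ (i , b′)) c ≡ 0
    absent′ b′ = proj₂ (split≡1 (cut⇒occ q) (ℕ.≤-reflexive (once (∈-allCodes⁻ c∈) i b′)))
  each : ∀ i → ∑ L (λ c → length (cuts i c)) ≤ length L + length L
  each i = ℕ.≤-trans (double-count {L = L} {J = cuts i} {M = LL} (λ _ x → x) (allCodes-unique n)
      (λ {c} c∈ → cuts-unique i c (at-most-once (valid⇒linear (∈-allCodes⁻ c∈)) (inj₁ i)))
      (λ {c} {x} c∈ x∈ → ∈LL (proj₁ x) (cut-valid (∈-allCodes⁻ c∈) (∈-cuts i c x∈)))
      (λ { {c} {x} {d} {y} c∈ x∈ d∈ y∈ refl → trans (sym (restore c∈ x∈)) (restore d∈ y∈) , refl }))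
    (ℕ.≤-reflexive (trans (length-++ (map (tag false) L)) (cong₂ _+_ (length-map (tag false) L) (length-map (tag true) L))))

-- The parameter `k` is free: the mean number of tips is at most (2 n + 2^k) / k, which is a small
-- fraction of n once `k` is a large constant and n is much larger than 2^k.
∑-tips : ∀ n k → k * ∑ (allCodes n) tipCount ≤ n * (length (allCodes n) + length (allCodes n)) + length (allCodes n) * 2 ^ k
∑-tips n k = begin
  k * ∑ L tipCount                          ≡⟨ sym (∑-* L k tipCount) ⟩
  ∑ L (λ c → k * tipCount c)                ≤⟨ ∑-mono L (λ {c} _ → tips≤depths k c) ⟩
  ∑ L (λ c → depthSum c + 2 ^ k)            ≡⟨ ∑-+ L depthSum (λ _ → 2 ^ k) ⟩
  ∑ L depthSum + ∑ L (λ _ → 2 ^ k)          ≤⟨ ℕ.+-mono-≤ (∑-depths n) (ℕ.≤-reflexive (∑-const L (2 ^ k))) ⟩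
  n * (length L + length L) + length L * 2 ^ k ∎
  where
  open ℕ.≤-Reasoning
  L = allCodes n

-- Few short cycles: exchanging the second parents of two reticulations

top : Code n → Maybe (Lab n)
top (via a _) = just a
top _         = nothing

isTop : Lab n → Code n → Bool
isTop x (via a _) = does (x ≟ˡ a)
isTop x _         = false

-- The label directly below or above the label `x`, provided that the vertex there carries a label.
-- In a linear code at most one branch of a fork can answer, so the preference of `<∣>` for the left
-- one is harmless.
next prev : Code n → Lab n → Maybe (Lab n)
next (tip _)    x = nothing
next (via a t)  x = if does (x ≟ˡ a) then top t else next t x
next (fork l r) x = next l x <∣> next r x
prev (tip _)    x = nothing
prev (via a t)  x = if isTop x t then just a else prev t x
prev (fork l r) x = prev l x <∣> prev r x

other : Lab n → Lab n
other (i , b) = i , not b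

data Move : Set where
  dn up jp : Move

-- Moves that are impossible in c stay put.
move : Code n → Move → Lab n → Lab n
move c dn x = fromMaybe x (next c x)
move c up x = fromMaybe x (prev c x)
move c jp x = other x

run : Code n → List Move → Lab n → Lab n
run c []      x = x
run c (m ∷ w) x = run c w (move c m x)

jumps : Code n → List Move → Lab n → List (Fin n)
jumps c []       x = []
jumps c (jp ∷ w) x = proj₁ x ∷ jumps c w (other x)
jumps c (dn ∷ w) x = jumps c w (move c dn x)
jumps c (up ∷ w) x = jumps c w (move c up x)

length-jumps : ∀ (c : Code n) w x → length (jumps c w x) ≤ length w
length-jumps c []       x = z≤n
length-jumps c (jp ∷ w) x = s≤s (length-jumps c w _)
length-jumps c (dn ∷ w) x = ℕ.m≤n⇒m≤1+n (length-jumps c w _)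
length-jumps c (up ∷ w) x = ℕ.m≤n⇒m≤1+n (length-jumps c w _)

words : ℕ → List (List Move)
words zero    = [] ∷ []
words (suc k) = [] ∷ concatMap (λ m → map (m ∷_) (words k)) (dn ∷ up ∷ jp ∷ [])

∈-words : ∀ {k} w → length w ≤ k → w ∈ words k
∈-words {zero}  []       _ = here refl
∈-words {suc k} []       _ = here refl
∈-words {suc k} (m ∷ w) (s≤s le) = there (∈-concatMap (λ m → map (m ∷_) (words k)) (∈-moves m) (∈-map⁺ (m ∷_) (∈-words w le)))
  where
  ∈-moves : ∀ m → m ∈ dn ∷ up ∷ jp ∷ []
  ∈-moves dn = here refl
  ∈-moves up = there (here refl)
  ∈-moves jp = there (there (here refl))

words-length : ∀ {k w} → w ∈ words k → length w ≤ k
words-length {zero}  (here refl) = z≤n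
words-length {suc k} (here refl) = z≤n
words-length {suc k} (there p) with find (∈-concatMap⁻ (λ m → map (m ∷_) (words k)) {xs = dn ∷ up ∷ jp ∷ []} p)
... | m , _ , q with ∈-map⁻ (m ∷_) q
... | w , w∈ , refl = s≤s (words-length w∈)

-- A path joining the two parents of the reticulation i that avoids it
Closes : Code n → Fin n → List Move → Set
Closes c i w = Hybrid c i × run c w (i , false) ≡ (i , true) × i ∉ jumps c w (i , false)

closes? : ∀ (c : Code n) i w → Dec (Closes c i w)
closes? c i w = hybrid? c i ×-dec run c w (i , false) ≟ˡ (i , true) ×-dec ¬? (any? (i Fin.≟_) (jumps c w (i , false)))

-- Pairs of a label and a word are counted, so that a cycle may be counted several times, which is
-- harmless in an upper bound.
cycles : ℕ → Code n → ℕ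
cycles {n} k c = ∑ (allFin n) λ i → ∑ (words k) λ w → ⟦ closes? c i w ⟧

private
  exchange : Fin n → Fin n → Lab n → Lab n
  exchange i j x = if does (x ≟ˡ (i , true)) then j , true else if does (x ≟ˡ (j , true)) then i , true else x

  module _ (i j : Fin n) where
    exchange-left : exchange i j (i , true) ≡ (j , true)
    exchange-left rewrite does-yes ((i , true) ≟ˡ (i , true)) refl = refl

    exchange-right : exchange i j (j , true) ≡ (i , true)
    exchange-right with (j , true) ≟ˡ (i , true)
    ... | yes refl = refl
    ... | no _ rewrite does-yes ((j , true) ≟ˡ (j , true)) refl = refl

    exchange-fixed : ∀ x → x ≢ (i , true) → x ≢ (j , true) → exchange i j x ≡ x
    exchange-fixed x p q rewrite does-no (x ≟ˡ (i , true)) p | does-no (x ≟ˡ (j , true)) q = refl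

    exchange-involutive : ∀ x → exchange i j (exchange i j x) ≡ x
    exchange-involutive x = go (x ≟ˡ (i , true)) (x ≟ˡ (j , true))
      where
      go : Dec (x ≡ (i , true)) → Dec (x ≡ (j , true)) → exchange i j (exchange i j x) ≡ x
      go (yes refl) _          = trans (cong (exchange i j) exchange-left) exchange-right
      go (no _)     (yes refl) = trans (cong (exchange i j) exchange-right) exchange-left
      go (no p)     (no q)     = trans (cong (exchange i j) (exchange-fixed x p q)) (exchange-fixed x p q)

  module _ {σ : Lab n → Lab n} (σ-injective : ∀ {x y} → σ x ≡ σ y → x ≡ y) where
    does-σ : ∀ x y → does (σ x ≟ˡ σ y) ≡ does (x ≟ˡ y)
    does-σ x y with x ≟ˡ y
    ... | yes refl = does-yes (σ x ≟ˡ σ x) refl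
    ... | no x≢y   = does-no (σ x ≟ˡ σ y) (x≢y ∘ σ-injective)

    top-σ : ∀ t → top (relabel σ t) ≡ mapᴹ σ (top t)
    top-σ (tip _)    = refl
    top-σ (via _ _)  = refl
    top-σ (fork _ _) = refl

    isTop-σ : ∀ x t → isTop (σ x) (relabel σ t) ≡ isTop x t
    isTop-σ x (tip _)    = refl
    isTop-σ x (via a _)  = does-σ x a
    isTop-σ x (fork _ _) = refl

    map-<∣> : ∀ (p q : Maybe (Lab n)) → mapᴹ σ (p <∣> q) ≡ mapᴹ σ p <∣> mapᴹ σ q
    map-<∣> (just _) q = refl
    map-<∣> nothing  q = refl

    next-σ : ∀ c x → next (relabel σ c) (σ x) ≡ mapᴹ σ (next c x)
    next-σ (tip _)    x = refl
    next-σ (via a t)  x rewrite does-σ x a with does (x ≟ˡ a)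
    ... | true  = top-σ t
    ... | false = next-σ t x
    next-σ (fork l r) x = trans (cong₂ _<∣>_ (next-σ l x) (next-σ r x)) (sym (map-<∣> (next l x) (next r x)))

    prev-σ : ∀ c x → prev (relabel σ c) (σ x) ≡ mapᴹ σ (prev c x)
    prev-σ (tip _)    x = refl
    prev-σ (via a t)  x rewrite isTop-σ x t with isTop x t
    ... | true  = refl
    ... | false = prev-σ t x
    prev-σ (fork l r) x = trans (cong₂ _<∣>_ (prev-σ l x) (prev-σ r x)) (sym (map-<∣> (prev l x) (prev r x)))

    fromMaybe-σ : ∀ x m → fromMaybe (σ x) (mapᴹ σ m) ≡ σ (fromMaybe x m)
    fromMaybe-σ x (just _) = refl
    fromMaybe-σ x nothing  = refl

    -- The vertical moves commute with every injective relabelling, since they only use the shape of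
    -- the code. `other` depends on the label itself, whence the condition that `σ` fixes both
    -- letters of every reticulation crossed.
    run-σ : ∀ c w x → (∀ {k} → k ∈ jumps c w x → ∀ b → σ (k , b) ≡ (k , b)) → run (relabel σ c) w (σ x) ≡ σ (run c w x)
    run-σ c []       x h = refl
    run-σ c (dn ∷ w) x h = trans (cong (run (relabel σ c) w) (trans (cong (fromMaybe (σ x)) (next-σ c x)) (fromMaybe-σ x (next c x)))) (run-σ c w _ h)
    run-σ c (up ∷ w) x h = trans (cong (run (relabel σ c) w) (trans (cong (fromMaybe (σ x)) (prev-σ c x)) (fromMaybe-σ x (prev c x)))) (run-σ c w _ h)
    run-σ c (jp ∷ w) x h = trans (cong (run (relabel σ c) w)
      (trans (cong other (h (here refl) (proj₂ x))) (sym (h (here refl) (not (proj₂ x)))))) (run-σ c w _ (h ∘ there))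

    occ-σ : ∀ c a → occ (inj₂ (σ a)) (relabel σ c) ≡ occ (inj₂ a) c
    occ-σ (tip j)    a = trans (⟦⟧-no (inj₂ (σ a) ≟ˣ inj₁ j) λ ()) (sym (⟦⟧-no (inj₂ a ≟ˣ inj₁ j) λ ()))
    occ-σ (via b t)  a = cong₂ _+_ (indicator (a ≟ˡ b)) (occ-σ t a)
      where
      indicator : Dec (a ≡ b) → ⟦ inj₂ (σ a) ≟ˣ inj₂ (σ b) ⟧ ≡ ⟦ inj₂ a ≟ˣ inj₂ b ⟧
      indicator (yes refl) = trans (⟦⟧-yes (inj₂ (σ a) ≟ˣ inj₂ (σ a)) refl) (sym (⟦⟧-yes (inj₂ a ≟ˣ inj₂ a) refl))
      indicator (no a≢b)   = trans (⟦⟧-no (inj₂ (σ a) ≟ˣ inj₂ (σ b)) (λ eq → a≢b (σ-injective (inj₂-injective eq))))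
                                   (sym (⟦⟧-no (inj₂ a ≟ˣ inj₂ b) (a≢b ∘ inj₂-injective)))
    occ-σ (fork l r) a = cong₂ _+_ (occ-σ l a) (occ-σ r a)

  relabel-id : ∀ {f : Lab n → Lab n} → (∀ a → f a ≡ a) → ∀ c → relabel f c ≡ c
  relabel-id e (tip i)    = refl
  relabel-id e (via a t)  = cong₂ via (e a) (relabel-id e t)
  relabel-id e (fork l r) = cong₂ fork (relabel-id e l) (relabel-id e r)

  exchange-inverse : ∀ i j (c : Code n) → relabel (exchange i j) (relabel (exchange i j) c) ≡ c
  exchange-inverse i j c = trans (relabel-∘ {h = id} (exchange-involutive i j) c) (relabel-id (λ _ → refl) c)

  exchange-injective : ∀ i j {x y : Lab n} → exchange i j x ≡ exchange i j y → x ≡ y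
  exchange-injective i j eq = trans (sym (exchange-involutive i j _)) (trans (cong (exchange i j) eq) (exchange-involutive i j _))

  -- Both labels belong to reticulations, so neither is a tip, and trading their second parents
  -- keeps all multiplicities equal to 1.
  exchange-valid : ∀ {i j} {c : Code n} → Valid c → Hybrid c i → Hybrid c j → Valid (relabel (exchange i j) c)
  exchange-valid {i = i} {j} {c} c! hi hj = valid λ k b →
    trans (cong₂ _+_ (occ-relabel (exchange i j) k c)
      (trans (cong (λ a → occ (inj₂ a) (relabel (exchange i j) c)) (sym (exchange-involutive i j (k , b))))
             (occ-σ (exchange-injective i j) c (exchange i j (k , b)))))
      (go k b ((k , b) ≟ˡ (i , true)) ((k , b) ≟ˡ (j , true)))
    where
    go : ∀ k b → Dec ((k , b) ≡ (i , true)) → Dec ((k , b) ≡ (j , true)) →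
         occ (inj₁ k) c + occ (inj₂ (exchange i j (k , b))) c ≡ 1
    go k b (yes refl) _ = trans (cong₂ _+_ (trans hi (sym hj)) (cong (λ a → occ (inj₂ a) c) (exchange-left i j))) (once c! j true)
    go k b (no _) (yes refl) = trans (cong₂ _+_ (trans hj (sym hi)) (cong (λ a → occ (inj₂ a) c) (exchange-right i j))) (once c! i true)
    go k b (no p) (no q) = trans (cong (λ a → occ (inj₁ k) c + occ (inj₂ a) c) (exchange-fixed i j (k , b) p q)) (once c! k b)

  partners : Code n → Fin n → List Move → List (Fin n)
  partners {n} c i w = filter (λ j → hybrid? c j ×-dec ¬? (any? (j Fin.≟_) (i ∷ jumps c w (i , false)))) (allFin n)

  n≤partners : ∀ {c : Code n} → Valid c → ∀ i w → n ≤ length (partners c i w) + (tipCount c + suc (length w))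
  n≤partners {n} {c} c! i w = begin
    n                                                        ≡⟨ sym (hybrids+tips c!) ⟩
    length (hybrids c) + tipCount c                          ≤⟨ ℕ.+-monoˡ-≤ (tipCount c) (⊆⇒length≤ (filter-allFin! (hybrid? c)) sub) ⟩
    length (partners c i w ++ i ∷ js) + tipCount c           ≡⟨ cong (_+ tipCount c) (length-++ (partners c i w)) ⟩
    (length (partners c i w) + suc (length js)) + tipCount c ≤⟨ ℕ.+-monoˡ-≤ (tipCount c) (ℕ.+-monoʳ-≤ (length (partners c i w)) (s≤s (length-jumps c w _))) ⟩
    (length (partners c i w) + suc (length w)) + tipCount c  ≡⟨ trans (ℕ.+-assoc (length (partners c i w)) _ _) (cong (length (partners c i w) +_) (ℕ.+-comm _ (tipCount c))) ⟩
    length (partners c i w) + (tipCount c + suc (length w))  ∎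
    where
    open ℕ.≤-Reasoning
    js = jumps c w (i , false)
    sub : ∀ {j} → j ∈ hybrids c → j ∈ partners c i w ++ i ∷ js
    sub {j} j∈ with any? (j Fin.≟_) (i ∷ js)
    ... | yes p = ∈-++⁺ʳ (partners c i w) p
    ... | no ¬p = ∈-++⁺ˡ (∈-filter-allFin (λ j → hybrid? c j ×-dec ¬? (any? (j Fin.≟_) (i ∷ js))) (filter-allFin⁻ (hybrid? c) j∈ , ¬p))

  -- After the exchange the same path leads from (i , false) to (j , true), which gives j back.
  exchanged : ∀ {c : Code n} {i j w} → Closes c i w → j ∉ i ∷ jumps c w (i , false) →
              run (relabel (exchange i j) c) w (i , false) ≡ (j , true)
  exchanged {c = c} {i} {j} {w} (_ , ends , i∉) j∉ = begin
    run (relabel (exchange i j) c) w (i , false)                  ≡⟨ cong (run _ w) (sym (exchange-fixed i j (i , false) (λ ()) (λ ()))) ⟩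
    run (relabel (exchange i j) c) w (exchange i j (i , false))   ≡⟨ run-σ (exchange-injective i j) c w (i , false) fixed ⟩
    exchange i j (run c w (i , false))                            ≡⟨ cong (exchange i j) ends ⟩
    exchange i j (i , true)                                       ≡⟨ exchange-left i j ⟩
    (j , true)                                                    ∎
    where
    open ≡-Reasoning
    fixed : ∀ {k} → k ∈ jumps c w (i , false) → ∀ b → exchange i j (k , b) ≡ (k , b)
    fixed {k} k∈ b = exchange-fixed i j (k , b) (λ { refl → i∉ k∈ }) (λ { refl → j∉ (there k∈) })

  only-if : ∀ {P : Set} → Dec P → List A → List A
  only-if (yes _) xs = xs
  only-if (no _)  xs = []

  ∈-only-if : ∀ {P : Set} (P? : Dec P) {xs} {x : A} → x ∈ only-if P? xs → P × x ∈ xs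
  ∈-only-if (yes p) x∈ = p , x∈

  only-if-unique : ∀ {P : Set} (P? : Dec P) {xs : List A} → Unique xs → Unique (only-if P? xs)
  only-if-unique (yes _) xs! = xs!
  only-if-unique (no _)  _   = []

  only-if-enough : ∀ {P : Set} (P? : Dec P) {xs : List A} {m k} → m ≤ length xs + k → m * ⟦ P? ⟧ ≤ length (only-if P? xs) + k
  only-if-enough (yes _) {m = m} le = ℕ.≤-trans (ℕ.≤-reflexive (ℕ.*-identityʳ m)) le
  only-if-enough (no _)  {m = m} le = ℕ.≤-trans (ℕ.≤-reflexive (ℕ.*-zeroʳ m)) z≤n

-- For fixed `i` and `w` the pairs of a code and a partner are mapped injectively to codes, because
-- the end of the path in the new code reveals the partner and the exchange is an involution. The
-- factor `n` on the left stands for the number of partners, up to the correction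
-- `tipCount c + suc k`; the one on the right is the number of labels `i`. They cancel, so the mean
-- number of short cycles is of the order of the mean number of tips.
∑-cycles : ∀ n k → n * ∑ (allCodes n) (cycles k) ≤
  n * (length (words k) * (length (allCodes n) + ∑ (allCodes n) (λ c → tipCount c + suc k)))
∑-cycles n k = begin
  n * ∑ L (cycles k)
    ≡⟨ cong (n *_) (∑-swap L (allFin n) (λ c i → ∑ (words k) λ w → ⟦ closes? c i w ⟧)) ⟩
  n * ∑ (allFin n) (λ i → ∑ L (λ c → ∑ (words k) λ w → ⟦ closes? c i w ⟧))
    ≡⟨ cong (n *_) (∑-cong (allFin n) (λ {i} _ → ∑-swap L (words k) (λ c w → ⟦ closes? c i w ⟧))) ⟩
  n * ∑ (allFin n) (λ i → ∑ (words k) (λ w → ∑ L (λ c → ⟦ closes? c i w ⟧)))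
    ≡⟨ trans (sym (∑-* (allFin n) n _)) (∑-cong (allFin n) (λ {i} _ → sym (∑-* (words k) n _))) ⟩
  ∑ (allFin n) (λ i → ∑ (words k) (λ w → n * ∑ L (λ c → ⟦ closes? c i w ⟧)))
    ≤⟨ ∑-mono (allFin n) (λ {i} _ → ∑-mono (words k) (λ {w} w∈ → each i w (words-length w∈))) ⟩
  ∑ (allFin n) (λ i → ∑ (words k) (λ w → bound))
    ≡⟨ trans (∑-cong (allFin n) (λ _ → ∑-const (words k) bound)) (∑-const (allFin n) _) ⟩
  length (allFin n) * (length (words k) * bound)
    ≡⟨ cong (_* (length (words k) * bound)) (length-allFin n) ⟩
  n * (length (words k) * bound) ∎
  where
  open ℕ.≤-Reasoning
  L = allCodes n
  bound = length L + ∑ L (λ c → tipCount c + suc k)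
  module _ (i : Fin n) (w : List Move) (le : length w ≤ k) where
    J : Code n → List (Fin n)
    J c = only-if (closes? c i w) (partners c i w)
    ∈J : ∀ {c j} → j ∈ J c → Closes c i w × Hybrid c j × j ∉ i ∷ jumps c w (i , false)
    ∈J {c} p = let q , p′ = ∈-only-if (closes? c i w) p in
      q , filter-allFin⁻ (λ j → hybrid? c j ×-dec ¬? (any? (j Fin.≟_) (i ∷ jumps c w (i , false)))) p′
    J! : ∀ c → Unique (J c)
    J! c = only-if-unique (closes? c i w) (filter-allFin! (λ j → hybrid? c j ×-dec ¬? (any? (j Fin.≟_) (i ∷ jumps c w (i , false)))))
    enough : ∀ {c} → Valid c → n * ⟦ closes? c i w ⟧ ≤ length (J c) + (tipCount c + suc k)
    enough {c} c! = only-if-enough (closes? c i w)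
      (ℕ.≤-trans (n≤partners c! i w) (ℕ.+-monoʳ-≤ (length (partners c i w)) (ℕ.+-monoʳ-≤ (tipCount c) (s≤s le))))
    each : n * ∑ L (λ c → ⟦ closes? c i w ⟧) ≤ bound
    each = begin
      n * ∑ L (λ c → ⟦ closes? c i w ⟧)                 ≡⟨ sym (∑-* L n _) ⟩
      ∑ L (λ c → n * ⟦ closes? c i w ⟧)                 ≤⟨ ∑-mono L (λ c∈ → enough (∈-allCodes⁻ c∈)) ⟩
      ∑ L (λ c → length (J c) + (tipCount c + suc k))   ≡⟨ ∑-+ L (length ∘ J) _ ⟩
      ∑ L (length ∘ J) + ∑ L (λ c → tipCount c + suc k) ≤⟨ ℕ.+-monoˡ-≤ _ (double-count {L = L} {J = J} {M = L} (λ c j → relabel (exchange i j) c)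
        (allCodes-unique n) (λ {c} _ → J! c)
        (λ {c} {j} c∈ j∈ → let q , h , _ = ∈J {c} j∈ in ∈-allCodes⁺ (exchange-valid (∈-allCodes⁻ c∈) (proj₁ q) h))
        λ {c} {j} {c′} {j′} _ j∈ _ j′∈ eq → let q , _ , j∉ = ∈J {c} j∈ ; q′ , _ , j′∉ = ∈J {c′} j′∈ in
          injective c c′ j j′ eq (trans (sym (exchanged {c = c} {w = w} q j∉)) (trans (cong (λ d → run d w (i , false)) eq) (exchanged {c = c′} {w = w} q′ j′∉)))) ⟩
      length L + ∑ L (λ c → tipCount c + suc k)         ∎
      where
      injective : ∀ c c′ j j′ → relabel (exchange i j) c ≡ relabel (exchange i j′) c′ → (j , true) ≡ (j′ , true) → c ≡ c′ × j ≡ j′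
      injective c c′ j .j eq refl = trans (sym (exchange-inverse i j c)) (trans (cong (relabel (exchange i j)) eq) (exchange-inverse i j c′)) , refl

-- Walks along the letters of a code

next⇒⊑ : ∀ (c : Code n) {a a′} → next c a ≡ just a′ → ∃ λ t → via a (via a′ t) ⊑ c
next⇒⊑ (via b t) {a} eq with a ≟ˡ b
next⇒⊑ (via b (via a′ t)) refl | yes refl = t , here
... | no _ = let u , p = next⇒⊑ t eq in u , via p
next⇒⊑ (fork l r) {a} eq with next l a in eqₗ
... | just _ = let u , p = next⇒⊑ l (trans eqₗ eq) in u , left p
... | nothing = let u , p = next⇒⊑ r eq in u , right p

private
  isTop⇒ : ∀ {a : Lab n} t → isTop a t ≡ true → ∃ λ u → t ≡ via a u
  isTop⇒ {a = a} (via b u) eq with a ≟ˡ b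
  ... | yes refl = u , refl

prev⇒⊑ : ∀ (c : Code n) {a a′} → prev c a ≡ just a′ → ∃ λ t → via a′ (via a t) ⊑ c
prev⇒⊑ (via b t) {a} eq with isTop a t in top?
prev⇒⊑ (via b t) refl | true with isTop⇒ t top?
... | u , refl = u , here
prev⇒⊑ (via b t) eq | false = let u , p = prev⇒⊑ t eq in u , via p
prev⇒⊑ (fork l r) {a} eq with prev l a in eqₗ
... | just _ = let u , p = prev⇒⊑ l (trans eqₗ eq) in u , left p
... | nothing = let u , p = prev⇒⊑ r eq in u , right p

private
  via-⊑-≢ : ∀ {a b t u} {c : Code n} → Linear (via b c) → via a (via u t) ⊑ c → a ≢ b
  via-⊑-≢ {a = a} lin p refl = ℕ.<-irrefl (sym (linear-via {a = a} lin)) (via⊑⇒occ p)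

  top-below : ∀ {a a′ u} {t : Code n} → Linear (via a t) → via a′ (via a u) ⊑ via a t → ⊥
  top-below {a = a} {u = u} lin here = ℕ.<-irrefl (sym (linear-via {a = a} lin)) (via⊑⇒occ {a = a} {u} here)
  top-below {a = a} lin (via p) = ℕ.<-irrefl (sym (linear-via {a = a} lin)) (via⊑⇒occ (⊑-trans (via here) p))

  not-top : ∀ {a a′ u} (t : Code n) → Linear t → via a′ (via a u) ⊑ t → isTop a t ≡ false
  not-top (fork _ _) lin p = refl
  not-top {a = a} (via b t) lin p = does-no (a ≟ˡ b) λ { refl → top-below lin p }

⊑⇒next : ∀ {c : Code n} {a a′ t} → Linear c → via a (via a′ t) ⊑ c → next c a ≡ just a′
⊑⇒next {a = a} lin here rewrite does-yes (a ≟ˡ a) refl = refl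
⊑⇒next {a = a} lin (via {a = b} p) rewrite does-no (a ≟ˡ b) (via-⊑-≢ lin p) = ⊑⇒next (linear-⊑ (via here) lin) p
⊑⇒next lin (left {l = l} {r} p) = cong (_<∣> next r _) (⊑⇒next (linear-⊑ (left here) lin) p)
⊑⇒next {a = a} lin (right {l = l} p) with next l a in eq
... | nothing = ⊑⇒next (linear-⊑ (right here) lin) p
... | just _ = ⊥-elim (linear-fork {x = inj₂ a} lin (via⊑⇒occ (proj₂ (next⇒⊑ l eq))) (via⊑⇒occ p))

⊑⇒prev : ∀ {c : Code n} {a a′ t} → Linear c → via a′ (via a t) ⊑ c → prev c a ≡ just a′
⊑⇒prev {a = a} lin here rewrite does-yes (a ≟ˡ a) refl = refl
⊑⇒prev {a = a} lin (via {t = t} p) rewrite not-top t (linear-⊑ (via here) lin) p = ⊑⇒prev (linear-⊑ (via here) lin) p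
⊑⇒prev lin (left {l = l} {r} p) = cong (_<∣> prev r _) (⊑⇒prev (linear-⊑ (left here) lin) p)
⊑⇒prev {a = a} lin (right {l = l} p) with prev l a in eq
... | nothing = ⊑⇒prev (linear-⊑ (right here) lin) p
... | just _ = ⊥-elim (linear-fork {x = inj₂ a} lin (via⊑⇒occ (⊑-trans (via here) (proj₂ (prev⇒⊑ l eq)))) (via⊑⇒occ (⊑-trans (via here) p)))

other-other : ∀ (a : Lab n) → other (other a) ≡ a
other-other (i , false) = refl
other-other (i , true)  = refl

same-label : ∀ (a b : Lab n) → proj₁ a ≡ proj₁ b → a ≡ b ⊎ a ≡ other b
same-label (i , false) (.i , false) refl = inj₁ refl
same-label (i , false) (.i , true)  refl = inj₂ refl
same-label (i , true)  (.i , false) refl = inj₂ refl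
same-label (i , true)  (.i , true)  refl = inj₁ refl

-- Reduced walks and closed walks

inv : Move → Move
inv dn = up
inv up = dn
inv jp = jp

data Reduced : List Move → Set where
  []   : Reduced []
  [_]  : ∀ m → Reduced (m ∷ [])
  step : ∀ {m m′ w} → m′ ≢ inv m → Reduced (m′ ∷ w) → Reduced (m ∷ m′ ∷ w)

_≟ᵐᵒ_ : DecidableEquality Move
dn ≟ᵐᵒ dn = yes refl
dn ≟ᵐᵒ up = no λ ()
dn ≟ᵐᵒ jp = no λ ()
up ≟ᵐᵒ dn = no λ ()
up ≟ᵐᵒ up = yes refl
up ≟ᵐᵒ jp = no λ ()
jp ≟ᵐᵒ dn = no λ ()
jp ≟ᵐᵒ up = no λ ()
jp ≟ᵐᵒ jp = yes refl

reduced-tail : ∀ {m w} → Reduced (m ∷ w) → Reduced w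
reduced-tail [ m ]      = []
reduced-tail (step _ p) = p

reduced-++ˡ : ∀ u {v} → Reduced (u ++ v) → Reduced u
reduced-++ˡ []           p          = []
reduced-++ˡ (m ∷ [])     p          = [ m ]
reduced-++ˡ (m ∷ m′ ∷ u) (step q p) = step q (reduced-++ˡ (m′ ∷ u) p)

reduced-++ʳ : ∀ u {v} → Reduced (u ++ v) → Reduced v
reduced-++ʳ []      p = p
reduced-++ʳ (m ∷ u) p = reduced-++ʳ u (reduced-tail p)

rev : List Move → List Move
rev []      = []
rev (m ∷ w) = rev w ++ inv m ∷ []

length-rev : ∀ w → length (rev w) ≡ length w
length-rev []      = refl
length-rev (m ∷ w) = trans (length-++ (rev w)) (trans (ℕ.+-comm (length (rev w)) 1) (cong suc (length-rev w)))

run-++ : ∀ (c : Code n) u v a → run c (u ++ v) a ≡ run c v (run c u a)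
run-++ c []      v a = refl
run-++ c (m ∷ u) v a = run-++ c u v (move c m a)

jumps-++ : ∀ (c : Code n) u v a → jumps c (u ++ v) a ≡ jumps c u a ++ jumps c v (run c u a)
jumps-++ c []       v a = refl
jumps-++ c (dn ∷ u) v a = jumps-++ c u v _
jumps-++ c (up ∷ u) v a = jumps-++ c u v _
jumps-++ c (jp ∷ u) v a = cong (proj₁ a ∷_) (jumps-++ c u v _)

-- Around a the code looks like the limit, and the reticulation of a lies on no short cycle.
record Nice (c : Code n) (k : ℕ) (a : Lab n) : Set where
  field
    after before : Lab n
    next-≡       : next c a ≡ just after
    prev-≡       : prev c a ≡ just before
    acyclic      : ∀ {w} → length w ≤ k → ¬ Closes c (proj₁ a) w

data NiceAlong (c : Code n) (k : ℕ) : List Move → Lab n → Set where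
  []  : ∀ {a} → Nice c k a → NiceAlong c k [] a
  _∷_ : ∀ {m w a} → Nice c k a → NiceAlong c k w (move c m a) → NiceAlong c k (m ∷ w) a

module _ {c : Code n} (c! : Valid c) {k : ℕ} where
  private
    lin = valid⇒linear c!

  nice-hybrid : ∀ {a} → Nice c k a → Hybrid c (proj₁ a)
  nice-hybrid p = via⇒hybrid c! (proj₂ (next⇒⊑ c (Nice.next-≡ p)))

  move-inv : ∀ m {a} → Nice c k a → move c (inv m) (move c m a) ≡ a
  move-inv jp {a} p = other-other a
  move-inv dn {a} p rewrite Nice.next-≡ p = cong (fromMaybe _) (⊑⇒prev lin (proj₂ (next⇒⊑ c (Nice.next-≡ p))))
  move-inv up {a} p rewrite Nice.prev-≡ p = cong (fromMaybe _) (⊑⇒next lin (proj₂ (prev⇒⊑ c (Nice.prev-≡ p))))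

  along-start : ∀ {w a} → NiceAlong c k w a → Nice c k a
  along-start ([] p)  = p
  along-start (p ∷ _) = p

  along-++ˡ : ∀ u {v a} → NiceAlong c k (u ++ v) a → NiceAlong c k u a
  along-++ˡ []      p       = [] (along-start p)
  along-++ˡ (m ∷ u) (q ∷ p) = q ∷ along-++ˡ u p

  along-++ʳ : ∀ u {v a} → NiceAlong c k (u ++ v) a → NiceAlong c k v (run c u a)
  along-++ʳ []      p       = p
  along-++ʳ (m ∷ u) (q ∷ p) = along-++ʳ u p

  along-++⁺ : ∀ {u v a} → NiceAlong c k u a → NiceAlong c k v (run c u a) → NiceAlong c k (u ++ v) a
  along-++⁺ ([] _)  q = q
  along-++⁺ (r ∷ p) q = r ∷ along-++⁺ p q

  rev-run : ∀ {w a} → NiceAlong c k w a → run c (rev w) (run c w a) ≡ a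
  rev-run {[]}    p       = refl
  rev-run {m ∷ w} {a} (q ∷ p) = trans (run-++ c (rev w) (inv m ∷ []) _)
    (trans (cong (move c (inv m)) (rev-run p)) (move-inv m q))

  rev-jumps : ∀ {w a i} → NiceAlong c k w a → i ∈ jumps c (rev w) (run c w a) → i ∈ jumps c w a
  rev-jumps {m ∷ w} {a} {i} (q ∷ p) i∈ with ∈-++⁻ (jumps c (rev w) _) (subst (i ∈_) (jumps-++ c (rev w) (inv m ∷ []) _) i∈)
  ... | inj₁ i∈′ = add m (rev-jumps p i∈′)
    where
    add : ∀ m → i ∈ jumps c w (move c m a) → i ∈ jumps c (m ∷ w) a
    add dn r = r
    add up r = r
    add jp r = there r
  ... | inj₂ i∈′ = last m p i∈′
    where
    last : ∀ m → NiceAlong c k w (move c m a) → i ∈ jumps c (inv m ∷ []) (run c (rev w) (run c w (move c m a))) → i ∈ jumps c (m ∷ w) a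
    last jp p (here refl) = here (cong proj₁ (rev-run p))

  private
    Straight : List Move → Set
    Straight w = All (_≢ jp) w

    straight-jumps : ∀ {w} a {i} → Straight w → i ∉ jumps c w a
    straight-jumps {dn ∷ w} a (_ ∷ s) p = straight-jumps {w} _ s p
    straight-jumps {up ∷ w} a (_ ∷ s) p = straight-jumps {w} _ s p
    straight-jumps {jp ∷ w} a (q ∷ s) p = q refl

    first-jump : ∀ w → Straight w ⊎ ∃ λ u → ∃ λ v → w ≡ u ++ jp ∷ v × Straight u
    first-jump []       = inj₁ []
    first-jump (jp ∷ w) = inj₂ ([] , w , refl , [])
    first-jump (dn ∷ w) with first-jump w
    ... | inj₁ s = inj₁ ((λ ()) ∷ s)
    ... | inj₂ (u , v , refl , s) = inj₂ (dn ∷ u , v , refl , (λ ()) ∷ s)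
    first-jump (up ∷ w) with first-jump w
    ... | inj₁ s = inj₁ ((λ ()) ∷ s)
    ... | inj₂ (u , v , refl , s) = inj₂ (up ∷ u , v , refl , (λ ()) ∷ s)

    jump-at : ∀ i v a → i ∉ jumps c v a ⊎ ∃ λ u → ∃ λ v′ → v ≡ u ++ jp ∷ v′ × i ∉ jumps c u a × proj₁ (run c u a) ≡ i
    jump-at i []       a = inj₁ λ ()
    jump-at i (dn ∷ v) a with jump-at i v (move c dn a)
    ... | inj₁ p = inj₁ p
    ... | inj₂ (u , v′ , refl , p , e) = inj₂ (dn ∷ u , v′ , refl , p , e)
    jump-at i (up ∷ v) a with jump-at i v (move c up a)
    ... | inj₁ p = inj₁ p
    ... | inj₂ (u , v′ , refl , p , e) = inj₂ (up ∷ u , v′ , refl , p , e)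
    jump-at i (jp ∷ v) a with proj₁ a Fin.≟ i
    ... | yes e = inj₂ ([] , v , refl , (λ ()) , e)
    ... | no ne with jump-at i v (other a)
    ...   | inj₁ p = inj₁ λ { (here e) → ne (sym e) ; (there q) → p q }
    ...   | inj₂ (u , v′ , refl , p , e) = inj₂ (jp ∷ u , v′ , refl , (λ { (here e′) → ne (sym e′) ; (there q) → p q }) , e)

    -- The height of a letter is the size of the subcode below it; every step down lowers it by at
    -- least one.
    dn-run : ∀ {w a t} → All (_≡ dn) w → NiceAlong c k w a → via a t ⊑ c →
             ∃ λ t′ → via (run c w a) t′ ⊑ c × length w + size t′ ≤ size t
    dn-run [] p q = _ , q , ℕ.≤-refl
    dn-run {dn ∷ w} {a} {t} (refl ∷ s) (r ∷ p) q rewrite Nice.next-≡ r with next⇒⊑ c (Nice.next-≡ r)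
    ... | u , q′ with via-unique lin q q′
    ... | refl with dn-run s p (⊑-trans (via here) q′)
    ... | t′ , q″ , le = t′ , q″ , s≤s le

    up-run : ∀ {w a t} → All (_≡ up) w → NiceAlong c k w a → via a t ⊑ c →
             ∃ λ t′ → via (run c w a) t′ ⊑ c × length w + size t ≤ size t′
    up-run [] p q = _ , q , ℕ.≤-refl
    up-run {up ∷ w} {a} {t} (refl ∷ s) (r ∷ p) q rewrite Nice.prev-≡ r with prev⇒⊑ c (Nice.prev-≡ r)
    ... | u , q′ with via-unique lin q (⊑-trans (via here) q′)
    ... | refl with up-run s p q′
    ... | t′ , q″ , le = t′ , q″ , ℕ.≤-trans (ℕ.≤-reflexive (sym (ℕ.+-suc (length w) (size t)))) le

    -- Without jumps, a change of direction would be a move followed by its inverse.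
    straight-reduced : ∀ {w} → Straight w → Reduced w → All (_≡ dn) w ⊎ All (_≡ up) w
    straight-reduced s [] = inj₁ []
    straight-reduced (_ ∷ _) [ dn ] = inj₁ (refl ∷ [])
    straight-reduced (_ ∷ _) [ up ] = inj₂ (refl ∷ [])
    straight-reduced (q ∷ _) [ jp ] = ⊥-elim (q refl)
    straight-reduced (q ∷ s) (step {m} {m′} r p) with straight-reduced s p
    straight-reduced (q ∷ s) (step {dn} r p) | inj₁ x = inj₁ (refl ∷ x)
    straight-reduced (q ∷ s) (step {up} r p) | inj₁ (refl ∷ x) = ⊥-elim (r refl)
    straight-reduced (q ∷ s) (step {jp} r p) | _ = ⊥-elim (q refl)
    straight-reduced (q ∷ s) (step {dn} r p) | inj₂ (refl ∷ x) = ⊥-elim (r refl)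
    straight-reduced (q ∷ s) (step {up} r p) | inj₂ x = inj₂ (refl ∷ x)

    straight-open : ∀ {m w a} → Straight (m ∷ w) → Reduced (m ∷ w) → NiceAlong c k (m ∷ w) a → run c (m ∷ w) a ≡ a → ⊥
    straight-open {m} {w} {a} s r p eq with next⇒⊑ c (Nice.next-≡ (along-start p)) | straight-reduced s r
    ... | u , q | inj₁ all with dn-run all p q
    ...   | t′ , q′ , le with via-unique lin q (subst (λ b → via b t′ ⊑ c) eq q′)
    ...   | refl = ℕ.<⇒≱ (s≤s (ℕ.m≤n+m _ (length w))) le
    straight-open {m} {w} {a} s r p eq | u , q | inj₂ all with up-run all p q
    ...   | t′ , q′ , le with via-unique lin q (subst (λ b → via b t′ ⊑ c) eq q′)
    ...   | refl = ℕ.<⇒≱ (s≤s (ℕ.m≤n+m _ (length w))) le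

    -- `Closes` fixes the direction from `(i , false)` to `(i , true)`, so a walk in the opposite
    -- direction is reversed first. Being nice along the way guarantees that the reversed walk
    -- retraces its steps.
    not-closing : ∀ {w a} → Nice c k a → NiceAlong c k w (other a) → length w ≤ k → proj₁ a ∉ jumps c w (other a) →
                  run c w (other a) ≢ a
    not-closing {w} {i , true}  q p le i∉ eq = Nice.acyclic q {w} le (nice-hybrid q , eq , i∉)
    not-closing {w} {i , false} q p le i∉ eq = Nice.acyclic q {rev w} (subst (_≤ k) (sym (length-rev w)) le)
      (nice-hybrid q , subst (λ b → run c (rev w) b ≡ (i , true)) eq (rev-run p) ,
       λ i∈ → i∉ (rev-jumps p (subst (λ b → i ∈ jumps c (rev w) b) (sym eq) i∈)))

  -- A closed walk must jump, since the height is strictly monotone along a straight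
  -- walk. After its first jump, at the reticulation i, either it never jumps at i
  -- again and i lies on a short cycle, or it returns to i and contains a shorter
  -- closed walk or a short cycle through i.
  no-return : ∀ {m w a} → Reduced (m ∷ w) → NiceAlong c k (m ∷ w) a → length (m ∷ w) ≤ k → run c (m ∷ w) a ≢ a
  no-return {m} {w} = go (<-wellFounded (length (m ∷ w)))
    where
    go : ∀ {m w a} → Acc _<_ (length (m ∷ w)) → Reduced (m ∷ w) → NiceAlong c k (m ∷ w) a → length (m ∷ w) ≤ k → run c (m ∷ w) a ≢ a
    go {m} {w} {a} (acc rec) r p le eq with first-jump (m ∷ w)
    ... | inj₁ s = straight-open s r p eq
    ... | inj₂ (u , v , e , s) = after-jump (jump-at (proj₁ b) v (other b))
      where
      b = run c u a
      r′ : Reduced (u ++ jp ∷ v)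
      r′ = subst Reduced e r
      p′ : NiceAlong c k (u ++ jp ∷ v) a
      p′ = subst (λ w → NiceAlong c k w a) e p
      lengths : suc (length w) ≡ length u + suc (length v)
      lengths = trans (cong length e) (length-++ u)
      at-b : NiceAlong c k (jp ∷ v) b
      at-b = along-++ʳ u p′
      on-v : NiceAlong c k v (other b)
      on-v with at-b
      ... | _ ∷ q = q
      end : run c v (other b) ≡ a
      end = trans (sym (run-++ c u (jp ∷ v) a)) (trans (cong (λ w → run c w a) (sym e)) eq)
      v<w : length v < suc (length w)
      v<w = ℕ.≤-trans (ℕ.m≤n+m _ (length u)) (ℕ.≤-reflexive (sym lengths))
      after-jump : (proj₁ b ∉ jumps c v (other b) ⊎ ∃ λ u′ → ∃ λ v′ → v ≡ u′ ++ jp ∷ v′ × proj₁ b ∉ jumps c u′ (other b) × proj₁ (run c u′ (other b)) ≡ proj₁ b) → ⊥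
      -- The closed walk is rotated so as to begin after its first jump: `v ++ u` leads from
      -- `other b` to `b`, and `u` contains no jump at all.
      after-jump (inj₁ i∉) = not-closing {v ++ u} (along-start at-b)
        (along-++⁺ on-v (subst (NiceAlong c k u) (sym end) (along-++ˡ u p′)))
        (ℕ.≤-trans (ℕ.≤-reflexive (length-++ v)) (ℕ.≤-trans (ℕ.≤-reflexive (ℕ.+-comm (length v) _))
          (ℕ.≤-trans (ℕ.+-monoʳ-≤ (length u) (ℕ.n≤1+n _)) (ℕ.≤-trans (ℕ.≤-reflexive (sym lengths)) le))))
        (λ i∈ → [ i∉ , straight-jumps _ s ]′ (∈-++⁻ (jumps c v (other b)) (subst (_ ∈_) (jumps-++ c v u (other b)) i∈)))
        (trans (run-++ c v u (other b)) (cong (run c u) end))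
      -- The first return to the reticulation of `b` happens either at `b`, in which case `u′`
      -- closes a short cycle, or at `other b`, in which case `u′` is a shorter closed walk.
      after-jump (inj₂ (u′ , v′ , refl , i∉ , label-≡)) with same-label (run c u′ (other b)) b label-≡
      ... | inj₁ eq′ = not-closing {u′} (along-start at-b) (along-++ˡ u′ on-v) (ℕ.≤-trans u′≤w (ℕ.≤-trans (ℕ.n≤1+n _) (ℕ.≤-trans (s≤s ℕ.≤-refl) le))) i∉ eq′
        where
        u′≤w : length u′ ≤ length w
        u′≤w = ℕ.≤-pred (ℕ.≤-trans (s≤s (ℕ.≤-trans (ℕ.m≤m+n _ _) (ℕ.≤-reflexive (sym (length-++ u′))))) v<w)
      ... | inj₂ eq′ = shorter u′ refl
        where
        shorter : ∀ u″ → u″ ≡ u′ → ⊥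
        -- An empty `u′` means two jumps in succession, which a reduced walk excludes.
        shorter [] refl with reduced-++ʳ u r′
        ... | step q _ = q refl
        shorter (m″ ∷ w″) refl = go (rec (ℕ.≤-<-trans (ℕ.≤-trans (ℕ.m≤m+n _ _) (ℕ.≤-reflexive (sym (length-++ u′)))) v<w))
          (reduced-++ˡ u′ (reduced-tail (reduced-++ʳ u r′))) (along-++ˡ u′ on-v)
          (ℕ.≤-trans (ℕ.≤-trans (ℕ.m≤m+n _ _) (ℕ.≤-reflexive (sym (length-++ u′)))) (ℕ.≤-trans (ℕ.<⇒≤ v<w) le)) eq′

-- Isomorphisms of balls

≅-sym : ∀ {Γ Δ} → Γ ≅ Δ → Δ ≅ Γ
≅-sym {Γ} {Δ} φ = record
  { vertices = ↔.↔-sym vertices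
  ; point-≡  = inverseʳ (sym point-≡)
  ; mark-≡   = λ y → trans (sym (mark-≡ (from y))) (cong Δ.mark (inverseˡ refl))
  ; edge-⇔   = λ x y → mk⇔
      (λ e → Equivalence.from (edge-⇔ (from x) (from y)) (subst₂ Δ._⟶_ (sym (inverseˡ refl)) (sym (inverseˡ refl)) e))
      (λ e → subst₂ Δ._⟶_ (inverseˡ refl) (inverseˡ refl) (Equivalence.to (edge-⇔ (from x) (from y)) e))
  }
  where
  module Δ = RootedGraph Δ
  open _≅_ φ
  open Inverse vertices using (inverseˡ; inverseʳ)

≅-trans : ∀ {Γ Δ Θ} → Γ ≅ Δ → Δ ≅ Θ → Γ ≅ Θ
≅-trans φ ψ = record
  { vertices = ↔.↔-trans φ.vertices ψ.vertices
  ; point-≡  = trans (cong ψ.to φ.point-≡) ψ.point-≡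
  ; mark-≡   = λ x → trans (ψ.mark-≡ (φ.to x)) (φ.mark-≡ x)
  ; edge-⇔   = λ x y → mk⇔ (Equivalence.to (ψ.edge-⇔ _ _) ∘ Equivalence.to (φ.edge-⇔ x y))
                            (Equivalence.from (φ.edge-⇔ x y) ∘ Equivalence.from (ψ.edge-⇔ _ _))
  }
  where
  module φ = _≅_ φ
  module ψ = _≅_ ψ

module _ (Γ : MarkedGraph) where
  open MarkedGraph Γ

  within-mono : ∀ {r s u v} → r ≤ s → Within r u v → Within s u v
  within-mono le here = here
  within-mono (s≤s le) (step e p) = step e (within-mono le p)

  within-snoc : ∀ {r u v w} → Within r u v → SymClosure _⟶_ v w → Within (suc r) u w
  within-snoc here e = step e here
  within-snoc (step f p) e = step f (within-snoc p e)

-- A local isomorphism that is injective on the ball of radius R + 1 restricts to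
-- an isomorphism on the ball of radius R.
module Covering {Γ Δ : MarkedGraph} (Γ-finite : LocallyFinite Γ) (Δ-finite : LocallyFinite Δ)
  (F : MarkedGraph.Vertex Δ → MarkedGraph.Vertex Γ) (y₀ : MarkedGraph.Vertex Δ) (R : ℕ) where
  private
    module Γ = MarkedGraph Γ
    module Δ = MarkedGraph Δ

  record IsCovering : Set where
    field
      mark-F    : ∀ {y} → Δ.Within R y₀ y → Γ.mark (F y) ≡ Δ.mark y
      edge-F    : ∀ {y y′} → Δ.Within R y₀ y → SymClosure Δ._⟶_ y y′ → SymClosure Γ._⟶_ (F y) (F y′)
      edge-F′   : ∀ {y y′} → Δ.Within R y₀ y → y Δ.⟶ y′ → F y Γ.⟶ F y′
      lift      : ∀ {y z} → Δ.Within R y₀ y → SymClosure Γ._⟶_ (F y) z → ∃ λ y′ → SymClosure Δ._⟶_ y y′ × F y′ ≡ z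
      lift′     : ∀ {y z} → Δ.Within R y₀ y → F y Γ.⟶ z → ∃ λ y′ → y Δ.⟶ y′ × F y′ ≡ z
      injective : ∀ {y y′} → Δ.Within (suc R) y₀ y → Δ.Within (suc R) y₀ y′ → F y ≡ F y′ → y ≡ y′

  module _ (cov : IsCovering) where
    open IsCovering cov

    private
      project : ∀ s {r y y′} → s + r ≤ R → Δ.Within s y₀ y → Δ.Within r y y′ → Γ.Within r (F y) (F y′)
      project s le p Δ.here = Γ.here
      project s {suc r} le p (Δ.step e q) = Γ.step (edge-F (within-mono Δ (ℕ.m+n≤o⇒m≤o s le) p) e)
        (project (suc s) (subst (_≤ R) (ℕ.+-suc s r) le) (within-snoc Δ p e) q)

      lift-path : ∀ s {r y z} → s + r ≤ R → Δ.Within s y₀ y → Γ.Within r (F y) z → ∃ λ y′ → Δ.Within R y₀ y′ × F y′ ≡ z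
      lift-path s le p Γ.here = _ , within-mono Δ (ℕ.m+n≤o⇒m≤o s le) p , refl
      lift-path s {suc r} le p (Γ.step e q) with lift (within-mono Δ (ℕ.m+n≤o⇒m≤o s le) p) e
      ... | y′ , e′ , refl = lift-path (suc s) (subst (_≤ R) (ℕ.+-suc s r) le) (within-snoc Δ p e′) q

      Ball-Γ Ball-Δ : RootedGraph
      Ball-Γ = ball Γ R (F y₀)
      Ball-Δ = ball Δ R y₀

      value-≡ : ∀ {x y : RootedGraph.Vertex Ball-Γ} → value x ≡ value y → x ≡ y
      value-≡ refl = refl

      value-≡′ : ∀ {x y : RootedGraph.Vertex Ball-Δ} → value x ≡ value y → x ≡ y
      value-≡′ refl = refl

      inside : (y : RootedGraph.Vertex Ball-Δ) → Δ.Within R y₀ (value y)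
      inside (Refinement._,_ y [ p ]) = recompute (within? Δ-finite R y₀ y) p

      inside′ : (z : RootedGraph.Vertex Ball-Γ) → Γ.Within R (F y₀) (value z)
      inside′ (Refinement._,_ z [ p ]) = recompute (within? Γ-finite R (F y₀) z) p

      lifted : (z : RootedGraph.Vertex Ball-Γ) → ∃ λ y → Δ.Within R y₀ y × F y ≡ value z
      lifted z = lift-path 0 ℕ.≤-refl Δ.here (inside′ z)

      up-to : RootedGraph.Vertex Ball-Γ → RootedGraph.Vertex Ball-Δ
      up-to z = Refinement._,_ (proj₁ (lifted z)) [ proj₁ (proj₂ (lifted z)) ]

      F-up : ∀ z → F (value (up-to z)) ≡ value z
      F-up z = proj₂ (proj₂ (lifted z))

      down-to : RootedGraph.Vertex Ball-Δ → RootedGraph.Vertex Ball-Γ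
      down-to y = Refinement._,_ (F (value y)) [ project 0 ℕ.≤-refl Δ.here (inside y) ]

      unique : ∀ y y′ → F (value y) ≡ F (value y′) → y ≡ y′
      unique y y′ eq = value-≡′ (injective (within-mono Δ (ℕ.n≤1+n R) (inside y)) (within-mono Δ (ℕ.n≤1+n R) (inside y′)) eq)

    covering-≅ : Ball-Γ ≅ Ball-Δ
    covering-≅ = record
      { vertices = mk↔ₛ′ up-to down-to (λ y → unique _ _ (F-up (down-to y))) (λ z → value-≡ (F-up z))
      ; point-≡  = unique _ _ (F-up (Refinement._,_ (F y₀) [ Γ.here ]))
      ; mark-≡   = λ z → trans (sym (mark-F (inside (up-to z)))) (cong Γ.mark (F-up z))
      ; edge-⇔   = λ x y → mk⇔ (to-edge x y) (λ e → subst₂ Γ._⟶_ (F-up x) (F-up y) (edge-F′ (inside (up-to x)) e))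
      }
      where
      to-edge : ∀ x y → value x Γ.⟶ value y → value (up-to x) Δ.⟶ value (up-to y)
      -- The lift of the edge ends within distance `R + 1` but perhaps not within `R`; injectivity
      -- on the larger ball identifies its end with the lift of `y`.
      to-edge x y e with lift′ (inside (up-to x)) (subst (Γ._⟶ value y) (sym (F-up x)) e)
      ... | y′ , f , eq with injective (within-snoc Δ (inside (up-to x)) (fwd f)) (within-mono Δ (ℕ.n≤1+n R) (inside (up-to y))) (trans eq (sym (F-up y)))
      ... | refl = f

-- Graphs whose tree vertices are acted upon by the moves

-- What the local analysis needs to know about a limit network, so that both limits are treated at
-- once. A point `x` stands for a tree vertex, and `hyb x` and `end x` are the reticulation below it
-- and its leaf. They are shared by `x` and `act jp x`, the two parents.
record Unfolding (Δ : MarkedGraph) : Set₁ where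
  open MarkedGraph Δ
  field
    Point : Set
    act   : Move → Point → Point
    act-inv : ∀ m x → act (inv m) (act m x) ≡ x
    spine hyb end : Point → Vertex
    mark-node : ∀ x → mark (spine x) ≡ tree
    mark-hyb  : ∀ x → mark (hyb x) ≡ reticulation
    mark-end  : ∀ x → mark (end x) ≡ leaf
    kinds     : ∀ v → (∃ λ x → v ≡ spine x) ⊎ (∃ λ x → v ≡ hyb x) ⊎ (∃ λ x → v ≡ end x)
    node-injective : ∀ {x y} → spine x ≡ spine y → x ≡ y
    hyb-injective  : ∀ {x y} → hyb x ≡ hyb y → x ≡ y ⊎ x ≡ act jp y
    end-injective  : ∀ {x y} → end x ≡ end y → x ≡ y ⊎ x ≡ act jp y
    hyb-jp   : ∀ x → hyb (act jp x) ≡ hyb x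
    end-jp   : ∀ x → end (act jp x) ≡ end x
    node-dn  : ∀ x → spine x ⟶ spine (act dn x)
    node-hyb : ∀ x → spine x ⟶ hyb x
    hyb-end  : ∀ x → hyb x ⟶ end x
    edges    : ∀ {u v} → u ⟶ v → (∃ λ x → u ≡ spine x × v ≡ spine (act dn x)) ⊎ (∃ λ x → u ≡ spine x × v ≡ hyb x)
                               ⊎ (∃ λ x → u ≡ hyb x × v ≡ end x)
    locallyFinite : LocallyFinite Δ

  act* : List Move → Point → Point
  act* []      x = x
  act* (m ∷ w) x = act* w (act m x)

-- An equivariant map from the limit to the letters of `c`. The vertical moves are respected only at
-- nice letters, because elsewhere `move` may stay put while the limit goes on.
record Labelling (c : Code n) (k : ℕ) {Δ : MarkedGraph} (U : Unfolding Δ) : Set where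
  open Unfolding U
  field
    H    : Point → Lab n
    H-jp : ∀ x → H (act jp x) ≡ other (H x)
    H-dn : ∀ x → Nice c k (H x) → H (act dn x) ≡ move c dn (H x)
    H-up : ∀ x → Nice c k (H x) → H (act up x) ≡ move c up (H x)

Good : Code n → ℕ → ℕ → Lab n → Set
Good c k r a = ∀ w → length w ≤ r → Nice c k (run c w a)

module Local {n} {c : Code n} (c! : Valid c) {M : Network n} (P : Named M c) where
  private
    module M = Network M
    module P = Named P
    lin = valid⇒linear c!

    vertex : ∀ {x} → c ∋ x → M.Vertex
    vertex p = proj₁ (P.onto p)

    vertex-≡ : ∀ {x} (p : c ∋ x) → P.name (vertex p) ≡ x
    vertex-≡ p = proj₂ (P.onto p)

  -- At labels that are tips, this and the next two functions take the junk value `M.origin`; the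
  -- lemmas on their names concern the labels of reticulations.
  via-vertex : Lab n → M.Vertex
  via-vertex (i , b) with hybrid? c i
  ... | yes h = vertex (node (proj₂ (hybrid⇒via c! h b)))
  ... | no _  = M.origin

  ret-vertex lf-vertex : Fin n → M.Vertex
  ret-vertex i with hybrid? c i
  ... | yes h = vertex (ret h)
  ... | no _  = M.origin
  lf-vertex i with hybrid? c i
  ... | yes h = vertex (lf h)
  ... | no _  = M.origin

  name-via : ∀ {a t} → via a t ⊑ c → P.name (via-vertex a) ≡ node (via a t)
  name-via {i , b} {t} p with hybrid? c i
  ... | yes h = trans (vertex-≡ _) (cong (λ u → node (via (i , b) u)) (via-unique lin (proj₂ (hybrid⇒via c! h b)) p))
  ... | no ¬h = contradiction (via⇒hybrid c! p) ¬h

  name-ret : ∀ {i} → Hybrid c i → P.name (ret-vertex i) ≡ ret i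
  name-ret {i} h with hybrid? c i
  ... | yes h′ = vertex-≡ (ret h′)
  ... | no ¬h  = contradiction h ¬h

  name-lf : ∀ {i} → Hybrid c i → P.name (lf-vertex i) ≡ lf i
  name-lf {i} h with hybrid? c i
  ... | yes h′ = vertex-≡ (lf h′)
  ... | no ¬h  = contradiction h ¬h

  private
    module _ {k : ℕ} where
      nice-⊑ : ∀ {a} → Nice c k a → ∃ λ t → via a (via (move c dn a) t) ⊑ c
      nice-⊑ {a} q rewrite Nice.next-≡ q = next⇒⊑ c (Nice.next-≡ q)

      nice-⊑′ : ∀ {a} → Nice c k a → ∃ λ t → via (move c up a) (via a t) ⊑ c
      nice-⊑′ {a} q rewrite Nice.prev-≡ q = prev⇒⊑ c (Nice.prev-≡ q)

      edge-dn : ∀ {a} → Nice c k a → via-vertex a M.⟶ via-vertex (move c dn a)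
      edge-dn q = let t , p = nice-⊑ q in P.edge-from (subst₂ (Edge c) (sym (name-via p)) (sym (name-via (⊑-trans (via here) p))) (along via))

      edge-hyb : ∀ {a} → Nice c k a → via-vertex a M.⟶ ret-vertex (proj₁ a)
      edge-hyb q = let t , p = nice-⊑ q in P.edge-from (subst₂ (Edge c) (sym (name-via p)) (sym (name-ret (nice-hybrid c! q))) cross)

      edge-end : ∀ {a} → Nice c k a → ret-vertex (proj₁ a) M.⟶ lf-vertex (proj₁ a)
      edge-end q = P.edge-from (subst₂ (Edge c) (sym (name-ret (nice-hybrid c! q))) (sym (name-lf (nice-hybrid c! q))) hang)

      is-via : ∀ {z a t} → P.name z ≡ node (via a t) → via-vertex a ≡ z
      is-via {z} eq = P.injective (trans (name-via (node⁻ (subst (c ∋_) eq (P.member z)))) (sym eq))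
        where
        node⁻ : ∀ {t} → c ∋ node t → t ⊑ c
        node⁻ (node q) = q

      from-via-name : ∀ {a t x} → Edge c (node (via a t)) x → x ≡ node t ⊎ x ≡ ret (proj₁ a)
      from-via-name (along via) = inj₁ refl
      from-via-name cross       = inj₂ refl

      from-via : ∀ {a z} → Nice c k a → via-vertex a M.⟶ z → via-vertex (move c dn a) ≡ z ⊎ ret-vertex (proj₁ a) ≡ z
      from-via {a} {z} q e with from-via-name (subst (λ x → Edge c x (P.name z)) (name-via (proj₂ (nice-⊑ q))) (P.edge-to e))
      ... | inj₁ eq = inj₁ (is-via eq)
      ... | inj₂ eq = inj₂ (P.injective (trans (name-ret (nice-hybrid c! q)) (sym eq)))

      to-via-name : ∀ {x a b t} → Edge c x (node (via a t)) → c ∋ x → via b (via a t) ⊑ c → x ≡ node (via b (via a t))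
      to-via-name start orig q = ⊥-elim (¬⋖-root q via)
      to-via-name (along s⋖p) (node r) q = cong node (parent-unique lin r q s⋖p via)

      to-via : ∀ {a z} → Nice c k a → z M.⟶ via-vertex a → via-vertex (move c up a) ≡ z
      to-via {a} {z} q e with to-via-name (subst (Edge c (P.name z)) (name-via (⊑-trans (via here) (proj₂ (nice-⊑′ q)))) (P.edge-to e)) (P.member z) (proj₂ (nice-⊑′ q))
      ... | eq = is-via eq

      from-ret : ∀ {i z} → Hybrid c i → ret-vertex i M.⟶ z → lf-vertex i ≡ z
      from-ret {i} {z} h e = go refl (subst (λ x → Edge c x (P.name z)) (name-ret h) (P.edge-to e))
        where
        go : ∀ {x} → P.name z ≡ x → Edge c (ret i) x → lf-vertex i ≡ z
        go eq hang = P.injective (trans (name-lf h) (sym eq))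

      to-ret : ∀ {i z} → Hybrid c i → z M.⟶ ret-vertex i → ∃ λ b → via-vertex (i , b) ≡ z
      to-ret {i} {z} h e = go refl (subst (Edge c (P.name z)) (name-ret h) (P.edge-to e))
        where
        go : ∀ {x} → P.name z ≡ x → Edge c x (ret i) → ∃ λ b → via-vertex (i , b) ≡ z
        go eq (cross {b = b}) = b , is-via eq

      from-lf : ∀ {i z} → Hybrid c i → ¬ lf-vertex i M.⟶ z
      from-lf {i} {z} h e with () ← subst (λ x → Edge c x (P.name z)) (name-lf h) (P.edge-to e)

      to-lf : ∀ {i z} → Hybrid c i → z M.⟶ lf-vertex i → ret-vertex i ≡ z
      to-lf {i} {z} h e = go refl (subst (Edge c (P.name z)) (name-lf h) (P.edge-to e))
        where
        go : ∀ {x} → P.name z ≡ x → Edge c x (lf i) → ret-vertex i ≡ z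
        go eq hang = P.injective (trans (name-ret h) (sym eq))

  module _ {k : ℕ} {Δ : MarkedGraph} (U : Unfolding Δ) (L : Labelling c k U) where
    open MarkedGraph Δ using (Vertex; _⟶_; Within; here; step) renaming (mark to markΔ)
    open Unfolding U
    open Labelling L

    label : Point → Fin n
    label x = proj₁ (H x)

    -- A reticulation of the limit belongs to two points, of which `kinds` returns one. The choice
    -- does not matter, because the letters of the two points have the same label.
    F : Vertex → M.Vertex
    F v with kinds v
    ... | inj₁ (x , _)        = via-vertex (H x)
    ... | inj₂ (inj₁ (x , _)) = ret-vertex (label x)
    ... | inj₂ (inj₂ (x , _)) = lf-vertex (label x)

    private
      label-jp : ∀ {x y} → x ≡ y ⊎ x ≡ act jp y → label x ≡ label y
      label-jp (inj₁ refl) = refl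
      label-jp {y = y} (inj₂ refl) = cong proj₁ (H-jp y)

      mark-≢ : ∀ {u v m m′} → u ≡ v → markΔ u ≡ m → markΔ v ≡ m′ → m ≡ m′
      mark-≢ refl p q = trans (sym p) q

    F-node : ∀ x → F (spine x) ≡ via-vertex (H x)
    F-node x with kinds (spine x)
    ... | inj₁ (y , eq) = cong (via-vertex ∘ H) (sym (node-injective eq))
    ... | inj₂ (inj₁ (y , eq)) with () ← mark-≢ eq (mark-node x) (mark-hyb y)
    ... | inj₂ (inj₂ (y , eq)) with () ← mark-≢ eq (mark-node x) (mark-end y)

    F-hyb : ∀ x → F (hyb x) ≡ ret-vertex (label x)
    F-hyb x with kinds (hyb x)
    ... | inj₁ (y , eq) with () ← mark-≢ eq (mark-hyb x) (mark-node y)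
    ... | inj₂ (inj₁ (y , eq)) = cong ret-vertex (sym (label-jp (hyb-injective eq)))
    ... | inj₂ (inj₂ (y , eq)) with () ← mark-≢ eq (mark-hyb x) (mark-end y)

    F-end : ∀ x → F (end x) ≡ lf-vertex (label x)
    F-end x with kinds (end x)
    ... | inj₁ (y , eq) with () ← mark-≢ eq (mark-end x) (mark-node y)
    ... | inj₂ (inj₁ (y , eq)) with () ← mark-≢ eq (mark-end x) (mark-hyb y)
    ... | inj₂ (inj₂ (y , eq)) = cong lf-vertex (sym (label-jp (end-injective eq)))

    private
      H-act : ∀ m {x} → Nice c k (H x) → H (act m x) ≡ move c m (H x)
      H-act dn q = H-dn _ q
      H-act up q = H-up _ q
      H-act jp q = H-jp _

      H-act* : ∀ w {x} → NiceAlong c k w (H x) → H (act* w x) ≡ run c w (H x)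
      H-act* []      p = refl
      H-act* (m ∷ w) {x} (q ∷ p) = trans (H-act* w (subst (NiceAlong c k w) (sym (H-act m q)) p)) (cong (run c w) (H-act m q))

      act*-++ : ∀ u v x → act* (u ++ v) x ≡ act* v (act* u x)
      act*-++ []      v x = refl
      act*-++ (m ∷ u) v x = act*-++ u v (act m x)

      act*-rev : ∀ w x → act* (rev w) (act* w x) ≡ x
      act*-rev []      x = refl
      act*-rev (m ∷ w) x = trans (act*-++ (rev w) (inv m ∷ []) _) (trans (cong (act (inv m)) (act*-rev w (act m x))) (act-inv m x))

      reduce : ∀ w x → ∃ λ w′ → Reduced w′ × length w′ ≤ length w × act* w′ x ≡ act* w x
      reduce []      x = [] , [] , z≤n , refl
      reduce (m ∷ w) x with reduce w (act m x)
      ... | [] , _ , le , eq = m ∷ [] , [ m ] , s≤s le , eq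
      ... | m′ ∷ w′ , r , le , eq with m′ ≟ᵐᵒ inv m
      ...   | yes refl = w′ , reduced-tail r , ℕ.≤-trans (ℕ.n≤1+n _) (ℕ.≤-trans le (ℕ.n≤1+n _)) , trans (sym (cong (act* w′) (act-inv m x))) eq
      ...   | no ne = m ∷ m′ ∷ w′ , step ne r , s≤s le , eq

      -- Relates each vertex to the points next to it, in order to replace paths in the graph by
      -- words: crossing an edge costs at most one move.
      data Touch (y : Vertex) (x : Point) : Set where
        is-node : y ≡ spine x → Touch y x
        is-hyb  : y ≡ hyb x → Touch y x
        is-end  : y ≡ end x → Touch y x

      touch-step : ∀ {y u x} → Touch y x → SymClosure _⟶_ y u → ∃ λ w → length w ≤ 1 × Touch u (act* w x)
      touch-step t (fwd e) with edges e | t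
      ... | inj₁ (z , p , q) | is-node r with node-injective (trans (sym p) r)
      ...   | refl = dn ∷ [] , ℕ.≤-refl , is-node q
      touch-step t (fwd e) | inj₁ (z , p , q) | is-hyb r with () ← mark-≢ (trans (sym p) r) (mark-node _) (mark-hyb _)
      touch-step t (fwd e) | inj₁ (z , p , q) | is-end r with () ← mark-≢ (trans (sym p) r) (mark-node _) (mark-end _)
      touch-step t (fwd e) | inj₂ (inj₁ (z , p , q)) | is-node r with node-injective (trans (sym p) r)
      ...   | refl = [] , z≤n , is-hyb q
      touch-step t (fwd e) | inj₂ (inj₁ (z , p , q)) | is-hyb r with () ← mark-≢ (trans (sym p) r) (mark-node _) (mark-hyb _)
      touch-step t (fwd e) | inj₂ (inj₁ (z , p , q)) | is-end r with () ← mark-≢ (trans (sym p) r) (mark-node _) (mark-end _)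
      touch-step t (fwd e) | inj₂ (inj₂ (z , p , q)) | is-node r with () ← mark-≢ (trans (sym p) r) (mark-hyb _) (mark-node _)
      touch-step t (fwd e) | inj₂ (inj₂ (z , p , q)) | is-hyb r with hyb-injective (trans (sym p) r)
      ...   | inj₁ refl = [] , z≤n , is-end q
      ...   | inj₂ refl = [] , z≤n , is-end (trans q (end-jp _))
      touch-step t (fwd e) | inj₂ (inj₂ (z , p , q)) | is-end r with () ← mark-≢ (trans (sym p) r) (mark-hyb _) (mark-end _)
      touch-step t (bwd e) with edges e | t
      ... | inj₁ (z , p , q) | is-node r with node-injective (trans (sym q) r)
      ...   | refl = up ∷ [] , ℕ.≤-refl , is-node (trans p (cong spine (sym (act-inv dn z))))
      touch-step t (bwd e) | inj₁ (z , p , q) | is-hyb r with () ← mark-≢ (trans (sym q) r) (mark-node _) (mark-hyb _)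
      touch-step t (bwd e) | inj₁ (z , p , q) | is-end r with () ← mark-≢ (trans (sym q) r) (mark-node _) (mark-end _)
      touch-step t (bwd e) | inj₂ (inj₁ (z , p , q)) | is-node r with () ← mark-≢ (trans (sym q) r) (mark-hyb _) (mark-node _)
      touch-step t (bwd e) | inj₂ (inj₁ (z , p , q)) | is-hyb r with hyb-injective (trans (sym q) r)
      ...   | inj₁ refl = [] , z≤n , is-node p
      ...   | inj₂ refl = jp ∷ [] , ℕ.≤-refl , is-node p
      touch-step t (bwd e) | inj₂ (inj₁ (z , p , q)) | is-end r with () ← mark-≢ (trans (sym q) r) (mark-hyb _) (mark-end _)
      touch-step t (bwd e) | inj₂ (inj₂ (z , p , q)) | is-node r with () ← mark-≢ (trans (sym q) r) (mark-end _) (mark-node _)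
      touch-step t (bwd e) | inj₂ (inj₂ (z , p , q)) | is-hyb r with () ← mark-≢ (trans (sym q) r) (mark-end _) (mark-hyb _)
      touch-step t (bwd e) | inj₂ (inj₂ (z , p , q)) | is-end r with end-injective (trans (sym q) r)
      ...   | inj₁ refl = [] , z≤n , is-hyb p
      ...   | inj₂ refl = [] , z≤n , is-hyb (trans p (hyb-jp _))

      touch-within : ∀ {s y u x} → Touch y x → Within s y u → ∃ λ w → length w ≤ s × Touch u (act* w x)
      touch-within t here = [] , z≤n , t
      touch-within {suc s} {x = x} t (step e p) with touch-step t e
      ... | w , le , t′ with touch-within t′ p
      ... | w′ , le′ , t″ = w ++ w′ , ℕ.≤-trans (ℕ.≤-reflexive (length-++ w)) (ℕ.+-mono-≤ le le′) , subst (Touch _) (sym (act*-++ w w′ x)) t″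

    module _ (y₀ : Vertex) (x₀ : Point) (touch₀ : Touch y₀ x₀) (R : ℕ) (3r≤k : 3 * suc (suc R) ≤ k) (good : Good c k (3 * suc (suc R)) (H x₀)) where
      private
        nice-along : ∀ w {a} → (∀ u v → w ≡ u ++ v → Nice c k (run c u a)) → NiceAlong c k w a
        nice-along []      h = [] (h [] [] refl)
        nice-along (m ∷ w) h = h [] (m ∷ w) refl ∷ nice-along w (λ u v eq → h (m ∷ u) v (cong (m ∷_) eq))

        good-along : ∀ w → length w ≤ 3 * suc (suc R) → NiceAlong c k w (H x₀)
        good-along w le = nice-along w λ { u v refl → good u (ℕ.≤-trans (ℕ.≤-trans (ℕ.m≤m+n _ _) (ℕ.≤-reflexive (sym (length-++ u)))) le) }

        good-along′ : ∀ u v → length u + length v ≤ 3 * suc (suc R) → NiceAlong c k v (H (act* u x₀))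
        good-along′ u v le = subst (NiceAlong c k v) (sym (H-act* u (along-++ˡ c! u p))) (along-++ʳ c! u p)
          where p = good-along (u ++ v) (ℕ.≤-trans (ℕ.≤-reflexive (length-++ u)) le)

        nice-at : ∀ w → length w ≤ 3 * suc (suc R) → Nice c k (H (act* w x₀))
        nice-at w le = along-start c! (good-along′ w [] (ℕ.≤-trans (ℕ.≤-reflexive (ℕ.+-identityʳ _)) le))

        reached : ∀ {s y} → Within s y₀ y → ∃ λ w → length w ≤ s × Touch y (act* w x₀)
        reached = touch-within touch₀

        R≤ : ∀ {l} → l ≤ R → l ≤ 3 * suc (suc R)
        R≤ le = ℕ.≤-trans le (ℕ.≤-trans (ℕ.n≤1+n _) (ℕ.≤-trans (ℕ.n≤1+n _) (ℕ.m≤m+n _ _)))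

        sR≤ : ∀ {l} → l ≤ suc R → l ≤ 3 * suc (suc R)
        sR≤ le = ℕ.≤-trans le (ℕ.≤-trans (ℕ.n≤1+n _) (ℕ.m≤m+n _ _))

        F-touch-mark : ∀ {y x} → Nice c k (H x) → Touch y x → M.mark (F y) ≡ markΔ y
        F-touch-mark {x = x} q (is-node refl) = trans (cong M.mark (F-node x)) (trans (P.mark-≡ _) (trans (cong nameMark (name-via (proj₂ (nice-⊑ q)))) (sym (mark-node x))))
        F-touch-mark {x = x} q (is-hyb refl)  = trans (cong M.mark (F-hyb x)) (trans (P.mark-≡ _) (trans (cong nameMark (name-ret (nice-hybrid c! q))) (sym (mark-hyb x))))
        F-touch-mark {x = x} q (is-end refl)  = trans (cong M.mark (F-end x)) (trans (P.mark-≡ _) (trans (cong nameMark (name-lf (nice-hybrid c! q))) (sym (mark-end x))))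

        F-edge : ∀ {u v w} → length w ≤ 3 * suc (suc R) → Touch u (act* w x₀) → u ⟶ v → F u M.⟶ F v
        F-edge {w = w} le t e with edges e | t
        ... | inj₁ (z , refl , refl) | is-node r with node-injective r
        ...   | refl = subst₂ M._⟶_ (sym (F-node z)) (sym (trans (F-node (act dn z)) (cong via-vertex (H-dn z (nice-at w le))))) (edge-dn (nice-at w le))
        F-edge le t e | inj₁ (z , refl , refl) | is-hyb r with () ← mark-≢ r (mark-node _) (mark-hyb _)
        F-edge le t e | inj₁ (z , refl , refl) | is-end r with () ← mark-≢ r (mark-node _) (mark-end _)
        F-edge {w = w} le t e | inj₂ (inj₁ (z , refl , refl)) | is-node r with node-injective r
        ...   | refl = subst₂ M._⟶_ (sym (F-node z)) (sym (F-hyb z)) (edge-hyb (nice-at w le))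
        F-edge le t e | inj₂ (inj₁ (z , refl , refl)) | is-hyb r with () ← mark-≢ r (mark-node _) (mark-hyb _)
        F-edge le t e | inj₂ (inj₁ (z , refl , refl)) | is-end r with () ← mark-≢ r (mark-node _) (mark-end _)
        F-edge le t e | inj₂ (inj₂ (z , refl , refl)) | is-node r with () ← mark-≢ r (mark-hyb _) (mark-node _)
        F-edge {w = w} le t e | inj₂ (inj₂ (z , refl , refl)) | is-hyb r =
          subst₂ M._⟶_ (sym (trans (F-hyb z) (cong ret-vertex eq))) (sym (trans (F-end z) (cong lf-vertex eq))) (edge-end (nice-at w le))
          where
          eq : label z ≡ label (act* w x₀)
          eq = label-jp (hyb-injective r)
        F-edge le t e | inj₂ (inj₂ (z , refl , refl)) | is-end r with () ← mark-≢ r (mark-hyb _) (mark-end _)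

        F-lift-fwd : ∀ {y x z} → Nice c k (H x) → Touch y x → F y M.⟶ z → ∃ λ y′ → y ⟶ y′ × F y′ ≡ z
        F-lift-fwd {x = x} {z} q (is-node refl) e with from-via q (subst (M._⟶ z) (F-node x) e)
        ... | inj₁ eq = spine (act dn x) , node-dn x , trans (F-node _) (trans (cong via-vertex (H-dn x q)) eq)
        ... | inj₂ eq = hyb x , node-hyb x , trans (F-hyb x) eq
        F-lift-fwd {x = x} {z} q (is-hyb refl) e = end x , hyb-end x , trans (F-end x) (from-ret {k} (nice-hybrid c! q) (subst (M._⟶ z) (F-hyb x) e))
        F-lift-fwd {x = x} {z} q (is-end refl) e = ⊥-elim (from-lf {k} (nice-hybrid c! q) (subst (M._⟶ z) (F-end x) e))

        F-lift-bwd : ∀ {y x z} → Nice c k (H x) → Touch y x → z M.⟶ F y → ∃ λ y′ → y′ ⟶ y × F y′ ≡ z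
        F-lift-bwd {x = x} {z} q (is-node refl) e = spine (act up x) , subst (λ v → spine (act up x) ⟶ spine v) (act-inv up x) (node-dn (act up x)) ,
          trans (F-node _) (trans (cong via-vertex (H-up x q)) (to-via q (subst (z M.⟶_) (F-node x) e)))
        F-lift-bwd {x = x} {z} q (is-hyb refl) e with to-ret {k} (nice-hybrid c! q) (subst (z M.⟶_) (F-hyb x) e)
        ... | b , eq with b ≟ᵇ proj₂ (H x)
        ...   | yes refl = spine x , node-hyb x , trans (F-node x) eq
        ...   | no b≢ = spine (act jp x) , subst (spine (act jp x) ⟶_) (hyb-jp x) (node-hyb (act jp x)) ,
                trans (F-node _) (trans (cong via-vertex (trans (H-jp x) (cong (label x ,_) (other-bit b (proj₂ (H x)) b≢)))) eq)
                where
                other-bit : ∀ b b′ → b ≢ b′ → not b′ ≡ b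
                other-bit false false ne = contradiction refl ne
                other-bit false true  ne = refl
                other-bit true  false ne = refl
                other-bit true  true  ne = contradiction refl ne
        F-lift-bwd {x = x} {z} q (is-end refl) e = hyb x , hyb-end x , trans (F-hyb x) (to-lf {k} (nice-hybrid c! q) (subst (z M.⟶_) (F-end x) e))

        -- The origin of the radius `3 * suc (suc R)`: a word of length at most R + 2 leads to the
        -- first point, and from there a reduced word of length at most 2 (R + 2) leads to the
        -- second one. If the latter word were not empty, it would describe a closed walk in the
        -- code, contrary to `no-return`.
        injective-at : ∀ u v → length u ≤ suc (suc R) → length v ≤ suc (suc R) → H (act* u x₀) ≡ H (act* v x₀) → act* u x₀ ≡ act* v x₀
        injective-at u v le le′ eq with reduce (rev u ++ v) (act* u x₀)
        ... | w , r , lw , eq-w = go w r lw (trans eq-w (trans (act*-++ (rev u) v _) (cong (act* v) (act*-rev u x₀))))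
          where
          short : length (rev u ++ v) ≤ suc (suc R) + suc (suc R)
          short = ℕ.≤-trans (ℕ.≤-reflexive (trans (length-++ (rev u)) (cong (_+ length v) (length-rev u)))) (ℕ.+-mono-≤ le le′)
          go : ∀ w → Reduced w → length w ≤ length (rev u ++ v) → act* w (act* u x₀) ≡ act* v x₀ → act* u x₀ ≡ act* v x₀
          go [] r lw e = e
          go (m ∷ w) r lw e = ⊥-elim (no-return c! r path
              (ℕ.≤-trans lw (ℕ.≤-trans short (ℕ.≤-trans (ℕ.≤-trans (ℕ.m≤n+m _ (suc (suc R))) (ℕ.≤-reflexive (three (suc (suc R))))) 3r≤k)))
              (trans (sym (H-act* (m ∷ w) path)) (trans (cong H e) (sym eq))))
            where
            three : ∀ s → s + (s + s) ≡ 3 * s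
            three = solve-∀
            path : NiceAlong c k (m ∷ w) (H (act* u x₀))
            path = good-along′ u (m ∷ w) (ℕ.≤-trans (ℕ.+-mono-≤ le (ℕ.≤-trans lw short)) (ℕ.≤-reflexive (three (suc (suc R)))))

        name-clash : ∀ {u v x y} → u ≡ v → P.name u ≡ x → P.name v ≡ y → x ≡ y
        name-clash refl p q = trans (sym p) q

        -- Equal labels leave the possibility of the opposite parent, which is reached by one more
        -- jump. So points within R + 1 moves require injectivity for words of length R + 2.
        same-point : ∀ u v → length u ≤ suc R → length v ≤ suc R → label (act* u x₀) ≡ label (act* v x₀) →
                     act* u x₀ ≡ act* v x₀ ⊎ act* u x₀ ≡ act jp (act* v x₀)
        same-point u v le le′ eq with same-label (H (act* u x₀)) (H (act* v x₀)) eq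
        ... | inj₁ e = inj₁ (injective-at u v (ℕ.m≤n⇒m≤1+n le) (ℕ.m≤n⇒m≤1+n le′) e)
        ... | inj₂ e = inj₂ (trans (injective-at u (v ++ jp ∷ []) (ℕ.m≤n⇒m≤1+n le)
                (ℕ.≤-trans (ℕ.≤-reflexive (trans (length-++ v) (ℕ.+-comm (length v) 1))) (s≤s le′))
                (trans e (trans (sym (H-jp _)) (cong H (sym (act*-++ v (jp ∷ []) x₀)))))) (act*-++ v (jp ∷ []) x₀))

        F-injective : ∀ {y y′} → Within (suc R) y₀ y → Within (suc R) y₀ y′ → F y ≡ F y′ → y ≡ y′
        F-injective p p′ eq with reached p | reached p′
        ... | u , le , t | v , le′ , t′ = go t t′ (trans (sym (F-touch-mark q t)) (trans (cong M.mark eq) (F-touch-mark q′ t′)))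
          where
          q = nice-at u (sR≤ le)
          q′ = nice-at v (sR≤ le′)
          go : Touch _ (act* u x₀) → Touch _ (act* v x₀) → markΔ _ ≡ markΔ _ → _
          go (is-node refl) (is-node refl) _ = cong spine (injective-at u v (ℕ.m≤n⇒m≤1+n le) (ℕ.m≤n⇒m≤1+n le′)
            (via-label (name-clash (trans (sym (F-node _)) (trans eq (F-node _))) (name-via (proj₂ (nice-⊑ q))) (name-via (proj₂ (nice-⊑ q′))))))
            where
            via-label : ∀ {a b s t} → Name.node {n} (via a s) ≡ node (via b t) → a ≡ b
            via-label refl = refl
          go (is-hyb refl) (is-hyb refl) _ = [ cong hyb , (λ e → trans (cong hyb e) (hyb-jp _)) ]′ (same-point u v le le′
            (ret-label (name-clash (trans (sym (F-hyb _)) (trans eq (F-hyb _))) (name-ret (nice-hybrid c! q)) (name-ret (nice-hybrid c! q′)))))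
            where
            ret-label : ∀ {i j} → Name.ret {n} i ≡ ret j → i ≡ j
            ret-label refl = refl
          go (is-end refl) (is-end refl) _ = [ cong end , (λ e → trans (cong end e) (end-jp _)) ]′ (same-point u v le le′
            (lf-label (name-clash (trans (sym (F-end _)) (trans eq (F-end _))) (name-lf (nice-hybrid c! q)) (name-lf (nice-hybrid c! q′)))))
            where
            lf-label : ∀ {i j} → Name.lf {n} i ≡ lf j → i ≡ j
            lf-label refl = refl
          go (is-node refl) (is-hyb refl) m with () ← trans (sym (mark-node _)) (trans m (mark-hyb _))
          go (is-node refl) (is-end refl) m with () ← trans (sym (mark-node _)) (trans m (mark-end _))
          go (is-hyb refl) (is-node refl) m with () ← trans (sym (mark-hyb _)) (trans m (mark-node _))
          go (is-hyb refl) (is-end refl) m with () ← trans (sym (mark-hyb _)) (trans m (mark-end _))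
          go (is-end refl) (is-node refl) m with () ← trans (sym (mark-end _)) (trans m (mark-node _))
          go (is-end refl) (is-hyb refl) m with () ← trans (sym (mark-end _)) (trans m (mark-hyb _))

        edge-of : ∀ {y y′} → Within R y₀ y → SymClosure _⟶_ y y′ → SymClosure M._⟶_ (F y) (F y′)
        edge-of p (fwd e) = let w , le , t = reached p in fwd (F-edge {w = w} (R≤ le) t e)
        edge-of p (bwd e) = let w , le , t = reached (within-snoc Δ p (bwd e)) in bwd (F-edge {w = w} (sR≤ le) t e)

        lift-of : ∀ {y z} → Within R y₀ y → SymClosure M._⟶_ (F y) z → ∃ λ y′ → SymClosure _⟶_ y y′ × F y′ ≡ z
        lift-of p (fwd e) = let w , le , t = reached p ; y′ , f , eq = F-lift-fwd (nice-at w (R≤ le)) t e in y′ , fwd f , eq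
        lift-of p (bwd e) = let w , le , t = reached p ; y′ , f , eq = F-lift-bwd (nice-at w (R≤ le)) t e in y′ , bwd f , eq

      ball-≅ : ball M.graph R (F y₀) ≅ ball Δ R y₀
      ball-≅ = Covering.covering-≅ M.locallyFinite locallyFinite F y₀ R record
        { mark-F    = λ p → let w , le , t = reached p in F-touch-mark (nice-at w (R≤ le)) t
        ; edge-F    = edge-of
        ; edge-F′   = λ p e → let w , le , t = reached p in F-edge {w = w} (R≤ le) t e
        ; lift      = lift-of
        ; lift′     = λ p e → let w , le , t = reached p in F-lift-fwd (nice-at w (R≤ le)) t e
        ; injective = F-injective
        }

    module _ (x₀ : Point) (R : ℕ) (3r≤k : 3 * suc (suc R) ≤ k) (good : Good c k (3 * suc (suc R)) (H x₀)) where
      ball-node : ball M.graph R (via-vertex (H x₀)) ≅ ball Δ R (spine x₀)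
      ball-node = subst (λ v → ball M.graph R v ≅ ball Δ R (spine x₀)) (F-node x₀) (ball-≅ (spine x₀) x₀ (is-node refl) R 3r≤k good)

      ball-hyb : ball M.graph R (ret-vertex (label x₀)) ≅ ball Δ R (hyb x₀)
      ball-hyb = subst (λ v → ball M.graph R v ≅ ball Δ R (hyb x₀)) (F-hyb x₀) (ball-≅ (hyb x₀) x₀ (is-hyb refl) R 3r≤k good)

      ball-end : ball M.graph R (lf-vertex (label x₀)) ≅ ball Δ R (end x₀)
      ball-end = subst (λ v → ball M.graph R v ≅ ball Δ R (end x₀)) (F-end x₀) (ball-≅ (end x₀) x₀ (is-end refl) R 3r≤k good)

-- The limit networks

module _ {c : Code n} (c! : Valid c) {k : ℕ} where

  dn-up : ∀ {a} → Nice c k (move c up a) → move c dn (move c up a) ≡ a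
  dn-up {a} q with prev c a in eq
  ... | just b  = cong (fromMaybe b) (⊑⇒next (valid⇒linear c!) (proj₂ (prev⇒⊑ c eq)))
  ... | nothing with () ← trans (sym eq) (Nice.prev-≡ q)

  up-dn : ∀ {a} → Nice c k (move c dn a) → move c up (move c dn a) ≡ a
  up-dn {a} q with next c a in eq
  ... | just b  = cong (fromMaybe b) (⊑⇒prev (valid⇒linear c!) (proj₂ (next⇒⊑ c eq)))
  ... | nothing with () ← trans (sym eq) (Nice.next-≡ q)

-- The common construction for both limits. `mate` tells where a jump leads from an undecorated
-- position of an initial spine: `𝓛` has no such position, and in `𝓡` the two parents of `ρ₀` are
-- mates.
module Points (B : Set) (D : ℤ → Set) (D? : Decidable D) (mate : B → ℤ → Decoration.Spine B D × ℤ) where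
  open Decoration B D using (Spine; initial; side; Decorated)

  Point : Set
  Point = Spine × ℤ

  data Spot : Set where
    at   : (s : Spine) (i : ℤ) → .(Decorated s i) → Spot
    bare : (b : B) (i : ℤ) → .(¬ D i) → Spot

  -- View s i p: the reticulation below the vertex at position i of s is p.
  data View : Spine → ℤ → Spot → Set where
    own  : ∀ {s i} .(d : Decorated s i) → View s i (at s i d)
    foot : ∀ {s i} .{d : Decorated s i} → View (side s i d) 0ℤ (at s i d)
    bare : ∀ {b i} .(nd : ¬ D i) → View (initial b) i (bare b i nd)

  view : ∀ s i → ∃ (View s i)
  view (initial b)  i with D? i
  ... | yes d = _ , own d
  ... | no nd = _ , bare nd
  view (side s j d) i with i ℤ.≟ 0ℤ
  ... | yes refl = _ , foot
  ... | no ne    = _ , own ne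

  spot : Point → Spot
  spot (s , i) = proj₁ (view s i)

  leap : ∀ {s i p} → View s i p → Point
  leap {s} {i} (own d)         = side s i d , 0ℤ
  leap (foot {s} {i})          = s , i
  leap (bare {b} {i} _)        = mate b i

  jump : Point → Point
  jump (s , i) = leap (proj₂ (view s i))

  view-≡ : ∀ {s i p q} → View s i p → View s i q → p ≡ q
  view-≡ (own _)   (own _)   = refl
  view-≡ (own d)   foot      = ⊥-elim-irr (d refl)
  view-≡ (own d)   (bare nd) = ⊥-elim-irr (nd d)
  view-≡ foot      (own d)   = ⊥-elim-irr (d refl)
  view-≡ foot      foot      = refl
  view-≡ (bare nd) (own d)   = ⊥-elim-irr (nd d)
  view-≡ (bare _)  (bare _)  = refl

  leap-≡ : ∀ {s i p q} (v : View s i p) (w : View s i q) → leap v ≡ leap w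
  leap-≡ (own _)   (own _)   = refl
  leap-≡ (own d)   foot      = ⊥-elim-irr (d refl)
  leap-≡ (own d)   (bare nd) = ⊥-elim-irr (nd d)
  leap-≡ foot      (own d)   = ⊥-elim-irr (d refl)
  leap-≡ foot      foot      = refl
  leap-≡ (bare nd) (own d)   = ⊥-elim-irr (nd d)
  leap-≡ (bare _)  (bare _)  = refl

  spot-≡ : ∀ {s i p} → View s i p → spot (s , i) ≡ p
  spot-≡ v = view-≡ (proj₂ (view _ _)) v

  jump-≡ : ∀ {s i p} (v : View s i p) → jump (s , i) ≡ leap v
  jump-≡ v = leap-≡ (proj₂ (view _ _)) v

  jump-jump : (∀ b i → .(¬ D i) → jump (mate b i) ≡ (initial b , i)) → ∀ x → jump (jump x) ≡ x
  jump-jump mate-mate (s , i) with view s i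
  ... | _ , own d          = jump-≡ (foot {s} {i} {d})
  ... | _ , foot {t} {j} = jump-≡ (own {t} {j} _)
  ... | _ , bare {b} {i} nd = mate-mate b i nd

  spot-jump : ∀ {R : Set} (f : Spot → R) → (∀ b i → .(nd : ¬ D i) → f (spot (mate b i)) ≡ f (bare b i nd)) → ∀ x → f (spot (jump x)) ≡ f (spot x)
  spot-jump f f-mate (s , i) with view s i
  ... | _ , own d          = cong f (spot-≡ (foot {s} {i} {d}))
  ... | _ , foot {t} {j} = cong f (spot-≡ (own {t} {j} _))
  ... | _ , bare {b} {i} nd = f-mate b i nd

  view-injective : ∀ {s i t j p} → View s i p → View t j p → (s , i) ≡ (t , j) ⊎ (s , i) ≡ jump (t , j)
  view-injective (own d)  (own _)  = inj₁ refl
  view-injective (own _)  w@foot    = inj₂ (sym (jump-≡ w))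
  view-injective foot     w@(own _) = inj₂ (sym (jump-≡ w))
  view-injective foot     foot     = inj₁ refl
  view-injective (bare _) (bare _) = inj₁ refl

  spot-injective : ∀ {x y} → spot x ≡ spot y → x ≡ y ⊎ x ≡ jump y
  spot-injective {s , i} {t , j} eq = view-injective (proj₂ (view s i)) (subst (View t j) (sym eq) (proj₂ (view t j)))

  act : Move → Point → Point
  act dn (s , i) = s , ℤ.suc i
  act up (s , i) = s , ℤ.pred i
  act jp x       = jump x

  act-inv : (∀ b i → .(¬ D i) → jump (mate b i) ≡ (initial b , i)) → ∀ m x → act (inv m) (act m x) ≡ x
  act-inv _ dn (s , i) = cong (s ,_) (ℤ.pred-suc i)
  act-inv _ up (s , i) = cong (s ,_) (ℤ.suc-pred i)
  act-inv h jp x       = jump-jump h x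

  module _ {n} {c : Code n} (c! : Valid c) (k : ℕ) (H₀ : B → Lab n) where

    walk : ℤ → Lab n → Lab n
    walk (pos zero)       a = a
    walk (pos (suc m))      a = move c dn (walk (pos m) a)
    walk -[1+ zero ]    a = move c up a
    walk -[1+ suc m ]   a = move c up (walk -[1+ m ] a)

    -- A side spine is entered at its position 0 through the reticulation shared with position `i`
    -- of `s`, so its letter there is the opposite parent.
    base : Spine → Lab n
    base (initial b)  = H₀ b
    base (side s i _) = other (walk i (base s))

    letter : Point → Lab n
    letter (s , i) = walk i (base s)

    letter-jump : (∀ b i → .(¬ D i) → letter (mate b i) ≡ other (letter (initial b , i))) → ∀ x → letter (jump x) ≡ other (letter x)
    letter-jump h (s , i) with view s i
    ... | _ , own d           = refl
    ... | _ , foot {t} {j}    = sym (other-other (walk j (base t)))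
    ... | _ , bare {b} {i} nd = h b i nd

    -- At nonnegative positions this is the definition of `walk`. At a negative position the letter
    -- arose by a move up, and a nice letter ensures that the move down undoes it.
    letter-dn : ∀ x → Nice c k (letter x) → letter (act dn x) ≡ move c dn (letter x)
    letter-dn (s , pos m)          q = refl
    letter-dn (s , -[1+ zero ])  q = sym (dn-up c! q)
    letter-dn (s , -[1+ suc m ]) q = sym (dn-up c! q)

    letter-up : ∀ x → Nice c k (letter x) → letter (act up x) ≡ move c up (letter x)
    letter-up (s , pos zero)    q = refl
    letter-up (s , pos (suc m))   q = sym (up-dn c! q)
    letter-up (s , -[1+ m ])  q = refl

module 𝓛-unfolding where
  open Decoration ⊤ (λ _ → ⊤) using (x; ρ; ℓ; along; x⟶ρ; w⟶ρ; ρ⟶ℓ; initial; side)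
  open MarkedGraph 𝓛.graph using (Vertex; _⟶_)
  -- Every position is decorated, so the mate is a dummy value.
  open Points ⊤ (λ _ → ⊤) (λ _ → yes tt) (λ b i → initial b , i)

  private
    mate-mate : ∀ b i → .(¬ ⊤) → jump (initial b , i) ≡ (initial b , i)
    mate-mate b i nd = ⊥-elim-irr (nd tt)

    hybˢ endˢ : Spot → Vertex
    hybˢ (at s i d)    = ρ s i d
    hybˢ (bare b i nd) = ⊥-elim-irr (nd tt)
    endˢ (at s i d)    = ℓ s i d
    endˢ (bare b i nd) = ⊥-elim-irr (nd tt)

    spine : Point → Vertex
    spine (s , i) = x s i

    hyb end : Point → Vertex
    hyb = hybˢ ∘ spot
    end = endˢ ∘ spot

    mark-hyb : ∀ p → MarkedGraph.mark 𝓛.graph (hybˢ p) ≡ reticulation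
    mark-hyb (at _ _ _)    = refl
    mark-hyb (bare _ _ nd) = ⊥-elim-irr (nd tt)

    mark-end : ∀ p → MarkedGraph.mark 𝓛.graph (endˢ p) ≡ leaf
    mark-end (at _ _ _)    = refl
    mark-end (bare _ _ nd) = ⊥-elim-irr (nd tt)

    hybˢ-injective : ∀ p q → hybˢ p ≡ hybˢ q → p ≡ q
    hybˢ-injective (at _ _ _)    (at _ _ _) refl = refl
    hybˢ-injective (bare _ _ nd) _ _ = ⊥-elim-irr (nd tt)
    hybˢ-injective _ (bare _ _ nd) _ = ⊥-elim-irr (nd tt)

    endˢ-injective : ∀ p q → endˢ p ≡ endˢ q → p ≡ q
    endˢ-injective (at _ _ _)    (at _ _ _) refl = refl
    endˢ-injective (bare _ _ nd) _ _ = ⊥-elim-irr (nd tt)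
    endˢ-injective _ (bare _ _ nd) _ = ⊥-elim-irr (nd tt)

    kinds : ∀ v → (∃ λ y → v ≡ spine y) ⊎ (∃ λ y → v ≡ hyb y) ⊎ (∃ λ y → v ≡ end y)
    kinds (x s i)   = inj₁ ((s , i) , refl)
    kinds (ρ s i d) = inj₂ (inj₁ ((s , i) , sym (cong hybˢ (spot-≡ (own {s} {i} d)))))
    kinds (ℓ s i d) = inj₂ (inj₂ ((s , i) , sym (cong endˢ (spot-≡ (own {s} {i} d)))))

    spine-hyb : ∀ {s i p} → View s i p → x s i ⟶ hybˢ p
    spine-hyb (own d)   = x⟶ρ
    spine-hyb foot      = w⟶ρ
    spine-hyb (bare nd) = ⊥-elim-irr (nd tt)

    hyb-end : ∀ p → hybˢ p ⟶ endˢ p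
    hyb-end (at s i d)    = ρ⟶ℓ
    hyb-end (bare b i nd) = ⊥-elim-irr (nd tt)

    edges : ∀ {u v} → u ⟶ v → (∃ λ y → u ≡ spine y × v ≡ spine (act dn y)) ⊎ (∃ λ y → u ≡ spine y × v ≡ hyb y)
                              ⊎ (∃ λ y → u ≡ hyb y × v ≡ end y)
    edges (along {s} {i} refl) = inj₁ ((s , i) , refl , refl)
    edges (x⟶ρ {s} {i} {d})    = inj₂ (inj₁ ((s , i) , refl , sym (cong hybˢ (spot-≡ (own {s} {i} d)))))
    edges (w⟶ρ {s} {i} {d})    = inj₂ (inj₁ ((side s i d , 0ℤ) , refl , sym (cong hybˢ (spot-≡ (foot {s} {i} {d})))))
    edges (ρ⟶ℓ {s} {i} {d})    = inj₂ (inj₂ ((s , i) , sym (cong hybˢ (spot-≡ (own {s} {i} d))) , sym (cong endˢ (spot-≡ (own {s} {i} d)))))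

  limit : Unfolding 𝓛.graph
  limit = record
    { Point = Point ; act = act ; act-inv = act-inv mate-mate ; spine = spine ; hyb = hyb ; end = end
    ; mark-node = λ _ → refl ; mark-hyb = mark-hyb ∘ spot ; mark-end = mark-end ∘ spot ; kinds = kinds
    ; node-injective = λ { refl → refl }
    ; hyb-injective = λ {y} {z} eq → spot-injective (hybˢ-injective (spot y) (spot z) eq)
    ; end-injective = λ {y} {z} eq → spot-injective (endˢ-injective (spot y) (spot z) eq)
    ; hyb-jp = spot-jump hybˢ (λ b i nd → ⊥-elim-irr (nd tt)) ; end-jp = spot-jump endˢ (λ b i nd → ⊥-elim-irr (nd tt))
    ; node-dn = λ _ → along refl ; node-hyb = λ (s , i) → spine-hyb (proj₂ (view s i)) ; hyb-end = λ y → hyb-end (spot y)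
    ; edges = edges ; locallyFinite = 𝓛.locallyFinite }

  labelling : ∀ {n} {c : Code n} (c! : Valid c) k (a : Lab n) → Labelling c k limit
  labelling c! k a = record
    { H = letter c! k (λ _ → a) ; H-jp = letter-jump c! k (λ _ → a) (λ b i nd → ⊥-elim-irr (nd tt))
    ; H-dn = letter-dn c! k (λ _ → a) ; H-up = letter-up c! k (λ _ → a) }

  p₀ : Point
  p₀ = initial tt , 0ℤ

module 𝓡-unfolding where
  open 𝓡 using (p; q; old; ρ₀; ℓ₀; to-ρ₀; to-ℓ₀)
  open 𝓡.S using (x; ρ; ℓ; along; x⟶ρ; w⟶ρ; ρ⟶ℓ; initial; side)
  open MarkedGraph 𝓡.graph using (Vertex; _⟶_)

  private
    twin : 𝓡.Name → 𝓡.Name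
    twin p = q
    twin q = p

    twin-twin : ∀ b → twin (twin b) ≡ b
    twin-twin p = refl
    twin-twin q = refl

  open Points 𝓡.Name (_≢ 0ℤ) (λ i → ¬? (i ℤ.≟ 0ℤ)) (λ b _ → initial (twin b) , 0ℤ)

  private
    ≡0 : ∀ i → .(¬ i ≢ 0ℤ) → i ≡ 0ℤ
    ≡0 i nd with i ℤ.≟ 0ℤ
    ... | yes eq = eq
    ... | no ne  = ⊥-elim-irr (nd ne)

    mate-mate : ∀ b i → .(¬ i ≢ 0ℤ) → jump (initial (twin b) , 0ℤ) ≡ (initial b , i)
    mate-mate b i nd = cong₂ (λ b i → initial b , i) (twin-twin b) (sym (≡0 i nd))

    hybˢ endˢ : Spot → Vertex
    hybˢ (at s i d)   = old (ρ s i d)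
    hybˢ (bare b i _) = ρ₀
    endˢ (at s i d)   = old (ℓ s i d)
    endˢ (bare b i _) = ℓ₀

    spine : Point → Vertex
    spine (s , i) = old (x s i)

    hyb end : Point → Vertex
    hyb = hybˢ ∘ spot
    end = endˢ ∘ spot

    mark-hyb : ∀ p → MarkedGraph.mark 𝓡.graph (hybˢ p) ≡ reticulation
    mark-hyb (at _ _ _)   = refl
    mark-hyb (bare _ _ _) = refl

    mark-end : ∀ p → MarkedGraph.mark 𝓡.graph (endˢ p) ≡ leaf
    mark-end (at _ _ _)   = refl
    mark-end (bare _ _ _) = refl

    at-foot : 𝓡.Name → Point
    at-foot b = initial b , 0ℤ

    feet : ∀ b b′ → at-foot b ≡ at-foot b′ ⊎ at-foot b ≡ jump (at-foot b′)
    feet p p = inj₁ refl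
    feet p q = inj₂ refl
    feet q p = inj₂ refl
    feet q q = inj₁ refl

    -- Equality of the reticulations at two spots. It is coarser than equality of spots, because
    -- `ρ₀` is a bare spot on each of the two initial spines.
    Same : Spot → Spot → Set
    Same (at s i d)   (at s′ i′ d′) = at s i d ≡ at s′ i′ d′
    Same (bare _ _ _) (bare _ _ _)  = ⊤
    Same _            _             = ⊥

    same-injective : ∀ {s i t j p q} → View s i p → View t j q → Same p q → (s , i) ≡ (t , j) ⊎ (s , i) ≡ jump (t , j)
    same-injective v@(own _) w@(own _) eq = view-injective v (subst (View _ _) (sym eq) w)
    same-injective v@(own _) w@foot    eq = view-injective v (subst (View _ _) (sym eq) w)
    same-injective v@foot    w@(own _) eq = view-injective v (subst (View _ _) (sym eq) w)
    same-injective v@foot    w@foot    eq = view-injective v (subst (View _ _) (sym eq) w)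
    same-injective (bare {b} {i} nd) (bare {b′} {j} nd′) _ with ≡0 i nd | ≡0 j nd′
    ... | refl | refl = feet b b′

    hybˢ-injective : ∀ p q → hybˢ p ≡ hybˢ q → Same p q
    hybˢ-injective (at _ _ _)   (at _ _ _)   refl = refl
    hybˢ-injective (bare _ _ _) (bare _ _ _) _    = tt

    endˢ-injective : ∀ p q → endˢ p ≡ endˢ q → Same p q
    endˢ-injective (at _ _ _)   (at _ _ _)   refl = refl
    endˢ-injective (bare _ _ _) (bare _ _ _) _    = tt

    kinds : ∀ v → (∃ λ y → v ≡ spine y) ⊎ (∃ λ y → v ≡ hyb y) ⊎ (∃ λ y → v ≡ end y)
    kinds (old (x s i))   = inj₁ ((s , i) , refl)
    kinds (old (ρ s i d)) = inj₂ (inj₁ ((s , i) , sym (cong hybˢ (spot-≡ (own {s} {i} d)))))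
    kinds (old (ℓ s i d)) = inj₂ (inj₂ ((s , i) , sym (cong endˢ (spot-≡ (own {s} {i} d)))))
    kinds ρ₀              = inj₂ (inj₁ ((initial p , 0ℤ) , refl))
    kinds ℓ₀              = inj₂ (inj₂ ((initial p , 0ℤ) , refl))

    spine-hyb : ∀ {s i p} → View s i p → old (x s i) ⟶ hybˢ p
    spine-hyb (own d)   = old x⟶ρ
    spine-hyb foot      = old w⟶ρ
    spine-hyb (bare {b} {i} nd) with ≡0 i nd
    ... | refl = to-ρ₀

    hyb-end : ∀ p → hybˢ p ⟶ endˢ p
    hyb-end (at s i d)   = old ρ⟶ℓ
    hyb-end (bare b i _) = to-ℓ₀

    edges : ∀ {u v} → u ⟶ v → (∃ λ y → u ≡ spine y × v ≡ spine (act dn y)) ⊎ (∃ λ y → u ≡ spine y × v ≡ hyb y)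
                              ⊎ (∃ λ y → u ≡ hyb y × v ≡ end y)
    edges (old (along {s} {i} refl)) = inj₁ ((s , i) , refl , refl)
    edges (old (x⟶ρ {s} {i} {d}))    = inj₂ (inj₁ ((s , i) , refl , sym (cong hybˢ (spot-≡ (own {s} {i} d)))))
    edges (old (w⟶ρ {s} {i} {d}))    = inj₂ (inj₁ ((side s i d , 0ℤ) , refl , sym (cong hybˢ (spot-≡ (foot {s} {i} {d})))))
    edges (old (ρ⟶ℓ {s} {i} {d}))    = inj₂ (inj₂ ((s , i) , sym (cong hybˢ (spot-≡ (own {s} {i} d))) , sym (cong endˢ (spot-≡ (own {s} {i} d)))))
    edges (to-ρ₀ {b})                = inj₂ (inj₁ ((initial b , 0ℤ) , refl , refl))
    edges to-ℓ₀                      = inj₂ (inj₂ ((initial p , 0ℤ) , refl , refl))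

  limit : Unfolding 𝓡.graph
  limit = record
    { Point = Point ; act = act ; act-inv = act-inv mate-mate ; spine = spine ; hyb = hyb ; end = end
    ; mark-node = λ _ → refl ; mark-hyb = mark-hyb ∘ spot ; mark-end = mark-end ∘ spot ; kinds = kinds
    ; node-injective = λ { refl → refl }
    ; hyb-injective = λ {y} {z} eq → same-injective (proj₂ (view _ _)) (proj₂ (view _ _)) (hybˢ-injective (spot y) (spot z) eq)
    ; end-injective = λ {y} {z} eq → same-injective (proj₂ (view _ _)) (proj₂ (view _ _)) (endˢ-injective (spot y) (spot z) eq)
    ; hyb-jp = spot-jump hybˢ (λ b i nd → refl) ; end-jp = spot-jump endˢ (λ b i nd → refl)
    ; node-dn = λ _ → old (along refl) ; node-hyb = λ (s , i) → spine-hyb (proj₂ (view s i)) ; hyb-end = λ y → hyb-end (spot y)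
    ; edges = edges ; locallyFinite = 𝓡.locallyFinite }

  private
    start-letter : ∀ {n} → Lab n → 𝓡.Name → Lab n
    start-letter a p = a
    start-letter a q = other a

    twin-letter : ∀ {n} (a : Lab n) b → start-letter a (twin b) ≡ other (start-letter a b)
    twin-letter a p = refl
    twin-letter a q = sym (other-other a)

  labelling : ∀ {n} {c : Code n} (c! : Valid c) k (a : Lab n) → Labelling c k limit
  labelling c! k a = record
    { H = letter c! k (start-letter a)
    ; H-jp = letter-jump c! k (start-letter a) mate-letter
    ; H-dn = letter-dn c! k (start-letter a) ; H-up = letter-up c! k (start-letter a) }
    where
    mate-letter : ∀ b i → .(¬ i ≢ 0ℤ) → start-letter a (twin b) ≡ other (letter c! k (start-letter a) (initial b , i))
    mate-letter b i nd with ≡0 i nd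
    ... | refl = twin-letter a b

  p₀ : Point
  p₀ = initial p , 0ℤ

module _ {c : Code n} (c! : Valid c) {M : Network n} (P : Named M c) (R : ℕ) where
  private
    k = 3 * suc (suc R)
    module M = Network M
    open Local c! P

  ball-tree : ∀ {a} → Good c k k a → ball M.graph R (via-vertex a) ≅ ball 𝓛.graph R 𝓛.p₀
  ball-tree {a} = ball-node 𝓛-unfolding.limit (𝓛-unfolding.labelling c! k a) 𝓛-unfolding.p₀ R ℕ.≤-refl

  ball-ret : ∀ {i} → Good c k k (i , false) → ball M.graph R (ret-vertex i) ≅ ball 𝓡.graph R 𝓡.ρ₀
  ball-ret {i} = ball-hyb 𝓡-unfolding.limit (𝓡-unfolding.labelling c! k (i , false)) 𝓡-unfolding.p₀ R ℕ.≤-refl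

  ball-lf : ∀ {i} → Good c k k (i , false) → ball M.graph R (lf-vertex i) ≅ ball 𝓡.graph R 𝓡.ℓ₀
  ball-lf {i} = ball-end 𝓡-unfolding.limit (𝓡-unfolding.labelling c! k (i , false)) 𝓡-unfolding.p₀ R ℕ.≤-refl

-- Counting the vertices whose neighbourhood differs from the limit

nice? : ∀ (c : Code n) k a → Dec (Nice c k a)
nice? c k a with next c a in eq | prev c a in eq′ | any? (closes? c (proj₁ a)) (words k)
... | just b  | just b′ | no none = yes record
  { after = b ; before = b′ ; next-≡ = eq ; prev-≡ = eq′ ; acyclic = λ {w} le cl → none (lose (∈-words w le) cl) }
... | nothing | _       | _ = no λ q → case trans (sym eq) (Nice.next-≡ q) of λ ()
... | just _  | nothing | _ = no λ q → case trans (sym eq′) (Nice.prev-≡ q) of λ ()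
... | just _  | just _  | yes some = no λ q → let w , w∈ , cl = find some in Nice.acyclic q {w} (words-length w∈) cl

good? : ∀ (c : Code n) k r a → Dec (Good c k r a)
good? c k r a = map′ (λ h w le → All.lookup h (∈-words w le)) (λ g → All.tabulate λ {w} w∈ → g w (words-length w∈))
  (All.all? (λ w → nice? c k (run c w a)) (words r))

letters : Code n → List (Lab n)
letters c = concatMap (λ i → (i , false) ∷ (i , true) ∷ []) (hybrids c)

∈-letters : ∀ {c : Code n} {a} → Hybrid c (proj₁ a) → a ∈ letters c
∈-letters {c = c} {i , b} h = ∈-concatMap (λ i → (i , false) ∷ (i , true) ∷ []) (∈-filter-allFin (hybrid? c) h) (which b)
  where
  which : ∀ b → (i , b) ∈ (i , false) ∷ (i , true) ∷ []
  which false = here refl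
  which true  = there (here refl)

letters-hybrid : ∀ {c : Code n} {a} → a ∈ letters c → Hybrid c (proj₁ a)
letters-hybrid {c = c} p with find (∈-concatMap⁻ (λ i → (i , false) ∷ (i , true) ∷ []) {xs = hybrids c} p)
... | i , i∈ , here refl         = filter-allFin⁻ (hybrid? c) i∈
... | i , i∈ , there (here refl) = filter-allFin⁻ (hybrid? c) i∈

letters-unique : ∀ (c : Code n) → Unique (letters c)
letters-unique c = concatMap-unique (λ i → (i , false) ∷ (i , true) ∷ []) (filter-allFin! (hybrid? c))
  (λ _ → ((λ ()) ∷ []) ∷ [] ∷ []) λ { _ _ (here refl) (here refl) → refl ; _ _ (there (here refl)) (there (here refl)) → refl
    ; _ _ (here refl) (there (here ())) ; _ _ (there (here refl)) (here ()) }

notNice : Code n → ℕ → List (Lab n)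
notNice c k = filter (¬? ∘ nice? c k) (letters c)

badLetters : Code n → ℕ → List (Lab n)
badLetters c k = filter (¬? ∘ good? c k k) (letters c)

private
  -- The labels directly above a tip or a fork; charging each to that tip or fork gives the bound in
  -- `length-ends`.
  ends : Code n → List (Lab n)
  ends (tip i)    = []
  ends (via a (via b t)) = ends (via b t)
  ends (via a t)  = a ∷ ends t
  ends (fork l r) = ends l ++ ends r

  atTop : Code n → List (Lab n)
  atTop (via a _) = a ∷ []
  atTop _         = []

  -- The labels directly below a fork, at most two for each fork. A label at the root of the code,
  -- which has no upper neighbour either, is accounted for by `atTop`.
  starts : Code n → List (Lab n)
  starts (tip i)    = []
  starts (via a t)  = starts t
  starts (fork l r) = (atTop l ++ atTop r) ++ (starts l ++ starts r)

  length-ends : ∀ (c : Code n) → length (ends c) ≤ tipCount c + forkCount c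
  length-ends (tip i) = z≤n
  length-ends (via a (tip i)) = ℕ.≤-refl
  length-ends (via a (via b t)) = length-ends (via b t)
  length-ends (via a (fork l r)) = ℕ.≤-trans (s≤s (ℕ.≤-trans (ℕ.≤-reflexive (length-++ (ends l))) (ℕ.+-mono-≤ (length-ends l) (length-ends r))))
    (ℕ.≤-reflexive (regroup (tipCount l) (forkCount l) (tipCount r) (forkCount r)))
    where
    regroup : ∀ a b c d → 1 + ((a + b) + (c + d)) ≡ (a + c) + (1 + (b + d))
    regroup = solve-∀
  length-ends (fork l r) = ℕ.≤-trans (ℕ.≤-reflexive (length-++ (ends l))) (ℕ.≤-trans (ℕ.+-mono-≤ (length-ends l) (length-ends r))
    (ℕ.≤-trans (ℕ.n≤1+n _) (ℕ.≤-reflexive (regroup (tipCount l) (forkCount l) (tipCount r) (forkCount r)))))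
    where
    regroup : ∀ a b c d → 1 + ((a + b) + (c + d)) ≡ (a + c) + (1 + (b + d))
    regroup = solve-∀

  length-atTop : ∀ (c : Code n) → length (atTop c) ≤ 1
  length-atTop (tip _)    = z≤n
  length-atTop (via _ _)  = ℕ.≤-refl
  length-atTop (fork _ _) = z≤n

  length-starts : ∀ (c : Code n) → length (starts c) ≤ forkCount c + forkCount c
  length-starts (tip i)    = z≤n
  length-starts (via a t)  = length-starts t
  length-starts (fork l r) = ℕ.≤-trans (ℕ.≤-reflexive (trans (length-++ (atTop l ++ atTop r)) (cong₂ _+_ (length-++ (atTop l)) (length-++ (starts l)))))
    (ℕ.≤-trans (ℕ.+-mono-≤ (ℕ.+-mono-≤ (length-atTop l) (length-atTop r)) (ℕ.+-mono-≤ (length-starts l) (length-starts r)))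
      (ℕ.≤-reflexive (regroup (forkCount l) (forkCount r))))
    where
    regroup : ∀ a b → (1 + 1) + ((a + a) + (b + b)) ≡ (1 + (a + b)) + (1 + (a + b))
    regroup = solve-∀

  ∈-ends : ∀ {a t} (c : Code n) → via a t ⊑ c → next c a ≡ nothing → a ∈ ends c
  ∈-ends {a = a} (via b (tip _)) p eq with a ≟ˡ b
  ... | yes refl = here refl
  ∈-ends (via b (tip _)) here eq | no ne = contradiction refl ne
  ∈-ends (via b (tip _)) (via ()) eq | no ne
  ∈-ends {a = a} (via b (via b′ t)) p eq with a ≟ˡ b
  ∈-ends (via b (via b′ t)) p () | yes refl
  ∈-ends (via b (via b′ t)) here eq | no ne = contradiction refl ne
  ∈-ends (via b (via b′ t)) (via p) eq | no ne = ∈-ends (via b′ t) p eq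
  ∈-ends {a = a} (via b (fork l r)) p eq with a ≟ˡ b
  ... | yes refl = here refl
  ∈-ends (via b (fork l r)) here eq | no ne = contradiction refl ne
  ∈-ends (via b (fork l r)) (via p) eq | no ne = there (∈-ends (fork l r) p eq)
  ∈-ends {a = a} (fork l r) p eq with next l a in eqₗ
  ∈-ends (fork l r) (left p) eq | nothing  = ∈-++⁺ˡ (∈-ends l p eqₗ)
  ∈-ends (fork l r) (right p) eq | nothing = ∈-++⁺ʳ (ends l) (∈-ends r p eq)

  ∈-starts : ∀ {a t} (c : Code n) → via a t ⊑ c → prev c a ≡ nothing → a ∈ atTop c ⊎ a ∈ starts c
  ∈-starts (via b u) here eq = inj₁ (here refl)
  ∈-starts {a = a} (via b u) (via p) eq with isTop a u in top?
  ... | false with ∈-starts u p eq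
  ...   | inj₂ q = inj₂ q
  ...   | inj₁ q = ⊥-elim (not-at-top u q top?)
    where
    not-at-top : ∀ {a : Lab _} u → a ∈ atTop u → isTop a u ≡ false → ⊥
    not-at-top {a} (via b u) (here refl) eq with () ← trans (sym (does-yes (a ≟ˡ b) refl)) eq
  ∈-starts {a = a} (fork l r) p eq with prev l a in eqₗ
  ∈-starts (fork l r) (left p) eq | nothing with ∈-starts l p eqₗ
  ... | inj₁ q = inj₂ (∈-++⁺ˡ (∈-++⁺ˡ q))
  ... | inj₂ q = inj₂ (∈-++⁺ʳ (atTop l ++ atTop r) (∈-++⁺ˡ q))
  ∈-starts (fork l r) (right p) eq | nothing with ∈-starts r p eq
  ... | inj₁ q = inj₂ (∈-++⁺ˡ (∈-++⁺ʳ (atTop l) q))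
  ... | inj₂ q = inj₂ (∈-++⁺ʳ (atTop l ++ atTop r) (∈-++⁺ʳ (starts l) q))

  onCycles : Code n → ℕ → List (Lab n)
  onCycles {n} c k = concatMap (λ i → concatMap (λ w → if does (closes? c i w) then (i , false) ∷ (i , true) ∷ [] else []) (words k)) (allFin n)

  length-onCycles : ∀ (c : Code n) k → length (onCycles c k) ≡ 2 * cycles k c
  length-onCycles {n} c k = trans (length-concatMap _ (allFin n)) (trans (∑-cong (allFin n) (λ {i} _ →
      trans (length-concatMap _ (words k)) (trans (∑-cong (words k) (λ {w} _ → each (closes? c i w))) (∑-* (words k) 2 _))))
    (∑-* (allFin n) 2 _))
    where
    each : ∀ {P : Set} (d : Dec P) {i : Fin n} → length (if does d then (i , false) ∷ (i , true) ∷ [] else []) ≡ 2 * ⟦ d ⟧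
    each (yes _) = refl
    each (no _)  = refl

  ∈-onCycles : ∀ {c : Code n} {k a w} → length w ≤ k → Closes c (proj₁ a) w → a ∈ onCycles c k
  ∈-onCycles {c = c} {k} {i , b} {w} le cl = ∈-concatMap _ (∈-allFin i) (∈-concatMap _ (∈-words w le) (found (closes? c i w) b))
    where
    found : ∀ (d : Dec (Closes c i w)) b → (i , b) ∈ (if does d then (i , false) ∷ (i , true) ∷ [] else [])
    found (yes _) false = here refl
    found (yes _) true  = there (here refl)
    found (no ¬cl) _    = contradiction cl ¬cl

-- A letter fails to be nice for want of a label below it, for want of a label above it, or because
-- of a short cycle. With m tips and m - 1 forks the first two cases contribute at most 2 m - 1 and
-- 1 + 2 (m - 1) letters, and each cycle contributes both parents of its reticulation.
length-notNice : ∀ {c : Code n} → Valid c → ∀ k → length (notNice c k) ≤ 4 * tipCount c + 2 * cycles k c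
length-notNice {c = c} c! k = begin
  length (notNice c k)                                       ≤⟨ ⊆⇒length≤ (Unique.filter⁺ (¬? ∘ nice? c k) (letters-unique c)) classify ⟩
  length ((ends c ++ (atTop c ++ starts c)) ++ onCycles c k) ≡⟨ trans (length-++ (ends c ++ (atTop c ++ starts c))) (cong₂ _+_ (trans (length-++ (ends c)) (cong (length (ends c) +_) (length-++ (atTop c)))) (length-onCycles c k)) ⟩
  (length (ends c) + (length (atTop c) + length (starts c))) + 2 * cycles k c
    ≤⟨ ℕ.+-monoˡ-≤ (2 * cycles k c) (ℕ.+-mono-≤ (length-ends c) (ℕ.+-mono-≤ (length-atTop c) (length-starts c))) ⟩
  ((tipCount c + forkCount c) + (1 + (forkCount c + forkCount c))) + 2 * cycles k c
    ≤⟨ ℕ.+-monoˡ-≤ (2 * cycles k c) (ℕ.≤-trans (ℕ.m≤n+m _ 2) (ℕ.≤-reflexive (trans (regroup (tipCount c) (forkCount c)) (sum4 (tips≡forks+1 c))))) ⟩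
  4 * tipCount c + 2 * cycles k c ∎
  where
  open ℕ.≤-Reasoning
  regroup : ∀ t f → 2 + ((t + f) + (1 + (f + f))) ≡ t + ((1 + f) + ((1 + f) + (1 + f)))
  regroup = solve-∀
  sum4 : ∀ {t f} → t ≡ suc f → t + ((1 + f) + ((1 + f) + (1 + f))) ≡ 4 * t
  sum4 {f = f} refl = four f
    where
    four : ∀ f → suc f + ((1 + f) + ((1 + f) + (1 + f))) ≡ 4 * suc f
    four = solve-∀
  classify : ∀ {a} → a ∈ notNice c k → a ∈ (ends c ++ (atTop c ++ starts c)) ++ onCycles c k
  classify {a} p with ∈-filter⁻ (¬? ∘ nice? c k) {xs = letters c} p
  ... | a∈ , ¬nice with hybrid⇒via c! (letters-hybrid {c = c} a∈) (proj₂ a)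
  ... | t , q with next c a in eq | prev c a in eq′ | any? (closes? c (proj₁ a)) (words k)
  ... | nothing | _       | _ = ∈-++⁺ˡ (∈-++⁺ˡ (∈-ends c q eq))
  ... | just _  | nothing | _ = ∈-++⁺ˡ (∈-++⁺ʳ (ends c) ([ ∈-++⁺ˡ , ∈-++⁺ʳ (atTop c) ]′ (∈-starts c q eq′)))
  ... | just _  | just _  | yes some = let w , w∈ , cl = find some in ∈-++⁺ʳ (ends c ++ (atTop c ++ starts c)) (∈-onCycles {a = a} {w} (words-length w∈) cl)
  ... | just b  | just b′ | no none = contradiction (record
    { after = b ; before = b′ ; next-≡ = eq ; prev-≡ = eq′ ; acyclic = λ {w} le cl → none (lose (∈-words w le) cl) }) ¬nice

private
  -- A walk from a leading to a letter that is not nice can be followed backwards up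
  -- to its first such letter.
  backtrack : ∀ {c : Code n} {k} → Valid c → ∀ w {a} → Hybrid c (proj₁ a) → ¬ Nice c k (run c w a) →
              ∃ λ w′ → ∃ λ z → length w′ ≤ length w × Hybrid c (proj₁ z) × ¬ Nice c k z × a ≡ run c w′ z
  backtrack {c = c} {k} c! w {a} h ¬q with nice? c k a
  ... | no ¬p = [] , a , z≤n , h , ¬p , refl
  backtrack c! [] h ¬q | yes p = contradiction p ¬q
  backtrack {c = c} {k} c! (m ∷ w) {a} h ¬q | yes p with backtrack c! w {move c m a} (present m) ¬q
    where
    present : ∀ m → Hybrid c (proj₁ (move c m a))
    present jp = h
    present dn rewrite Nice.next-≡ p = via⇒hybrid c! (⊑-trans (via here) (proj₂ (next⇒⊑ c (Nice.next-≡ p))))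
    present up rewrite Nice.prev-≡ p = via⇒hybrid c! (proj₂ (prev⇒⊑ c (Nice.prev-≡ p)))
  ... | w′ , z , le , hz , ¬pz , eq = w′ ++ inv m ∷ [] , z ,
    ℕ.≤-trans (ℕ.≤-reflexive (trans (length-++ w′) (ℕ.+-comm (length w′) 1))) (s≤s le) , hz , ¬pz ,
    trans (sym (move-inv c! m p)) (trans (cong (move c (inv m)) eq) (sym (run-++ c w′ (inv m ∷ []) z)))

-- By `backtrack` every bad letter is the end of a short walk from a letter that is not nice, so it
-- can be charged to this walk and this letter.
length-badLetters : ∀ {c : Code n} → Valid c → ∀ k → length (badLetters c k) ≤ length (words k) * length (notNice c k)
length-badLetters {c = c} c! k = begin
  length (badLetters c k)                                           ≤⟨ ⊆⇒length≤ (Unique.filter⁺ (¬? ∘ good? c k k) (letters-unique c)) from-bad ⟩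
  length (concatMap (λ w → map (run c w) (notNice c k)) (words k))  ≡⟨ length-concatMap (λ w → map (run c w) (notNice c k)) (words k) ⟩
  ∑ (words k) (λ w → length (map (run c w) (notNice c k)))          ≡⟨ ∑-cong (words k) (λ {w} _ → length-map (run c w) (notNice c k)) ⟩
  ∑ (words k) (λ _ → length (notNice c k))                          ≡⟨ ∑-const (words k) _ ⟩
  length (words k) * length (notNice c k)                           ∎
  where
  open ℕ.≤-Reasoning
  from-bad : ∀ {a} → a ∈ badLetters c k → a ∈ concatMap (λ w → map (run c w) (notNice c k)) (words k)
  from-bad {a} p with ∈-filter⁻ (¬? ∘ good? c k k) {xs = letters c} p
  ... | a∈ , ¬good with any? (λ w → ¬? (nice? c k (run c w a))) (words k)
  ... | no none = contradiction (λ w le → decidable-stable (nice? c k (run c w a)) λ ¬q → none (lose (∈-words w le) ¬q)) ¬good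
  ... | yes some with find some
  ... | w , w∈ , ¬q with backtrack c! w (letters-hybrid {c = c} a∈) ¬q
  ... | w′ , z , le , hz , ¬pz , refl = ∈-concatMap (λ w → map (run c w) (notNice c k)) (∈-words w′ (ℕ.≤-trans le (words-length w∈)))
          (∈-map⁺ (run c w′) (∈-filter⁺ (¬? ∘ nice? c k) (∈-letters {c = c} hz) ¬pz))

-- Exceptional vertices of a network

private
  nonvia : Code n → List (Code n)
  nonvia t@(tip _)    = t ∷ []
  nonvia (via a t)    = nonvia t
  nonvia t@(fork l r) = t ∷ nonvia l ++ nonvia r

  length-nonvia : ∀ (c : Code n) → length (nonvia c) ≤ 2 * tipCount c
  length-nonvia (tip i)    = s≤s z≤n
  length-nonvia (via a t)  = length-nonvia t
  length-nonvia (fork l r) = ℕ.<⇒≤ (ℕ.≤-trans (ℕ.≤-reflexive (cong (2 +_) (trans (length-++ (nonvia l)) (cong₂ _+_ (count l) (count r)))))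
    (ℕ.≤-reflexive (combine (tips≡forks+1 l) (tips≡forks+1 r))))
    where
    count : ∀ (c : Code _) → length (nonvia c) ≡ tipCount c + forkCount c
    count (tip i)    = refl
    count (via a t)  = count t
    count (fork l r) = trans (cong suc (trans (length-++ (nonvia l)) (cong₂ _+_ (count l) (count r)))) (regroup (tipCount l) (forkCount l) (tipCount r) (forkCount r))
      where
      regroup : ∀ a b c d → 1 + ((a + b) + (c + d)) ≡ (a + c) + (1 + (b + d))
      regroup = solve-∀
    combine : ∀ {a b x y} → a ≡ suc x → b ≡ suc y → 2 + ((a + x) + (b + y)) ≡ 2 * (a + b)
    combine {x = x} {y} refl refl = four x y
      where
      four : ∀ x y → 2 + ((suc x + x) + (suc y + y)) ≡ 2 * (suc x + suc y)
      four = solve-∀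

  ∈-nonvia-tip : ∀ {i} {c : Code n} → tip i ⊑ c → tip i ∈ nonvia c
  ∈-nonvia-tip here = here refl
  ∈-nonvia-tip (via p) = ∈-nonvia-tip p
  ∈-nonvia-tip (left p) = there (∈-++⁺ˡ (∈-nonvia-tip p))
  ∈-nonvia-tip (right {l = l} p) = there (∈-++⁺ʳ (nonvia l) (∈-nonvia-tip p))

  ∈-nonvia-fork : ∀ {l r} {c : Code n} → fork l r ⊑ c → fork l r ∈ nonvia c
  ∈-nonvia-fork here = here refl
  ∈-nonvia-fork (via p) = ∈-nonvia-fork p
  ∈-nonvia-fork (left p) = there (∈-++⁺ˡ (∈-nonvia-fork p))
  ∈-nonvia-fork (right {l = l} p) = there (∈-++⁺ʳ (nonvia l) (∈-nonvia-fork p))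

-- Tips and forks are exceptional outright. A bad letter may spoil its tree vertex, the reticulation
-- below it and the leaf of that reticulation, whence the factor 3.
badness : ℕ → Code n → ℕ
badness k c = length (nonvia c) + 3 * length (badLetters c k)

badness-≤ : ∀ {c : Code n} → Valid c → ∀ k →
  badness k c ≤ 2 * tipCount c + 3 * (length (words k) * (4 * tipCount c + 2 * cycles k c))
badness-≤ {c = c} c! k = ℕ.+-mono-≤ (length-nonvia c) (ℕ.*-monoʳ-≤ 3
  (ℕ.≤-trans (length-badLetters c! k) (ℕ.*-monoʳ-≤ (length (words k)) (length-notNice c! k))))

data Kind : Mark → Set where
  tree         : Kind tree
  reticulation : Kind reticulation
  leaf         : Kind leaf

limitBall : ∀ {m} → Kind m → ℕ → RootedGraph
limitBall tree         R = ball 𝓛.graph R 𝓛.p₀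
limitBall reticulation R = ball 𝓡.graph R 𝓡.ρ₀
limitBall leaf         R = ball 𝓡.graph R 𝓡.ℓ₀

module _ {c : Code n} (c! : Valid c) {M : Network n} (P : Named M c) where
  private
    module M = Network M
    module P = Named P
    open Local c! P

  private
    node⁻ : ∀ {t} → c ∋ node t → t ⊑ c
    node⁻ (node q) = q

    via-at : ∀ {u a t} → P.name u ≡ node (via a t) → via-vertex a ≡ u
    via-at {u} eq = P.injective (trans (name-via (node⁻ (subst (c ∋_) eq (P.member u)))) (sym eq))

    ret-at : ∀ {u i} → P.name u ≡ ret i → Hybrid c i → ret-vertex i ≡ u
    ret-at eq h = P.injective (trans (name-ret h) (sym eq))

    lf-at : ∀ {u i} → P.name u ≡ lf i → Hybrid c i → lf-vertex i ≡ u
    lf-at eq h = P.injective (trans (name-lf h) (sym eq))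

  module _ (R : ℕ) where
    private
      k = 3 * suc (suc R)

      badNames : List (Name n)
      badNames = map node (nonvia c) ++ (map (P.name ∘ via-vertex) (badLetters c k)
        ++ (map (ret ∘ proj₁) (badLetters c k) ++ map (lf ∘ proj₁) (badLetters c k)))

      length-badNames : length badNames ≡ badness k c
      length-badNames = trans (length-++ (map node (nonvia c))) (cong₂ _+_ (length-map node (nonvia c))
        (trans (length-++ (map (P.name ∘ via-vertex) (badLetters c k))) (cong₂ _+_ (length-map _ (badLetters c k))
        (trans (length-++ (map (ret ∘ proj₁) (badLetters c k))) (cong₂ _+_ (length-map _ (badLetters c k))
          (trans (length-map _ (badLetters c k)) (sym (ℕ.+-identityʳ _))))))))

      bad : ∀ {a} → Hybrid c (proj₁ a) → ¬ Good c k k a → a ∈ badLetters c k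
      bad h ¬g = ∈-filter⁺ (¬? ∘ good? c k k) (∈-letters {c = c} h) ¬g

      bad-via : ∀ {a} → a ∈ badLetters c k → P.name (via-vertex a) ∈ badNames
      bad-via a∈ = ∈-++⁺ʳ (map node (nonvia c)) (∈-++⁺ˡ (∈-map⁺ (P.name ∘ via-vertex) a∈))

      bad-ret : ∀ {i} → (i , false) ∈ badLetters c k → ret i ∈ badNames
      bad-ret a∈ = ∈-++⁺ʳ (map node (nonvia c)) (∈-++⁺ʳ (map (P.name ∘ via-vertex) (badLetters c k))
        (∈-++⁺ˡ (∈-map⁺ (ret ∘ proj₁) a∈)))

      bad-lf : ∀ {i} → (i , false) ∈ badLetters c k → lf i ∈ badNames
      bad-lf a∈ = ∈-++⁺ʳ (map node (nonvia c)) (∈-++⁺ʳ (map (P.name ∘ via-vertex) (badLetters c k))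
        (∈-++⁺ʳ (map (ret ∘ proj₁) (badLetters c k)) (∈-map⁺ (lf ∘ proj₁) a∈)))

      bad-name : ∀ {m} (κ : Kind m) {u} → M.mark u ≡ m → ¬ (ball M.graph R u ≅ limitBall κ R) → P.name u ∈ badNames
      bad-name κ {u} eq ¬≅ = go κ refl (P.member u) (trans (sym (P.mark-≡ u)) eq) ¬≅
        where
        go : ∀ {m} (κ : Kind m) {x} → P.name u ≡ x → c ∋ x → nameMark x ≡ m → ¬ (ball M.graph R u ≅ limitBall κ R) →
             P.name u ∈ badNames
        go tree         eq orig ()
        go reticulation eq orig ()
        go leaf         eq orig ()
        go κ eq (node {tip i} q) _ ¬≅ = subst (_∈ badNames) (sym eq) (∈-++⁺ˡ (∈-map⁺ node (∈-nonvia-tip q)))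
        go κ eq (node {fork l r} q) _ ¬≅ = subst (_∈ badNames) (sym eq) (∈-++⁺ˡ (∈-map⁺ node (∈-nonvia-fork q)))
        go tree eq (node {via a t} q) _ ¬≅ = subst (_∈ badNames) (cong P.name (via-at eq))
          (bad-via (bad (via⇒hybrid c! q) λ g → ¬≅ (subst (λ v → ball M.graph R v ≅ limitBall tree R) (via-at eq) (ball-tree c! P R g))))
        go reticulation eq (node {via a t} q) ()
        go leaf eq (node {via a t} q) ()
        go reticulation eq (ret h) _ ¬≅ = subst (_∈ badNames) (sym eq)
          (bad-ret (bad h λ g → ¬≅ (subst (λ v → ball M.graph R v ≅ limitBall reticulation R) (ret-at eq h) (ball-ret c! P R g))))
        go tree eq (ret h) ()
        go leaf eq (ret h) ()
        go leaf eq (lf h) _ ¬≅ = subst (_∈ badNames) (sym eq)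
          (bad-lf (bad h λ g → ¬≅ (subst (λ v → ball M.graph R v ≅ limitBall leaf R) (lf-at eq h) (ball-lf c! P R g))))
        go tree eq (lf h) ()
        go reticulation eq (lf h) ()

    few-bad : ∀ {m} (κ : Kind m) {us} → Unique us → (∀ {u} → u ∈ us → M.mark u ≡ m × ¬ (ball M.graph R u ≅ limitBall κ R)) →
              length us ≤ badness k c
    few-bad κ us! h = ℕ.≤-trans (injection⇒length≤ P.name us! (λ u∈ → let m , ¬≅ = h u∈ in bad-name κ m ¬≅) (λ _ _ → P.injective))
      (ℕ.≤-reflexive length-badNames)

  -- Every reticulation label provides a vertex of each of the three kinds, so no denominator is
  -- smaller than n minus the number of tips.
  many : ∀ {m} → Kind m → n ≤ tipCount c + # (λ u → M.mark u ≟ᵐ m)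
  many {m} κ = begin
    n                                          ≡⟨ sym (hybrids+tips c!) ⟩
    length (hybrids c) + tipCount c            ≡⟨ ℕ.+-comm _ (tipCount c) ⟩
    tipCount c + length (hybrids c)            ≤⟨ ℕ.+-monoʳ-≤ (tipCount c) (injection⇒length≤ (pick κ) (filter-allFin! (hybrid? c))
                                                    (λ i∈ → ∈-filter-allFin (λ u → M.mark u ≟ᵐ m) (pick-mark κ (filter-allFin⁻ (hybrid? c) i∈)))
                                                    (λ i∈ j∈ → pick-injective κ (filter-allFin⁻ (hybrid? c) i∈) (filter-allFin⁻ (hybrid? c) j∈))) ⟩
    tipCount c + length (filter (λ u → M.mark u ≟ᵐ m) (allFin M.size)) ≡⟨ cong (tipCount c +_) (sym (#-filter (λ u → M.mark u ≟ᵐ m))) ⟩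
    tipCount c + # (λ u → M.mark u ≟ᵐ m)       ∎
    where
    open ℕ.≤-Reasoning
    pick : ∀ {m} → Kind m → Fin n → M.Vertex
    pick tree i         = via-vertex (i , false)
    pick reticulation i = ret-vertex i
    pick leaf i         = lf-vertex i
    pick-mark : ∀ {m} (κ : Kind m) {i} → Hybrid c i → M.mark (pick κ i) ≡ m
    pick-mark tree h         = trans (P.mark-≡ _) (cong nameMark (name-via (proj₂ (hybrid⇒via c! h false))))
    pick-mark reticulation h = trans (P.mark-≡ _) (cong nameMark (name-ret h))
    pick-mark leaf h         = trans (P.mark-≡ _) (cong nameMark (name-lf h))
    pick-injective : ∀ {m} (κ : Kind m) {i j} → Hybrid c i → Hybrid c j → pick κ i ≡ pick κ j → i ≡ j
    pick-injective tree h h′ eq = label-≡ (trans (sym (name-via (proj₂ (hybrid⇒via c! h false)))) (trans (cong P.name eq) (name-via (proj₂ (hybrid⇒via c! h′ false)))))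
      where
      label-≡ : ∀ {i j b b′ s t} → Name.node {n} (via (i , b) s) ≡ node (via (j , b′) t) → i ≡ j
      label-≡ refl = refl
    pick-injective reticulation h h′ eq with trans (sym (name-ret h)) (trans (cong P.name eq) (name-ret h′))
    ... | refl = refl
    pick-injective leaf h h′ eq with trans (sym (name-lf h)) (trans (cong P.name eq) (name-lf h′))
    ... | refl = refl

-- Proportions and probabilities

private
  frac : ℕ → ℕ → ℚ
  frac a k = pos a ℚ./ suc k

  frac-≃ : ∀ a k → toℚᵘ (frac a k) ℚᵘ.≃ mkℚᵘ (pos a) k
  frac-≃ a k = ℚ.toℚᵘ-fromℚᵘ (mkℚᵘ (pos a) k)

  frac-+ : ∀ {a b c} k → a + b ≡ c → frac a k ℚ.+ frac b k ≡ frac c k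
  frac-+ {a} {b} k refl = ℚ.toℚᵘ-injective (begin-equality
    toℚᵘ (frac a k ℚ.+ frac b k)            ≃⟨ ℚ.toℚᵘ-homo-+ (frac a k) (frac b k) ⟩
    toℚᵘ (frac a k) ℚᵘ.+ toℚᵘ (frac b k)    ≃⟨ ℚᵘ.+-cong (frac-≃ a k) (frac-≃ b k) ⟩
    mkℚᵘ (pos a) k ℚᵘ.+ mkℚᵘ (pos b) k          ≃⟨ *≡* (common (pos a) (pos b) (pos (suc k))) ⟩
    mkℚᵘ (pos (a + b)) k                      ≃⟨ ℚᵘ.≃-sym (frac-≃ (a + b) k) ⟩
    toℚᵘ (frac (a + b) k)                   ∎)
    where
    open ℚᵘ.≤-Reasoning
    common : ∀ x y z → (x ℤ.* z ℤ.+ y ℤ.* z) ℤ.* z ≡ (x ℤ.+ y) ℤ.* (z ℤ.* z)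
    common = ℤ-Solver.solve-∀

  frac-1 : ∀ k → frac (suc k) k ≡ 1ℚ
  frac-1 k = ℚ.toℚᵘ-injective (ℚᵘ.≃-trans (frac-≃ (suc k) k) (*≡* (ℤ.*-comm (pos (suc k)) (pos 1))))

  ∣frac∣ : ∀ a k → ∣ frac a k ∣ ≡ frac a k
  ∣frac∣ a k = ℚ.0≤p⇒∣p∣≡p (ℚ.nonNegative⁻¹ (frac a k) {{ℚ.normalize-nonNeg a (suc k)}})

  from-one : ∀ {a b} k → a + b ≡ suc k → ∣ frac a k ℚ.- 1ℚ ∣ ≡ frac b k
  from-one {a} {b} k eq = trans (cong ∣_∣ minus) (trans (ℚ.∣-p∣≡∣p∣ (frac b k)) (∣frac∣ b k))
    where
    open ≡-Reasoning
    minus : frac a k ℚ.- 1ℚ ≡ ℚ.- frac b k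
    minus = begin
      frac a k ℚ.- 1ℚ                                   ≡⟨ cong (λ q → frac a k ℚ.- q) (sym (trans (frac-+ {a} {b} k eq) (frac-1 k))) ⟩
      frac a k ℚ.- (frac a k ℚ.+ frac b k)              ≡⟨ cong (frac a k ℚ.+_) (ℚ.neg-distrib-+ (frac a k) (frac b k)) ⟩
      frac a k ℚ.+ (ℚ.- frac a k ℚ.+ ℚ.- frac b k)      ≡⟨ sym (ℚ.+-assoc (frac a k) (ℚ.- frac a k) _) ⟩
      (frac a k ℚ.- frac a k) ℚ.+ ℚ.- frac b k          ≡⟨ cong (ℚ._+ ℚ.- frac b k) (ℚ.+-inverseʳ (frac a k)) ⟩
      0ℚ ℚ.+ ℚ.- frac b k                               ≡⟨ ℚ.+-identityˡ _ ⟩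
      ℚ.- frac b k                                      ∎

  from-zero : ∀ a k → ∣ frac a k ℚ.- 0ℚ ∣ ≡ frac a k
  from-zero a k = trans (cong ∣_∣ (ℚ.+-identityʳ (frac a k))) (∣frac∣ a k)

  -- The denominator of ϵ bounds 1 / ϵ.
  above : ∀ ϵ → 0ℚ ℚ.< ϵ → ∃ λ e → ∀ b k → ϵ ℚ.< frac b k → suc k ≤ e * b
  above (mkℚ (pos zero) q _) (ℚ.*<* (ℤ.+<+ ()))
  above (mkℚ -[1+ p ] q _) (ℚ.*<* ())
  above ϵ@(mkℚ (pos (suc p)) q _) _ = suc q , λ b k lt → bound b k (ℚᵘ.<-respʳ-≃ (frac-≃ b k) (ℚ.toℚᵘ-mono-< lt))
    where
    bound : ∀ b k → mkℚᵘ (pos (suc p)) q ℚᵘ.< mkℚᵘ (pos b) k → suc k ≤ suc q * b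
    bound b k (*<* lt) = ℕ.≤-trans (ℕ.m≤m+n (suc k) (p * suc k)) (ℕ.≤-trans
      (ℕ.<⇒≤ (ℤ.drop‿+<+ (subst₂ ℤ._<_ (sym (ℤ.pos-* (suc p) (suc k))) (sym (ℤ.pos-* b (suc q))) lt)))
      (ℕ.≤-reflexive (ℕ.*-comm b (suc q))))

  -- As for `above`, the witness `d` is the denominator: `δ` is at least 1 / d.
  below-δ : ∀ δ → 0ℚ ℚ.< δ → ∃ λ d → 1 ≤ d × ∀ a t → d * a ≤ t → ratio a t ℚ.≤ δ
  below-δ (mkℚ (pos zero) q _) (ℚ.*<* (ℤ.+<+ ()))
  below-δ (mkℚ -[1+ p ] q _) (ℚ.*<* ())
  below-δ δ@(mkℚ (pos (suc p)) q _) 0<δ = suc q , s≤s z≤n , bound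
    where
    bound : ∀ a t → suc q * a ≤ t → ratio a t ℚ.≤ δ
    bound a zero    le = ℚ.<⇒≤ 0<δ
    bound a (suc t) le = ℚ.toℚᵘ-cancel-≤ (ℚᵘ.≤-respˡ-≃ (ℚᵘ.≃-sym (frac-≃ a t)) (*≤* (subst₂ ℤ._≤_ (ℤ.pos-* a (suc q)) (ℤ.pos-* (suc p) (suc t))
      (ℤ.+≤+ (ℕ.≤-trans (ℕ.≤-reflexive (ℕ.*-comm a (suc q))) (ℕ.≤-trans le (ℕ.m≤m+n (suc t) (p * suc t))))))))

  -- The limit is 0 or 1, so the deviation is again a fraction with denominator `k`. Its numerator
  -- counts the vertices not matching `G` if the limit is 1 and those matching it if the limit is 0;
  -- in both cases these differ from the limit and are exceptional.
  deviation : ∀ {ϵ e} → (∀ b k → ϵ ℚ.< frac b k → suc k ≤ e * b) → ∀ {A : Set} (A? : Dec A) {a k b} →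
    (A → ∃ λ r → a + r ≡ k × r ≤ b) → (¬ A → a ≤ b) → ϵ ℚ.< ∣ ratio a k ℚ.- 𝟙 A? ∣ → k ≤ e * b
  deviation h A? {k = zero} _ _ _ = z≤n
  deviation {e = e} h (yes p) {a} {suc k} if _ lt with if p
  ... | r , eq , le = ℕ.≤-trans (h r k (subst (_ ℚ.<_) (from-one {a} {r} k eq) lt)) (ℕ.*-monoʳ-≤ e le)
  deviation {e = e} h (no ¬p) {a} {suc k} _ otherwise lt =
    ℕ.≤-trans (h a k (subst (_ ℚ.<_) (from-zero a k) lt)) (ℕ.*-monoʳ-≤ e (otherwise ¬p))

limit? : ∀ {m} (κ : Kind m) R (G : FiniteGraph) → Dec (limitBall κ R ≅ FiniteGraph.rooted G)
limit? tree         R G = ball≅? 𝓛.locallyFinite R 𝓛.p₀ G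
limit? reticulation R G = ball≅? 𝓡.locallyFinite R 𝓡.ρ₀ G
limit? leaf         R G = ball≅? 𝓡.locallyFinite R 𝓡.ℓ₀ G

module _ {c : Code n} (c! : Valid c) {M : Network n} (P : Named M c) {m : Mark} (κ : Kind m) (R : ℕ) (G : FiniteGraph) where
  private
    open Network M using (mark; graph; locallyFinite) renaming (size to order)
    k = 3 * suc (suc R)

    m? : ∀ u → Dec (mark u ≡ m)
    m? u = mark u ≟ᵐ m

    G? : ∀ u → Dec (ball graph R u ≅ FiniteGraph.rooted G)
    G? u = ball≅? locallyFinite R u G

    split : # (λ u → m? u ×-dec G? u) + length (filter (λ u → m? u ×-dec ¬? (G? u)) (allFin order)) ≡ # m?
    split = trans (cong₂ _+_ (trans (#-filter (λ u → m? u ×-dec G? u)) (length-filter _ (allFin order))) (length-filter _ (allFin order)))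
      (trans (sym (∑-+ (allFin order) _ _)) (trans (∑-cong (allFin order) (λ {u} _ → each (m? u) (G? u)))
        (sym (trans (#-filter m?) (length-filter m? (allFin order))))))
      where
      each : ∀ {A B : Set} (a? : Dec A) (b? : Dec B) → ⟦ a? ×-dec b? ⟧ + ⟦ a? ×-dec ¬? b? ⟧ ≡ ⟦ a? ⟧
      each (yes _) (yes _) = refl
      each (yes _) (no _)  = refl
      each (no _)  _       = refl

  -- A large deviation bounds the denominator by `e` times the number of exceptional vertices, and
  -- by `many` the denominator is almost n. The resulting inequality refers to the code alone, which
  -- is the form that `transfer` requires.
  deviant : ∀ {ϵ e} → (∀ b k → ϵ ℚ.< frac b k → suc k ≤ e * b) →
            ϵ ℚ.< ∣ proportion m R G M ℚ.- 𝟙 (limit? κ R G) ∣ → n ≤ tipCount c + e * badness k c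
  deviant {e = e} h lt = ℕ.≤-trans (many c! P κ) (ℕ.+-monoʳ-≤ (tipCount c) (deviation {e = e} h (limit? κ R G)
    (λ φ → _ , split , few-bad c! P R κ (filter-allFin! (λ u → m? u ×-dec ¬? (G? u)))
      (λ u∈ → let eq , ¬≅ = filter-allFin⁻ (λ u → m? u ×-dec ¬? (G? u)) u∈ in eq , λ ψ → ¬≅ (≅-trans ψ φ)))
    (λ ¬φ → ℕ.≤-trans (ℕ.≤-reflexive (#-filter (λ u → m? u ×-dec G? u)))
      (few-bad c! P R κ (filter-allFin! (λ u → m? u ×-dec G? u))
        (λ u∈ → let eq , φ = filter-allFin⁻ (λ u → m? u ×-dec G? u) u∈ in eq , λ ψ → ¬φ (≅-trans (≅-sym ψ) φ))))
    lt))

-- The probability of a large deviation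

private
  -- With K = 4 A d the bounds on the sums St of tips give K n ev ≤ 4 A n l.
  arithmetic : ∀ {n d l ev St A B} → 1 ≤ A → 1 ≤ d → 1 ≤ n → n * ev ≤ A * St + B * l →
    4 * (A * d) * St ≤ n * (l + l) + l * 2 ^ (4 * (A * d)) → A * 2 ^ (4 * (A * d)) + 4 * (A * d) * B ≤ n → d * ev ≤ l
  arithmetic {suc n} {suc d} {l} {ev} {St} {suc A} {B} _ _ _ h₁ h₂ h₃ = ℕ.*-cancelˡ-≤ (4 * (suc A * suc n)) (begin
    4 * (suc A * suc n) * (suc d * ev)                   ≡⟨ e₁ (suc A) (suc n) (suc d) ev ⟩
    K * (suc n * ev)                                     ≤⟨ ℕ.*-monoʳ-≤ K h₁ ⟩
    K * (suc A * St + B * l)                             ≡⟨ e₂ K (suc A) St B l ⟩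
    suc A * (K * St) + K * B * l                         ≤⟨ ℕ.+-monoˡ-≤ (K * B * l) (ℕ.*-monoʳ-≤ (suc A) h₂) ⟩
    suc A * (suc n * (l + l) + l * P) + K * B * l        ≡⟨ e₃ (suc A) (suc n) l P (K * B) ⟩
    (2 * (suc A * suc n)) * l + (suc A * P + K * B) * l  ≤⟨ ℕ.+-monoʳ-≤ (2 * (suc A * suc n) * l) (ℕ.*-monoˡ-≤ l (ℕ.≤-trans h₃ (ℕ.≤-trans (ℕ.m≤m+n (suc n) (A * suc n)) (ℕ.m≤m+n (suc A * suc n) (suc A * suc n))))) ⟩
    (2 * (suc A * suc n)) * l + (suc A * suc n + suc A * suc n) * l ≡⟨ e₄ (suc A * suc n) l ⟩
    4 * (suc A * suc n) * l                              ∎)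
    where
    open ℕ.≤-Reasoning
    K = 4 * (suc A * suc d)
    P = 2 ^ K
    e₁ : ∀ a n d v → 4 * (a * n) * (d * v) ≡ 4 * (a * d) * (n * v)
    e₁ = solve-∀
    e₂ : ∀ k a s b l → k * (a * s + b * l) ≡ a * (k * s) + k * b * l
    e₂ = solve-∀
    e₃ : ∀ a n l p q → a * (n * (l + l) + l * p) + q * l ≡ (2 * (a * n)) * l + (a * p + q) * l
    e₃ = solve-∀
    e₄ : ∀ x l → (2 * x) * l + (x + x) * l ≡ 4 * x * l
    e₄ = solve-∀

module _ (R e d : ℕ) (1≤d : 1 ≤ d) where
  private
    k W α β γ ϑ : ℕ
    k = 3 * suc (suc R)
    W = length (words k)
    -- `α` and `β` are the coefficients of the tips and of the cycles in `exceptional-≤`. Bounding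
    -- the cycles by `∑-cycles` adds `β * W` to the former, which gives `γ`, and leaves the constant
    -- `ϑ` per code.
    α = suc (e * (2 + 12 * W))
    β = e * (6 * W)
    γ = α + β * W
    ϑ = β * (W * (2 + k))

    exceptional : Code n → ℕ
    exceptional c = tipCount c + e * badness k c

    exceptional-≤ : ∀ {c : Code n} → Valid c → exceptional c ≤ α * tipCount c + β * cycles k c
    exceptional-≤ {c = c} c! = ℕ.≤-trans (ℕ.+-monoʳ-≤ (tipCount c) (ℕ.*-monoʳ-≤ e (badness-≤ c! k)))
      (ℕ.≤-reflexive (expand e W (tipCount c) (cycles k c)))
      where
      expand : ∀ e w t y → t + e * (2 * t + 3 * (w * (4 * t + 2 * y))) ≡ suc (e * (2 + 12 * w)) * t + e * (6 * w) * y
      expand = solve-∀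

  -- The threshold of `arithmetic` for `A = γ` and `B = ϑ`, increased by one so that n is positive
  -- and can be cancelled.
  n₀ : ℕ
  n₀ = suc (γ * 2 ^ (4 * (γ * d)) + 4 * (γ * d) * ϑ)

  -- Markov's inequality: n times the indicator of `n ≤ exceptional c` is at most `exceptional c`.
  -- Summed over all codes, this reduces the claim to the bounds on tips and cycles.
  few-exceptional : ∀ n → n₀ ≤ n → d * length (filter (λ c → n ℕ.≤? tipCount c + e * badness k c) (allCodes n)) ≤ length (allCodes n)
  few-exceptional n@(suc _) le = arithmetic {l = l} {St = St} {γ} {ϑ} (s≤s z≤n) 1≤d (s≤s z≤n) count (∑-tips n (4 * (γ * d))) (ℕ.≤-trans (ℕ.n≤1+n _) le)
    where
    open ℕ.≤-Reasoning
    L = allCodes n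
    St = ∑ L tipCount
    Sc = ∑ L (cycles k)
    l = length L
    E? : ∀ (c : Code n) → Dec (n ≤ exceptional c)
    E? c = n ℕ.≤? exceptional c
    markov : ∀ {x} (x? : Dec (n ≤ x)) → n * ⟦ x? ⟧ ≤ x
    markov (yes p) = ℕ.≤-trans (ℕ.≤-reflexive (ℕ.*-identityʳ n)) p
    markov (no _)  = ℕ.≤-trans (ℕ.≤-reflexive (ℕ.*-zeroʳ n)) z≤n
    Sc-≤ : Sc ≤ W * (l + ∑ L (λ c → tipCount c + suc k))
    Sc-≤ = ℕ.*-cancelˡ-≤ n (∑-cycles n k)
    regroup : ∀ a b w s l t → a * s + b * (w * (l + (s + l * suc t))) ≡ (a + b * w) * s + b * (w * (2 + t)) * l
    regroup = solve-∀
    count : n * length (filter E? L) ≤ γ * St + ϑ * l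
    count = begin
      n * length (filter E? L)                             ≡⟨ cong (n *_) (length-filter E? L) ⟩
      n * ∑ L (λ c → ⟦ E? c ⟧)                             ≡⟨ sym (∑-* L n _) ⟩
      ∑ L (λ c → n * ⟦ E? c ⟧)                             ≤⟨ ∑-mono L (λ {c} c∈ → ℕ.≤-trans (markov (E? c)) (exceptional-≤ (∈-allCodes⁻ c∈))) ⟩
      ∑ L (λ c → α * tipCount c + β * cycles k c)          ≡⟨ trans (∑-+ L _ _) (cong₂ _+_ (∑-* L α tipCount) (∑-* L β (cycles k))) ⟩
      α * St + β * Sc                                      ≤⟨ ℕ.+-monoʳ-≤ (α * St) (ℕ.*-monoʳ-≤ β Sc-≤) ⟩
      α * St + β * (W * (l + ∑ L (λ c → tipCount c + suc k))) ≡⟨ cong (λ s → α * St + β * (W * (l + s))) (trans (∑-+ L tipCount _) (cong (St +_) (∑-const L (suc k)))) ⟩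
      α * St + β * (W * (l + (St + l * suc k)))            ≡⟨ regroup α β W St l k ⟩
      γ * St + ϑ * l                                       ∎

convergence : ∀ {m} (κ : Kind m) R G → ConvergesInProbability enumeration (proportion m R G) (𝟙 (limit? κ R G))
convergence {m} κ R G ϵ δ 0<ϵ 0<δ =
  let e , above-ϵ = above ϵ 0<ϵ
      d , 1≤d , below = below-δ δ 0<δ
  in n₀ R e d 1≤d , λ n le → below _ _ (transfer n d (λ N → ϵ ℚ.<? ∣ proportion m R G N ℚ.- 𝟙 (limit? κ R G) ∣)
       (λ c → n ℕ.≤? tipCount c + e * badness (3 * suc (suc R)) c)
       (λ c! P lt → deviant c! P κ R G {e = e} above-ϵ lt)
       (few-exceptional R e d 1≤d n le))

theorem1p11 : Σ[ E ∈ (∀ n → Enumeration n) ] ∀ (R : ℕ) (G : FiniteGraph) →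
    ConvergesInProbability E (proportion tree R G) (𝟙 (ball≅? 𝓛.locallyFinite R 𝓛.p₀ G))
    × ConvergesInProbability E (proportion reticulation R G) (𝟙 (ball≅? 𝓡.locallyFinite R 𝓡.ρ₀ G))
    × ConvergesInProbability E (proportion leaf R G) (𝟙 (ball≅? 𝓡.locallyFinite R 𝓡.ℓ₀ G))
theorem1p11 = enumeration , λ R G → convergence tree R G , convergence reticulation R G , convergence leaf R G
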